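{- Suppose that $k$ and $s$ are constants and $c=\Theta(n^{ -\alpha})$ for some $\alpha\in(0,1)$. Let $\tau$ and $\kappa$ be the largest integers satisfying $\alpha\binom{\tau}{s-1}<1$ and $\alpha\binom{\kappa}{s-1}<s$, respectively, and let $C_t=2n^tc^{\binom{t}{s}}$ for each $s\le t\le k$. Then, on input $G\sim G(n,c,s)$, the algorithm IT-GEN-CLIQUES with the cutoffs $C_t$ outputs $S_k=\mathrm{cl}_k(G)$ with probability $1-n^{ -\omega(1)}$, where: (1) the runtime of IT-GEN-CLIQUES is $O\left(n^{\tau+2-\alpha\binom{\tau+1}{s}}\right)$ if $\tau+2\le k\le\kappa+1$; (2) the runtime of IT-GEN-CLIQUES is $O\left(n^{k-\alpha\binom{k-1}{s}}\right)$ if $k<\tau+2$.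
   Context: Here $2\le s\le k$ are integers. $G(n,c,s)$ is the Erdős–Rényi distribution on $s$-uniform hypergraphs with vertex set $[n]$, in which each of the $\binom{n}{s}$ possible hyperedges is included independently with probability $c$. A $t$-clique of $G$ is a $t$-subset $W$ of vertices with $\binom{W}{s}\subseteq E(G)$; $\mathrm{cl}_t(G)$ is the set of $t$-cliques of $G$ (so $\mathrm{cl}_{s-1}(G)$ is the set of all $(s-1)$-subsets of $[n]$). The deterministic algorithm IT-GEN-CLIQUES, on input an $s$-uniform hypergraph on $[n]$, takes in cutoffs $C_t$ and generates sets $S_{s-1},S_s,\dots,S_k$ as follows. (1) Initialize $S_{s-1}$ to be the set of all $(s-1)$-subsets of $[n]$. (2) Given $S_i$, for each vertex $v\in[n]$, iterate through all $A\in S_i$ and add $A\cup\{v\}$ to $S_{i+1}$ if $A\cup\{v\}$ is a clique and $v$ is larger than the labels of all vertices in $A$; stop if ever $|S_{i+1}|\ge C_{i+1}$. (3) Stop once $S_k$ has been generated and output $S_k$. The notation $n^{ -\omega(1)}$ denotes a quantity decaying faster than any fixed polynomial in $1/n$.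
   Formalization: The claim that the algorithm outputs S_k = cl_k(G) with probability 1 − n^{ -ω(1)} is stated only for k ≤ κ+1 (cases (1) and (2) together); for larger k it fails, since the cutoff C_{κ+2} = O(1) is reached with probability at least n^{ -O(1)}. -}

module Defs where

open import Algebra.Bundles using (CommutativeRing; Semiring)
import Algebra.Definitions.RawSemiring as RawSemiringDefinitions
open import Algebra.Structures using (IsCommutativeRing)
open import Data.Bool.Base using (Bool; true; false; if_then_else_; _∧_)
import Data.Bool.Properties as Bool
open import Data.Fin.Base using (Fin)
import Data.Fin.Properties as Fin
open import Data.Fin.Subset using (Subset; inside; outside; ∣_∣; ⁅_⁆; _∪_)
import Data.Fin.Subset.Properties as Subset
open import Data.Integer.Base using (ℤ; +_; -[1+_])
open import Data.List.Base using (List; []; _∷_; _++_; allFin; filter; length; lookup; map)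
import Data.List.Relation.Binary.Subset.DecPropositional as ListSubset
import Data.List.Membership.DecPropositional as ListMembership
open import Data.Maybe.Base using (Maybe; just; nothing; maybe′)
open import Data.Nat.Base using (ℕ; zero; suc; _+_; _∸_; _≤_)
open import Data.Nat.Combinatorics using (_C_)
import Data.Nat.Properties as ℕ
open import Data.Product.Base using (∃; ∃-syntax; _×_; _,_; proj₁; proj₂)
open import Data.Rational.Base using (↥_; ↧ₙ_)
import Data.Vec.Base as Vec
import Data.Vec.Properties as Vec
open import Level using (0ℓ)
open import Relation.Binary.Definitions using (DecidableEquality)
import Relation.Binary.Construct.NonStrictToStrict as NonStrictToStrict
open import Relation.Binary.PropositionalEquality using (_≡_; _≢_)
open import Relation.Binary.Structures using (IsDecTotalOrder)
open import Relation.Nullary using (Dec; does)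
open import Relation.Nullary.Decidable using (_×-dec_)

-- The classical real numbers, characterised (uniquely up to isomorphism)
-- as a Dedekind-complete ordered field.
-- `_⁻¹` and `sup` are total; they are only constrained where the inverse,
-- respectively the least upper bound, exists.  The order is decidable, as
-- it is classically.  Completeness implies `archimedean` classically; it is
-- a field so that it supplies a witness.
record Reals : Set₁ where
  infix  8 _⁻¹
  infix  8 -ᴿ_
  infixl 7 _*ᴿ_
  infixl 6 _+ᴿ_ _-ᴿ_
  infix  4 _≤ᴿ_
  field
    ℝ         : Set
    _+ᴿ_ _*ᴿ_ : ℝ → ℝ → ℝ
    -ᴿ_ _⁻¹   : ℝ → ℝ
    0ᴿ 1ᴿ     : ℝ
    _≤ᴿ_      : ℝ → ℝ → Set
    sup       : (ℝ → Set) → ℝ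

  IsUpperBound : (ℝ → Set) → ℝ → Set
  IsUpperBound P b = ∀ x → P x → x ≤ᴿ b

  IsLeastUpperBound : (ℝ → Set) → ℝ → Set
  IsLeastUpperBound P b = IsUpperBound P b × (∀ b′ → IsUpperBound P b′ → b ≤ᴿ b′)

  field
    isCommutativeRing : IsCommutativeRing _≡_ _+ᴿ_ _*ᴿ_ -ᴿ_ 0ᴿ 1ᴿ
    0≢1               : 0ᴿ ≢ 1ᴿ
    ⁻¹-inverse        : ∀ x → x ≢ 0ᴿ → x *ᴿ x ⁻¹ ≡ 1ᴿ
    isDecTotalOrder   : IsDecTotalOrder _≡_ _≤ᴿ_
    +-mono            : ∀ {x y} z → x ≤ᴿ y → x +ᴿ z ≤ᴿ y +ᴿ z
    *-nonNegative     : ∀ {x y} → 0ᴿ ≤ᴿ x → 0ᴿ ≤ᴿ y → 0ᴿ ≤ᴿ x *ᴿ y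
    sup-isLUB         : ∀ P → ∃ P → ∃ (IsUpperBound P) →
                        IsLeastUpperBound P (sup P)

  commutativeRing : CommutativeRing 0ℓ 0ℓ
  commutativeRing = record { isCommutativeRing = isCommutativeRing }

  open RawSemiringDefinitions (Semiring.rawSemiring (CommutativeRing.semiring commutativeRing)) public
    using () renaming (_^_ to _^ᴿ_; _×_ to _×ᴿ_)

  fromℕ : ℕ → ℝ
  fromℕ n = n ×ᴿ 1ᴿ

  field
    archimedean : ∀ x → ∃[ n ] (x ≤ᴿ fromℕ n)

  _-ᴿ_ : ℝ → ℝ → ℝ
  x -ᴿ y = x +ᴿ -ᴿ y

  open NonStrictToStrict _≡_ _≤ᴿ_ public using () renaming (_<_ to infix 4 _<ᴿ_)
  open IsDecTotalOrder isDecTotalOrder public using () renaming (_≤?_ to infix 4 _≤ᴿ?_)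

  fromℤ : ℤ → ℝ
  fromℤ (+ n)      = fromℕ n
  fromℤ (-[1+ n ]) = -ᴿ fromℕ (suc n)

  infixr 8 _^ℤ_
  _^ℤ_ : ℝ → ℤ → ℝ
  x ^ℤ (+ n)      = x ^ᴿ n
  x ^ℤ (-[1+ n ]) = (x ⁻¹) ^ᴿ suc n

  -- x ^ a for x ≥ 1: the supremum of x ^ r over the rationals r ≤ a, where
  -- y ≤ x ^ (p / q) is expressed, for y ≥ 0, as y ^ q ≤ x ^ p.
  infixr 8 _**_
  _**_ : ℝ → ℝ → ℝ
  x ** a = sup λ y → 0ᴿ ≤ᴿ y ×
    ∃[ r ] (fromℤ (↥ r) ≤ᴿ fromℕ (↧ₙ r) *ᴿ a × y ^ᴿ (↧ₙ r) ≤ᴿ x ^ℤ (↥ r))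

_≟ˢ_ : ∀ {n} → DecidableEquality (Subset n)
_≟ˢ_ = Vec.≡-dec Bool._≟_

module _ {n : ℕ} where
  open ListMembership (_≟ˢ_ {n}) public using (_∈_; _∈?_)
  open ListSubset (_≟ˢ_ {n}) public using (_⊆_; _⊆?_)

allSubsets : ∀ n → List (Subset n)
allSubsets zero    = Vec.[] ∷ []
allSubsets (suc n) = map (inside Vec.∷_) (allSubsets n) ++ map (outside Vec.∷_) (allSubsets n)

subsetsOfSize : ℕ → ∀ n → List (Subset n)
subsetsOfSize t n = filter (λ W → ∣ W ∣ ℕ.≟ t) (allSubsets n)

-- An s-uniform hypergraph on Fin n.  Its edges are given by their positions
-- in the repetition-free list of all s-subsets of Fin n, so that the random
-- hypergraph below is a sequence of independent coin flips.
record Hypergraph (n s : ℕ) : Set where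
  constructor hypergraph
  field
    edgePositions : Subset (length (subsetsOfSize s n))

  edges : List (Subset n)
  edges = map (lookup (subsetsOfSize s n))
              (filter (Subset._∈? edgePositions) (allFin (length (subsetsOfSize s n))))

open Hypergraph public using (edges)

binom : ∀ {n} → Subset n → ℕ → List (Subset n)
binom {n} W s = filter (Subset._⊆? W) (subsetsOfSize s n)

IsClique : ∀ {n s} → Hypergraph n s → Subset n → Set
IsClique {s = s} G W = binom W s ⊆ edges G

isClique? : ∀ {n s} (G : Hypergraph n s) (W : Subset n) → Dec (IsClique G W)
isClique? {s = s} G W = binom W s ⊆? edges G

cl : ∀ {n s} → ℕ → Hypergraph n s → List (Subset n)
cl {n} t G = filter (isClique? G) (subsetsOfSize t n)

-- A computation: the number of steps taken, and its output unless it halts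
-- without one.
Comp : Set → Set
Comp A = ℕ × Maybe A

return : ∀ {A} → A → Comp A
return a = 0 , just a

halt : ∀ {A} → Comp A
halt = 0 , nothing

tick : ∀ {A} → Comp A → Comp A
tick (t , r) = suc t , r

infixl 1 _>>=_
_>>=_ : ∀ {A B} → Comp A → (A → Comp B) → Comp B
(t , nothing) >>= f = t , nothing
(t , just a)  >>= f = let (u , r) = f a in t + u , r

steps : ∀ {A} → Comp A → ℕ
steps = proj₁

output : ∀ {A} → Comp A → Maybe A
output = proj₂

-- Each iteration of a loop costs one step in addition to its body.
forEach : ∀ {A B : Set} → List A → B → (A → B → Comp B) → Comp B
forEach []       b f = return b
forEach (a ∷ as) b f = tick (f a b) >>= λ b′ → forEach as b′ f

-- Unit-cost model: a set of at most k vertices (k fixed) takes O(1) words, so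
-- forming A ∪ ⁅ v ⁆ and listing its elements and its s-subsets is charged
-- through the steps that visit them.  Comparing two labels, querying one
-- s-set for being an edge, inserting a set in a list (with its length
-- maintained) and comparing a length with a cutoff each take one step, as
-- does each loop iteration.
module WithReals (R : Reals) where
  open Reals R

  isAbove : ∀ {n} → Fin n → Subset n → Comp Bool
  isAbove {n} v A = forEach (filter (Subset._∈? A) (allFin n)) true
    λ w b → tick (return (b ∧ does (w Fin.<? v)))

  testClique : ∀ {n s} → Hypergraph n s → Subset n → Comp Bool
  testClique {s = s} G W = forEach (binom W s) true
    λ e b → tick (return (b ∧ does (e ∈? edges G)))

  -- Insertion, halting the whole algorithm once the cutoff is reached.
  insert : ∀ {n} → ℝ → Subset n → List (Subset n) → Comp (List (Subset n))
  insert cutoff W S = tick (tick (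
    if does (cutoff ≤ᴿ? fromℕ (length (W ∷ S))) then halt else return (W ∷ S)))

  -- From S = S_i to S_{i+1}, with cutoff C_{i+1}.
  next : ∀ {n s} → Hypergraph n s → ℝ → List (Subset n) → Comp (List (Subset n))
  next {n} G cutoff S =
    forEach (allFin n) [] λ v S₁ →
      forEach S S₁ λ A S′ →
        isAbove v A >>= λ above →
        testClique G (A ∪ ⁅ v ⁆) >>= λ clique →
        if clique ∧ above then insert cutoff (A ∪ ⁅ v ⁆) S′ else return S′

  -- `grow G cut t m` computes S_t, …, S_{t+m-1} successively from S_{t-1}.
  grow : ∀ {n s} → Hypergraph n s → (ℕ → ℝ) → ℕ → ℕ → List (Subset n) → Comp (List (Subset n))
  grow G cut t zero    S = return S
  grow G cut t (suc m) S = next G (cut t) S >>= grow G cut (suc t) m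

  -- Writing one of the initial sets costs one step per label.
  initial : ∀ n s → Comp (List (Subset n))
  initial n s = forEach (subsetsOfSize (s ∸ 1) n) []
    λ A S → forEach (filter (Subset._∈? A) (allFin n)) (A ∷ S) λ _ → return

  it-gen-cliques : ∀ {n s} → ℕ → (ℕ → ℝ) → Hypergraph n s → Comp (List (Subset n))
  it-gen-cliques {n} {s} k cut G = initial n s >>= grow G cut s (suc k ∸ s)

  -- The algorithm outputs S_k, and S_k equals cl_k(G) as a set.
  outputsCliques : ∀ {n s} → ℕ → (ℕ → ℝ) → Hypergraph n s → Bool
  outputsCliques k cut G =
    maybe′ (λ S → does ((S ⊆? cl k G) ×-dec (cl k G ⊆? S))) false
           (output (it-gen-cliques k cut G))

  -- The product measure: m independent coins, each `inside` with probability p.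
  flipPr : ℝ → ∀ m → (Subset m → Bool) → ℝ
  flipPr p zero    E = if E Vec.[] then 1ᴿ else 0ᴿ
  flipPr p (suc m) E = p *ᴿ flipPr p m (λ x → E (inside Vec.∷ x))
                    +ᴿ (1ᴿ -ᴿ p) *ᴿ flipPr p m (λ x → E (outside Vec.∷ x))

  Pr : ∀ n → ℝ → ∀ s → (Hypergraph n s → Bool) → ℝ
  Pr n p s E = flipPr p (length (subsetsOfSize s n)) (λ x → E (hypergraph x))

  infix 4 _=Θ_
  _=Θ_ : (ℕ → ℝ) → (ℕ → ℝ) → Set
  f =Θ g = ∃[ a ] ∃[ b ] ∃[ N ] (0ᴿ <ᴿ a × 0ᴿ <ᴿ b ×
    (∀ n → N ≤ n → a *ᴿ g n ≤ᴿ f n × f n ≤ᴿ b *ᴿ g n))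

  -- δ(n) = n^{-ω(1)}
  Negligible : (ℕ → ℝ) → Set
  Negligible δ = ∀ d → ∃[ N ] (∀ n → N ≤ n →
    -ᴿ ((fromℕ n ⁻¹) ^ᴿ d) ≤ᴿ δ n × δ n ≤ᴿ (fromℕ n ⁻¹) ^ᴿ d)

  -- The worst-case running time over all inputs on n vertices is O(g(n)).
  -- `cut n t` is the cutoff C_t for inputs on n vertices.
  RunsInO : (s k : ℕ) → (cut : ℕ → ℕ → ℝ) → (ℕ → ℝ) → Set
  RunsInO s k cut g = ∃[ K ] ∃[ N ] (∀ n → N ≤ n → (G : Hypergraph n s) →
    fromℕ (steps (it-gen-cliques k (cut n) G)) ≤ᴿ K *ᴿ g n)

  cutoffs : (s : ℕ) → (c : ℕ → ℝ) → ℕ → ℕ → ℝ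
  cutoffs s c n t = fromℕ 2 *ᴿ fromℕ n ^ᴿ t *ᴿ c n ^ᴿ (t C s)

IsLargest : (ℕ → Set) → ℕ → Set
IsLargest P m = P m × (∀ m′ → P m′ → m′ ≤ m)

{-# OPTIONS --safe #-}

-- The number X of t-cliques is controlled by a moment of order r ≈ log n.  Writing X as a sum of
-- products of coin indicators, E[X^r] grows by one clique W at a time: if the earlier cliques span a
-- vertex set V, then W costs c ^ ((t C s) - (j C s)) with j = ∣ V ∩ W ∣, and since n ^ j c ^ (j C s) is a
-- positive power of n for 1 ≤ j ≤ κ + 1 while ∣ V ∣ is polylogarithmic, the cliques meeting V contribute at
-- most half as much as the others.  Hence E[X^r] ≤ (3/2 n^t c^(t C s))^r, and Markov's inequality bounds the
-- probability of reaching the cutoff C_t by (3/4)^r.  If no cutoff is reached, every clique is found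
-- exactly once, by adding its largest vertex last.  The running time is a sum of the terms
-- n C_i ≈ n ^ (i + 1 - α (i C s)), whose exponents increase up to i = τ + 1 and decrease afterwards.

module Submission where

open import Defs
open import Data.Nat.Base as ℕ using (ℕ; zero; suc; _+_; _*_; _^_; _∸_; _≤_; _<_; z≤n; s≤s)
open import Data.Nat.Combinatorics using (_C_; nCk+nC[k+1]≡[n+1]C[k+1]; nC1≡n)
open import Data.Product.Base using (∃; ∃-syntax; _×_; _,_; proj₁; proj₂)
open import Data.Sum.Base using (_⊎_; inj₁; inj₂)
open import Algebra.Bundles using (CommutativeRing)
import Algebra.Properties.CommutativeSemiring.Exp as Exp
import Algebra.Properties.Ring as RingProperties
import Algebra.Properties.Semiring.Mult as Mult
import Algebra.Solver.Ring.NaturalCoefficients.Default as SemiringSolver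
open import Data.Bool.Base using (Bool; true; false; if_then_else_; _∧_)
import Data.Bool.Properties as Bool
open import Data.Empty using (⊥-elim)
open import Data.Fin.Base as Fin using (Fin; zero; suc)
import Data.Fin.Properties as Fin
open import Data.Fin.Subset using (Subset; inside; outside; ∣_∣; ⁅_⁆; _∪_; _∩_) renaming (_∈_ to _∈ˢ_; _∉_ to _∉ˢ_; _⊆_ to _⊆ˢ_; ⊥ to ∅)
import Data.Fin.Subset.Properties as Subset
import Data.Integer.Base as ℤ
import Data.Integer.Properties as ℤ
open import Data.List.Base as List using (List; []; _∷_; _++_; _ʳ++_; allFin; concatMap; filter; foldl; length; lookup; map; reverse; upTo)
open import Data.List.Membership.Propositional using (find; lose) renaming (_∈_ to _∈ᴸ_)
open import Data.List.Membership.Propositional.Properties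
  using (∈-filter⁺; ∈-filter⁻; ∈-map⁺; ∈-map⁻; ∈-map∘filter⁺; ∈-map∘filter⁻; ∈-++⁺ˡ; ∈-++⁺ʳ; ∈-lookup; ∈-allFin; ∈-concatMap⁺; ∈-concatMap⁻; ∈-upTo⁺; ∈-upTo⁻)
import Data.List.Properties as List
open import Data.List.Relation.Binary.Permutation.Propositional using (↭-sym; ↭⇒↭ₛ)
open import Data.List.Relation.Binary.Permutation.Propositional.Properties using (↭-reverse; ∈-resp-↭)
import Data.List.Relation.Binary.Permutation.Setoid.Properties as Permutation
open import Data.List.Relation.Unary.All as All using (All; []; _∷_; all?)
import Data.List.Relation.Unary.All.Properties as All
open import Data.List.Relation.Unary.AllPairs as AllPairs using ([]; _∷_)
import Data.List.Relation.Unary.AllPairs.Properties as AllPairs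
open import Data.List.Relation.Unary.Any as Any using (Any; here; there; any?; index)
open import Data.List.Relation.Unary.Any.Properties using (lookup-index)
open import Data.List.Relation.Unary.Unique.Propositional using (Unique)
import Data.List.Relation.Unary.Unique.Propositional.Properties as Unique
open import Data.Maybe.Base using (Maybe; just; nothing; maybe′)
open import Data.Maybe.Properties using (just-injective)
open import Data.Nat.Combinatorics.Specification using (k>n⇒nCk≡0)
open import Data.Nat.DivMod using (_/_; _%_; m≡m%n+[m/n]*n; m%n<n)
open import Data.Nat.ListAction using (sum)
open import Data.Nat.ListAction.Properties using (sum-++)
import Data.Nat.Properties as ℕ
open import Data.Nat.Solver using (module +-*-Solver)
open import Data.Rational.Base using (ℚ; ↥_; ↧_; ↧ₙ_) renaming (_/_ to _/ℚ_)
import Data.Rational.Properties as ℚₚ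
open import Data.Unit.Base using (⊤; tt)
open import Data.Vec.Base as Vec using (Vec; []; _∷_; here; there)
import Data.Vec.Properties as Vec
open import Function.Base using (_∘_; id)
open import Level using (0ℓ)
open import Relation.Binary.Bundles using (Poset)
open import Relation.Binary.PropositionalEquality using (_≡_; _≢_; refl; sym; trans; cong; cong₂; subst; subst₂; setoid; module ≡-Reasoning)
import Relation.Binary.Reasoning.PartialOrder as PosetReasoning
open import Relation.Binary.Structures using (IsDecTotalOrder)
open import Relation.Nullary using (¬_; Dec; yes; no; does)
open import Relation.Nullary.Decidable using (_×-dec_; dec-true; dec-false)
open import Relation.Unary using (Pred; Decidable)

-- Ordered fields and real powers

-- Markov's inequality on a raw moment gains only a constant factor per order. To fall below n^(-d)
-- for every d, the order must grow like d log n, so the vertex set spanned by one term of the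
-- expanded power is not of bounded size. The margins n^j c^(j C s) must therefore beat powers of
-- log n, which is what the strict inequality α (j C s) < j provides for 1 ≤ j ≤ k.
--
-- The constant 3/2 comes from a product weight. Let v bound ∣ V ∣ and suppose n^j c^(j C s) ≥ (v
-- h)^j. Give each vertex of V the weight n and every other vertex the weight v h; the total is at
-- most v n (h + 1), and its t-th power dominates the sum over all t-sets. Relative to n^t (v h)^t
-- this loses (1 + 1/h)^t, which is at most 3/2 for h + 1 = 3 k.
--
-- Since `x ** a` is given only as a supremum, no law of exponents is proved for it. Two one-sided
-- estimates, each losing powers of 2, are enough because every use tolerates constants; rational
-- exponents are cleared by comparing natural powers.

n<2^n : ∀ n → n < 2 ^ n
n<2^n zero    = s≤s z≤n
n<2^n (suc n) = ℕ.+-mono-≤ (ℕ.m^n>0 2 n) (subst (suc n ≤_) (sym (ℕ.+-identityʳ (2 ^ n))) (n<2^n n))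

module OrderedField (R : Reals) where
  open Reals R public
  open CommutativeRing commutativeRing public
    using (commutativeSemiring; semiring; ring)
    renaming ( +-comm to +ᴿ-comm; +-assoc to +ᴿ-assoc; +-identityˡ to +ᴿ-identityˡ; +-identityʳ to +ᴿ-identityʳ
             ; *-comm to *ᴿ-comm; *-assoc to *ᴿ-assoc; *-identityˡ to *ᴿ-identityˡ; *-identityʳ to *ᴿ-identityʳ
             ; distribˡ to *ᴿ-distribˡ; distribʳ to *ᴿ-distribʳ; zeroˡ to *ᴿ-zeroˡ; zeroʳ to *ᴿ-zeroʳ
             ; -‿inverseʳ to +ᴿ-inverseʳ; -‿inverseˡ to +ᴿ-inverseˡ )
  open IsDecTotalOrder isDecTotalOrder public
    using (isPartialOrder)
    renaming (refl to ≤ᴿ-refl; reflexive to ≤ᴿ-reflexive; trans to ≤ᴿ-trans; antisym to ≤ᴿ-antisym; total to ≤ᴿ-total)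

  private
    poset : Poset _ _ _
    poset = record { isPartialOrder = isPartialOrder }

  module ≤ᴿ-Reasoning = PosetReasoning poset
  open ≤ᴿ-Reasoning
  open SemiringSolver commutativeSemiring public using (solve; _:+_; _:*_; _:=_; con)
  open Exp commutativeSemiring public using (^-homo-*; ^-assocʳ; ^-distrib-*)
  open Mult semiring using (×-homo-+; ×1-homo-*)
  open RingProperties ring using (-‿distribˡ-*; -‿involutive)

  infix 4 _≰ᴿ_
  _≰ᴿ_ : ℝ → ℝ → Set
  x ≰ᴿ y = ¬ (x ≤ᴿ y)

  ≰⇒≥ : ∀ {x y} → x ≰ᴿ y → y ≤ᴿ x
  ≰⇒≥ {x} {y} x≰y with ≤ᴿ-total x y
  ... | inj₁ x≤y = ⊥-elim (x≰y x≤y)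
  ... | inj₂ y≤x = y≤x

  <⇒≰ : ∀ {x y} → x <ᴿ y → y ≰ᴿ x
  <⇒≰ (x≤y , x≢y) y≤x = x≢y (≤ᴿ-antisym x≤y y≤x)

  ≰⇒> : ∀ {x y} → x ≰ᴿ y → y <ᴿ x
  ≰⇒> x≰y = ≰⇒≥ x≰y , λ y≡x → x≰y (≤ᴿ-reflexive (sym y≡x))

  <-≤-trans : ∀ {x y z} → x <ᴿ y → y ≤ᴿ z → x <ᴿ z
  <-≤-trans x<y y≤z = ≰⇒> λ z≤x → <⇒≰ x<y (≤ᴿ-trans y≤z z≤x)

  +-mono₂ : ∀ {a b c d} → a ≤ᴿ b → c ≤ᴿ d → a +ᴿ c ≤ᴿ b +ᴿ d
  +-mono₂ {a} {b} {c} {d} a≤b c≤d = begin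
    a +ᴿ c ≤⟨ +-mono c a≤b ⟩
    b +ᴿ c ≡⟨ +ᴿ-comm b c ⟩
    c +ᴿ b ≤⟨ +-mono b c≤d ⟩
    d +ᴿ b ≡⟨ +ᴿ-comm d b ⟩
    b +ᴿ d ∎

  +-cancelʳ-≤ : ∀ {x y} z → x +ᴿ z ≤ᴿ y +ᴿ z → x ≤ᴿ y
  +-cancelʳ-≤ {x} {y} z le = subst₂ _≤ᴿ_ (cancel x) (cancel y) (+-mono (-ᴿ z) le)
    where
    cancel : ∀ w → w +ᴿ z +ᴿ -ᴿ z ≡ w
    cancel w = trans (+ᴿ-assoc w z (-ᴿ z)) (trans (cong (w +ᴿ_) (+ᴿ-inverseʳ z)) (+ᴿ-identityʳ w))

  x-y+y≡x : ∀ x y → x -ᴿ y +ᴿ y ≡ x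
  x-y+y≡x x y = trans (+ᴿ-assoc x (-ᴿ y) y) (trans (cong (x +ᴿ_) (+ᴿ-inverseˡ y)) (+ᴿ-identityʳ x))

  x≤y⇒0≤y-x : ∀ {x y} → x ≤ᴿ y → 0ᴿ ≤ᴿ y -ᴿ x
  x≤y⇒0≤y-x {x} {y} x≤y = subst (_≤ᴿ y -ᴿ x) (+ᴿ-inverseʳ x) (+-mono (-ᴿ x) x≤y)

  x≤x+y : ∀ {x y} → 0ᴿ ≤ᴿ y → x ≤ᴿ x +ᴿ y
  x≤x+y {x} {y} 0≤y = subst (_≤ᴿ x +ᴿ y) (+ᴿ-identityʳ x) (+-mono₂ ≤ᴿ-refl 0≤y)

  0≤x+y : ∀ {x y} → 0ᴿ ≤ᴿ x → 0ᴿ ≤ᴿ y → 0ᴿ ≤ᴿ x +ᴿ y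
  0≤x+y 0≤x 0≤y = ≤ᴿ-trans 0≤x (x≤x+y 0≤y)

  0≤1 : 0ᴿ ≤ᴿ 1ᴿ
  0≤1 with ≤ᴿ-total 0ᴿ 1ᴿ
  ... | inj₁ le = le
  ... | inj₂ le = subst (0ᴿ ≤ᴿ_) -1*-1≡1 (*-nonNegative 0≤-1 0≤-1)
    where
    0≤-1 : 0ᴿ ≤ᴿ -ᴿ 1ᴿ
    0≤-1 = subst (0ᴿ ≤ᴿ_) (+ᴿ-identityˡ (-ᴿ 1ᴿ)) (x≤y⇒0≤y-x le)
    -1*-1≡1 : -ᴿ 1ᴿ *ᴿ -ᴿ 1ᴿ ≡ 1ᴿ
    -1*-1≡1 = trans (sym (-‿distribˡ-* 1ᴿ (-ᴿ 1ᴿ)))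
                    (trans (cong (-ᴿ_) (*ᴿ-identityˡ (-ᴿ 1ᴿ))) (-‿involutive 1ᴿ))

  0<1 : 0ᴿ <ᴿ 1ᴿ
  0<1 = 0≤1 , 0≢1

  *-monoʳ-≤ : ∀ {x y z} → 0ᴿ ≤ᴿ z → x ≤ᴿ y → x *ᴿ z ≤ᴿ y *ᴿ z
  *-monoʳ-≤ {x} {y} {z} 0≤z x≤y = begin
    x *ᴿ z                      ≡⟨ sym (+ᴿ-identityˡ _) ⟩
    0ᴿ +ᴿ x *ᴿ z                ≤⟨ +-mono (x *ᴿ z) (*-nonNegative (x≤y⇒0≤y-x x≤y) 0≤z) ⟩
    (y -ᴿ x) *ᴿ z +ᴿ x *ᴿ z     ≡⟨ sym (*ᴿ-distribʳ z (y -ᴿ x) x) ⟩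
    (y -ᴿ x +ᴿ x) *ᴿ z          ≡⟨ cong (_*ᴿ z) (x-y+y≡x y x) ⟩
    y *ᴿ z                      ∎

  *-monoˡ-≤ : ∀ {x y z} → 0ᴿ ≤ᴿ z → x ≤ᴿ y → z *ᴿ x ≤ᴿ z *ᴿ y
  *-monoˡ-≤ {x} {y} {z} 0≤z x≤y = subst₂ _≤ᴿ_ (*ᴿ-comm x z) (*ᴿ-comm y z) (*-monoʳ-≤ 0≤z x≤y)

  *-mono₂ : ∀ {a b c d} → 0ᴿ ≤ᴿ a → 0ᴿ ≤ᴿ c → a ≤ᴿ b → c ≤ᴿ d → a *ᴿ c ≤ᴿ b *ᴿ d
  *-mono₂ 0≤a 0≤c a≤b c≤d = ≤ᴿ-trans (*-monoʳ-≤ 0≤c a≤b) (*-monoˡ-≤ (≤ᴿ-trans 0≤a a≤b) c≤d)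

  x≤x*y : ∀ {x y} → 0ᴿ ≤ᴿ x → 1ᴿ ≤ᴿ y → x ≤ᴿ x *ᴿ y
  x≤x*y {x} {y} 0≤x 1≤y = subst (_≤ᴿ x *ᴿ y) (*ᴿ-identityʳ x) (*-monoˡ-≤ 0≤x 1≤y)

  ⁻¹-inverseˡ : ∀ {x} → 0ᴿ <ᴿ x → x ⁻¹ *ᴿ x ≡ 1ᴿ
  ⁻¹-inverseˡ {x} (_ , 0≢x) = trans (*ᴿ-comm (x ⁻¹) x) (⁻¹-inverse x λ x≡0 → 0≢x (sym x≡0))

  0<x⁻¹ : ∀ {x} → 0ᴿ <ᴿ x → 0ᴿ <ᴿ x ⁻¹
  0<x⁻¹ {x} 0<x = ≰⇒> λ x⁻¹≤0 → <⇒≰ 0<1 (begin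
    1ᴿ         ≡⟨ sym (⁻¹-inverseˡ 0<x) ⟩
    x ⁻¹ *ᴿ x  ≤⟨ *-monoʳ-≤ (proj₁ 0<x) x⁻¹≤0 ⟩
    0ᴿ *ᴿ x    ≡⟨ *ᴿ-zeroˡ x ⟩
    0ᴿ         ∎)

  *-cancelʳ-≤ : ∀ {x y} z → 0ᴿ <ᴿ z → x *ᴿ z ≤ᴿ y *ᴿ z → x ≤ᴿ y
  *-cancelʳ-≤ {x} {y} z 0<z le = subst₂ _≤ᴿ_ (cancel x) (cancel y) (*-monoʳ-≤ (proj₁ (0<x⁻¹ 0<z)) le)
    where
    cancel : ∀ w → w *ᴿ z *ᴿ z ⁻¹ ≡ w
    cancel w = trans (*ᴿ-assoc w z (z ⁻¹)) (trans (cong (w *ᴿ_) (trans (*ᴿ-comm z (z ⁻¹)) (⁻¹-inverseˡ 0<z))) (*ᴿ-identityʳ w))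

  *-cancelˡ-≤ : ∀ {x y} z → 0ᴿ <ᴿ z → z *ᴿ x ≤ᴿ z *ᴿ y → x ≤ᴿ y
  *-cancelˡ-≤ {x} {y} z 0<z le = *-cancelʳ-≤ z 0<z (subst₂ _≤ᴿ_ (*ᴿ-comm z x) (*ᴿ-comm z y) le)

  0<x*y : ∀ {x y} → 0ᴿ <ᴿ x → 0ᴿ <ᴿ y → 0ᴿ <ᴿ x *ᴿ y
  0<x*y {x} {y} 0<x 0<y = ≰⇒> λ xy≤0 → <⇒≰ 0<x (*-cancelʳ-≤ y 0<y (subst (x *ᴿ y ≤ᴿ_) (sym (*ᴿ-zeroˡ y)) xy≤0))

  0≤^ : ∀ {x} n → 0ᴿ ≤ᴿ x → 0ᴿ ≤ᴿ x ^ᴿ n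
  0≤^ zero    0≤x = 0≤1
  0≤^ (suc n) 0≤x = *-nonNegative 0≤x (0≤^ n 0≤x)

  0<^ : ∀ {x} n → 0ᴿ <ᴿ x → 0ᴿ <ᴿ x ^ᴿ n
  0<^ zero    0<x = 0<1
  0<^ (suc n) 0<x = 0<x*y 0<x (0<^ n 0<x)

  ^-monoˡ-≤ : ∀ {x y} n → 0ᴿ ≤ᴿ x → x ≤ᴿ y → x ^ᴿ n ≤ᴿ y ^ᴿ n
  ^-monoˡ-≤ zero    0≤x x≤y = ≤ᴿ-refl
  ^-monoˡ-≤ (suc n) 0≤x x≤y = *-mono₂ 0≤x (0≤^ n 0≤x) x≤y (^-monoˡ-≤ n 0≤x x≤y)

  1^n≡1 : ∀ n → 1ᴿ ^ᴿ n ≡ 1ᴿ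
  1^n≡1 zero    = refl
  1^n≡1 (suc n) = trans (*ᴿ-identityˡ _) (1^n≡1 n)

  1≤^ : ∀ {x} n → 1ᴿ ≤ᴿ x → 1ᴿ ≤ᴿ x ^ᴿ n
  1≤^ {x} n 1≤x = subst (_≤ᴿ x ^ᴿ n) (1^n≡1 n) (^-monoˡ-≤ n 0≤1 1≤x)

  ^≤1 : ∀ {x} n → 0ᴿ ≤ᴿ x → x ≤ᴿ 1ᴿ → x ^ᴿ n ≤ᴿ 1ᴿ
  ^≤1 {x} n 0≤x x≤1 = subst (x ^ᴿ n ≤ᴿ_) (1^n≡1 n) (^-monoˡ-≤ n 0≤x x≤1)

  ^-monoʳ-≤ : ∀ {x m n} → 1ᴿ ≤ᴿ x → m ℕ.≤ n → x ^ᴿ m ≤ᴿ x ^ᴿ n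
  ^-monoʳ-≤ {x} {n = n} 1≤x z≤n       = 1≤^ n 1≤x
  ^-monoʳ-≤ {x}         1≤x (s≤s m≤n) = *-monoˡ-≤ (≤ᴿ-trans 0≤1 1≤x) (^-monoʳ-≤ 1≤x m≤n)

  ^-antimonoʳ-≤ : ∀ {x m n} → 0ᴿ ≤ᴿ x → x ≤ᴿ 1ᴿ → m ℕ.≤ n → x ^ᴿ n ≤ᴿ x ^ᴿ m
  ^-antimonoʳ-≤ {x} {n = n} 0≤x x≤1 z≤n       = ^≤1 n 0≤x x≤1
  ^-antimonoʳ-≤ {x}         0≤x x≤1 (s≤s m≤n) = *-monoˡ-≤ 0≤x (^-antimonoʳ-≤ 0≤x x≤1 m≤n)

  -- Stands in for extracting roots: if `y < x`, then `x * x ^ n ≤ y * y ^ n ≤ y * x ^ n`, and the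
  -- positive factor `x ^ n` cancels.
  ^-cancelˡ-≤ : ∀ {x y} n → 0ᴿ ≤ᴿ x → 0ᴿ ≤ᴿ y → x ^ᴿ suc n ≤ᴿ y ^ᴿ suc n → x ≤ᴿ y
  ^-cancelˡ-≤ {x} {y} n 0≤x 0≤y le with x ≤ᴿ? y
  ... | yes x≤y = x≤y
  ... | no  x≰y = *-cancelʳ-≤ (x ^ᴿ n) (0<^ n (≤-<-trans 0≤y (≰⇒> x≰y)))
                    (≤ᴿ-trans le (*-monoˡ-≤ 0≤y (^-monoˡ-≤ n 0≤y (≰⇒≥ x≰y))))
    where
    ≤-<-trans : ∀ {x y z} → x ≤ᴿ y → y <ᴿ z → x <ᴿ z
    ≤-<-trans x≤y y<z = ≰⇒> λ z≤x → <⇒≰ y<z (≤ᴿ-trans z≤x x≤y)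

  fromℕ-+ : ∀ m n → fromℕ (m ℕ.+ n) ≡ fromℕ m +ᴿ fromℕ n
  fromℕ-+ = ×-homo-+ 1ᴿ

  fromℕ-* : ∀ m n → fromℕ (m ℕ.* n) ≡ fromℕ m *ᴿ fromℕ n
  fromℕ-* = ×1-homo-*

  fromℕ-1 : fromℕ 1 ≡ 1ᴿ
  fromℕ-1 = +ᴿ-identityʳ 1ᴿ

  2*x≡x+x : ∀ x → fromℕ 2 *ᴿ x ≡ x +ᴿ x
  2*x≡x+x = solve 1 (λ x → (con 1 :+ (con 1 :+ con 0)) :* x := x :+ x) refl

  fromℕ-^ : ∀ m n → fromℕ (m ℕ.^ n) ≡ fromℕ m ^ᴿ n
  fromℕ-^ m zero    = fromℕ-1
  fromℕ-^ m (suc n) = trans (fromℕ-* m (m ℕ.^ n)) (cong (fromℕ m *ᴿ_) (fromℕ-^ m n))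

  0≤fromℕ : ∀ n → 0ᴿ ≤ᴿ fromℕ n
  0≤fromℕ zero    = ≤ᴿ-refl
  0≤fromℕ (suc n) = 0≤x+y 0≤1 (0≤fromℕ n)

  fromℕ-mono-≤ : ∀ {m n} → m ℕ.≤ n → fromℕ m ≤ᴿ fromℕ n
  fromℕ-mono-≤ {n = n} z≤n = 0≤fromℕ n
  fromℕ-mono-≤ (s≤s m≤n)   = +-mono₂ ≤ᴿ-refl (fromℕ-mono-≤ m≤n)

  1≤fromℕ : ∀ {n} → 1 ℕ.≤ n → 1ᴿ ≤ᴿ fromℕ n
  1≤fromℕ {n} 1≤n = subst (_≤ᴿ fromℕ n) fromℕ-1 (fromℕ-mono-≤ 1≤n)

  0<fromℕ : ∀ {n} → 1 ℕ.≤ n → 0ᴿ <ᴿ fromℕ n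
  0<fromℕ 1≤n = <-≤-trans 0<1 (1≤fromℕ 1≤n)

  0<fromℕ-suc : ∀ n → 0ᴿ <ᴿ fromℕ (suc n)
  0<fromℕ-suc n = 0<fromℕ {suc n} (s≤s z≤n)

  1≤2 : 1ᴿ ≤ᴿ fromℕ 2
  1≤2 = 1≤fromℕ {2} (s≤s z≤n)

  0<2 : 0ᴿ <ᴿ fromℕ 2
  0<2 = 0<fromℕ-suc 1

  fromℕ-mono-< : ∀ {m n} → m ℕ.< n → fromℕ m <ᴿ fromℕ n
  fromℕ-mono-< {m} {n} m<n = ≰⇒> λ n≤m → <⇒≰ 0<1 (+-cancelʳ-≤ (fromℕ m) (begin
    1ᴿ +ᴿ fromℕ m  ≤⟨ fromℕ-mono-≤ m<n ⟩
    fromℕ n        ≤⟨ n≤m ⟩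
    fromℕ m        ≡⟨ sym (+ᴿ-identityˡ _) ⟩
    0ᴿ +ᴿ fromℕ m  ∎))

  ceiling : ∀ {x} → 0ᴿ ≤ᴿ x → ∃[ m ] (x ≤ᴿ fromℕ m × fromℕ m ≤ᴿ x +ᴿ 1ᴿ)
  ceiling {x} 0≤x = let (n , x≤n) = archimedean x in search n x≤n
    where
    search : ∀ n → x ≤ᴿ fromℕ n → ∃[ m ] (x ≤ᴿ fromℕ m × fromℕ m ≤ᴿ x +ᴿ 1ᴿ)
    search zero    x≤0 = zero , x≤0 , 0≤x+y 0≤x 0≤1
    search (suc n) x≤1+n with x ≤ᴿ? fromℕ n
    ... | yes x≤n = search n x≤n
    ... | no  x≰n = suc n , x≤1+n , subst (_≤ᴿ x +ᴿ 1ᴿ) (+ᴿ-comm (fromℕ n) 1ᴿ) (+-mono 1ᴿ (≰⇒≥ x≰n))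

module RealPowers (R : Reals) where
  open import Data.Integer.Base using (ℤ; +_; -[1+_]; _⊖_)
  open OrderedField R
  open ≤ᴿ-Reasoning

  -- Integer exponents are treated as differences `m ⊖ n`. Multiplying by `x ^ᴿ n` then turns each
  -- claim about them into one about natural powers.
  ^ℤ-⊖ : ∀ {x} → 0ᴿ <ᴿ x → ∀ m n → x ^ℤ (m ⊖ n) *ᴿ x ^ᴿ n ≡ x ^ᴿ m
  ^ℤ-⊖ {x} 0<x m       zero    = *ᴿ-identityʳ (x ^ᴿ m)
  ^ℤ-⊖ {x} 0<x zero    (suc n) = trans (sym (^-distrib-* (x ⁻¹) x (suc n)))
                                   (trans (cong (_^ᴿ suc n) (⁻¹-inverseˡ 0<x)) (1^n≡1 (suc n)))
  ^ℤ-⊖ {x} 0<x (suc m) (suc n) rewrite ℤ.[1+m]⊖[1+n]≡m⊖n m n =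
    trans (solve 3 (λ a b c → a :* (b :* c) := b :* (a :* c)) refl (x ^ℤ (m ⊖ n)) x (x ^ᴿ n))
          (cong (x *ᴿ_) (^ℤ-⊖ 0<x m n))

  fromℤ-⊖ : ∀ m n → fromℤ (m ⊖ n) +ᴿ fromℕ n ≡ fromℕ m
  fromℤ-⊖ m       zero    = +ᴿ-identityʳ (fromℕ m)
  fromℤ-⊖ zero    (suc n) = +ᴿ-inverseˡ (fromℕ (suc n))
  fromℤ-⊖ (suc m) (suc n) rewrite ℤ.[1+m]⊖[1+n]≡m⊖n m n =
    trans (solve 3 (λ a b c → a :+ (b :+ c) := b :+ (a :+ c)) refl (fromℤ (m ⊖ n)) 1ᴿ (fromℕ n))
          (cong (1ᴿ +ᴿ_) (fromℤ-⊖ m n))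

  ⊖-surjective : ∀ i → ∃[ m ] ∃[ n ] (i ≡ m ⊖ n)
  ⊖-surjective (+ m)    = m , 0 , refl
  ⊖-surjective -[1+ n ] = 0 , suc n , refl

  ⊖-*-+ : ∀ m n g → (m ⊖ n) ℤ.* (+ g) ≡ (m ℕ.* g) ⊖ (n ℕ.* g)
  ⊖-*-+ m n g = trans (cong (ℤ._* + g) (sym (ℤ.m-n≡m⊖n m n)))
    (trans (ℤ.*-distribʳ-+ (+ g) (+ m) (ℤ.- + n))
    (trans (cong₂ ℤ._+_ (sym (ℤ.pos-* m g))
                        (trans (sym (ℤ.neg-distribˡ-* (+ n) (+ g))) (cong ℤ.-_ (sym (ℤ.pos-* n g)))))
           (ℤ.m-n≡m⊖n (m ℕ.* g) (n ℕ.* g))))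

  -- The set whose supremum is x ** a.
  Below : ℝ → ℝ → ℝ → Set
  Below x a y = 0ᴿ ≤ᴿ y ×
    ∃[ r ] (fromℤ (↥ r) ≤ᴿ fromℕ (↧ₙ r) *ᴿ a × y ^ᴿ (↧ₙ r) ≤ᴿ x ^ℤ (↥ r))

  -- The same condition for a fraction (m - n) / q that need not be in lowest terms.
  BelowFraction : ℝ → ℝ → ℝ → ℕ → ℕ → ℕ → Set
  BelowFraction x a y m n q =
    fromℕ m ≤ᴿ fromℕ q *ᴿ a +ᴿ fromℕ n × y ^ᴿ q *ᴿ x ^ᴿ n ≤ᴿ x ^ᴿ m

  below⁻ : ∀ {x a y} → 0ᴿ <ᴿ x → Below x a y → ∃[ m ] ∃[ n ] ∃[ q ] BelowFraction x a y m n (suc q)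
  below⁻ {x} {a} {y} 0<x (0≤y , r , r≤a , y^q≤) with ⊖-surjective (↥ r)
  ... | m , n , eq rewrite eq = m , n , ℚ.denominator-1 r
    , subst (_≤ᴿ fromℕ (↧ₙ r) *ᴿ a +ᴿ fromℕ n) (fromℤ-⊖ m n) (+-mono (fromℕ n) r≤a)
    , subst (y ^ᴿ (↧ₙ r) *ᴿ x ^ᴿ n ≤ᴿ_) (^ℤ-⊖ 0<x m n) (*-monoʳ-≤ (0≤^ n (proj₁ 0<x)) y^q≤)

  -- The linear inequality is divided by `suc g`; the power inequality is the `suc g`-th power of
  -- the reduced one, so `^-cancelˡ-≤` applies.
  belowFraction-reduce : ∀ {x a y m n q} g → 0ᴿ <ᴿ x → 0ᴿ ≤ᴿ y →
    BelowFraction x a y (m ℕ.* suc g) (n ℕ.* suc g) (q ℕ.* suc g) → BelowFraction x a y m n q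
  belowFraction-reduce {x} {a} {y} {m} {n} {q} g 0<x 0≤y (m≤ , y^q≤) =
    *-cancelʳ-≤ (fromℕ (suc g)) (0<fromℕ-suc g) (subst₂ _≤ᴿ_ (fromℕ-* m (suc g)) rhs m≤) ,
    ^-cancelˡ-≤ g (*-nonNegative (0≤^ q 0≤y) (0≤^ n (proj₁ 0<x))) (0≤^ m (proj₁ 0<x))
      (subst₂ _≤ᴿ_ lhs (sym (^-assocʳ x m (suc g))) y^q≤)
    where
    rhs : fromℕ (q ℕ.* suc g) *ᴿ a +ᴿ fromℕ (n ℕ.* suc g) ≡ (fromℕ q *ᴿ a +ᴿ fromℕ n) *ᴿ fromℕ (suc g)
    rhs = trans (cong₂ (λ u v → u *ᴿ a +ᴿ v) (fromℕ-* q (suc g)) (fromℕ-* n (suc g)))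
                (solve 4 (λ q g a n → q :* g :* a :+ n :* g := (q :* a :+ n) :* g) refl
                   (fromℕ q) (fromℕ (suc g)) a (fromℕ n))
    lhs : y ^ᴿ (q ℕ.* suc g) *ᴿ x ^ᴿ (n ℕ.* suc g) ≡ (y ^ᴿ q *ᴿ x ^ᴿ n) ^ᴿ suc g
    lhs = trans (cong₂ _*ᴿ_ (sym (^-assocʳ y q (suc g))) (sym (^-assocʳ x n (suc g))))
                (sym (^-distrib-* (y ^ᴿ q) (x ^ᴿ n) (suc g)))

  -- The factor removed by normalisation cannot be zero, since its product with the reduced
  -- denominator is `suc q`.
  lowest-terms : ∀ i q → ∃[ r ] ∃[ g ] (↥ r ℤ.* + suc g ≡ i × ↧ₙ r ℕ.* suc g ≡ suc q)
  lowest-terms i q = go (i /ℚ suc q) _ (ℚₚ.↥-/ i (suc q)) (ℚₚ.↧-/ i (suc q))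
    where
    go : ∀ r h → ↥ r ℤ.* + h ≡ i → ↧ r ℤ.* + h ≡ + suc q →
         ∃[ r ] ∃[ g ] (↥ r ℤ.* + suc g ≡ i × ↧ₙ r ℕ.* suc g ≡ suc q)
    go r zero    num den with () ← trans (sym den) (ℤ.*-zeroʳ (↧ r))
    go r (suc g) num den = r , g , num , ℤ.+-injective (trans (ℤ.pos-* (↧ₙ r) (suc g)) den)

  -- The supremum defining `**` ranges over normalised rationals; this permits any convenient
  -- fraction as a witness.
  below⁺ : ∀ {x a y} m n q → 0ᴿ <ᴿ x → 0ᴿ ≤ᴿ y → BelowFraction x a y m n (suc q) → Below x a y
  below⁺ {x} {a} {y} m n q 0<x 0≤y (m≤ , y^q≤) with lowest-terms (m ⊖ n) q
  ... | r , g , num , q≡ with ⊖-surjective (↥ r)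
  ... | m′ , n′ , eq = 0≤y , r , r≤a , y^≤
    where
    cross : (m′ ℕ.* suc g) ⊖ (n′ ℕ.* suc g) ≡ m ⊖ n
    cross = trans (sym (⊖-*-+ m′ n′ (suc g))) (trans (cong (ℤ._* + suc g) (sym eq)) num)
    m≤′ : fromℤ (m ⊖ n) ≤ᴿ fromℕ (suc q) *ᴿ a
    m≤′ = +-cancelʳ-≤ (fromℕ n) (subst (_≤ᴿ _) (sym (fromℤ-⊖ m n)) m≤)
    y^q≤′ : y ^ᴿ suc q ≤ᴿ x ^ℤ (m ⊖ n)
    y^q≤′ = *-cancelʳ-≤ (x ^ᴿ n) (0<^ n 0<x) (subst (_ ≤ᴿ_) (sym (^ℤ-⊖ 0<x m n)) y^q≤)
    scaled : BelowFraction x a y (m′ ℕ.* suc g) (n′ ℕ.* suc g) (↧ₙ r ℕ.* suc g)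
    scaled = subst (_≤ᴿ fromℕ (↧ₙ r ℕ.* suc g) *ᴿ a +ᴿ fromℕ (n′ ℕ.* suc g)) (fromℤ-⊖ (m′ ℕ.* suc g) (n′ ℕ.* suc g))
               (+-mono (fromℕ (n′ ℕ.* suc g))
                 (subst₂ _≤ᴿ_ (cong fromℤ (sym cross)) (cong (λ k → fromℕ k *ᴿ a) (sym q≡)) m≤′))
           , subst (_ ≤ᴿ_) (^ℤ-⊖ 0<x (m′ ℕ.* suc g) (n′ ℕ.* suc g))
               (*-monoʳ-≤ (0≤^ (n′ ℕ.* suc g) (proj₁ 0<x))
                 (subst₂ _≤ᴿ_ (cong (y ^ᴿ_) (sym q≡)) (cong (x ^ℤ_) (sym cross)) y^q≤′))
    reduced : BelowFraction x a y m′ n′ (↧ₙ r)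
    reduced = belowFraction-reduce {m = m′} {n′} {↧ₙ r} g 0<x 0≤y scaled
    r≤a : fromℤ (↥ r) ≤ᴿ fromℕ (↧ₙ r) *ᴿ a
    r≤a = +-cancelʳ-≤ (fromℕ n′)
            (subst (_≤ᴿ _) (trans (sym (fromℤ-⊖ m′ n′)) (cong (λ i → fromℤ i +ᴿ fromℕ n′) (sym eq))) (proj₁ reduced))
    y^≤ : y ^ᴿ (↧ₙ r) ≤ᴿ x ^ℤ (↥ r)
    y^≤ = *-cancelʳ-≤ (x ^ᴿ n′) (0<^ n′ 0<x)
            (subst (_ ≤ᴿ_) (trans (sym (^ℤ-⊖ 0<x m′ n′)) (cong (λ i → x ^ℤ i *ᴿ x ^ᴿ n′) (sym eq))) (proj₂ reduced))

  module _ {x : ℝ} (1≤x : 1ᴿ ≤ᴿ x) where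
    private
      0<x : 0ᴿ <ᴿ x
      0<x = <-≤-trans 0<1 1≤x
      0≤x : 0ᴿ ≤ᴿ x
      0≤x = proj₁ 0<x

    below-bounded : ∀ a → ∃ (IsUpperBound (Below x a))
    below-bounded a with archimedean a
    ... | N , a≤N = x ^ᴿ N , bound
      where
      bound : IsUpperBound (Below x a) (x ^ᴿ N)
      bound y below@(0≤y , _) with below⁻ 0<x below
      ... | m , n , q , m≤ , y^q≤ = ^-cancelˡ-≤ q 0≤y (0≤^ N 0≤x)
        (*-cancelʳ-≤ (x ^ᴿ n) (0<^ n 0<x) (begin
          y ^ᴿ suc q *ᴿ x ^ᴿ n           ≤⟨ y^q≤ ⟩
          x ^ᴿ m                         ≤⟨ ^-monoʳ-≤ 1≤x m≤ℕ ⟩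
          x ^ᴿ (N ℕ.* suc q ℕ.+ n)       ≡⟨ ^-homo-* x (N ℕ.* suc q) n ⟩
          x ^ᴿ (N ℕ.* suc q) *ᴿ x ^ᴿ n   ≡⟨ cong (_*ᴿ x ^ᴿ n) (sym (^-assocʳ x N (suc q))) ⟩
          (x ^ᴿ N) ^ᴿ suc q *ᴿ x ^ᴿ n    ∎))
        where
        m≤ℕ : m ℕ.≤ N ℕ.* suc q ℕ.+ n
        m≤ℕ = ℕ.≮⇒≥ λ lt → <⇒≰ (fromℕ-mono-< lt) (begin
          fromℕ m                               ≤⟨ m≤ ⟩
          fromℕ (suc q) *ᴿ a +ᴿ fromℕ n         ≤⟨ +-mono (fromℕ n) (*-monoˡ-≤ (0≤fromℕ (suc q)) a≤N) ⟩
          fromℕ (suc q) *ᴿ fromℕ N +ᴿ fromℕ n   ≡⟨ cong (_+ᴿ fromℕ n) (*ᴿ-comm (fromℕ (suc q)) (fromℕ N)) ⟩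
          fromℕ N *ᴿ fromℕ (suc q) +ᴿ fromℕ n   ≡⟨ cong (_+ᴿ fromℕ n) (sym (fromℕ-* N (suc q))) ⟩
          fromℕ (N ℕ.* suc q) +ᴿ fromℕ n        ≡⟨ sym (fromℕ-+ (N ℕ.* suc q) n) ⟩
          fromℕ (N ℕ.* suc q ℕ.+ n)             ∎)

    below⇒≤** : ∀ {a y} → Below x a y → y ≤ᴿ x ** a
    below⇒≤** {a} {y} below = proj₁ (sup-isLUB (Below x a) (y , below) (below-bounded a)) y below

    **-lub : ∀ {a b} → ∃ (Below x a) → (∀ y → Below x a y → y ≤ᴿ b) → x ** a ≤ᴿ b
    **-lub {a} {b} inhabited = proj₂ (sup-isLUB (Below x a) inhabited (below-bounded a)) b

    -- Approximating x ** (- α) by powers of 1/2 avoids the existence of roots.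
    **-lower : ∀ {α} P q → α *ᴿ fromℕ (suc q) ≤ᴿ fromℕ P →
               1ᴿ ≤ᴿ (x ** (-ᴿ α) *ᴿ fromℕ 2) ^ᴿ suc q *ᴿ x ^ᴿ P
    **-lower {α} P q α≤P/Q with ≤ᴿ-total 1ᴿ ((x ** (-ᴿ α) *ᴿ fromℕ 2) ^ᴿ suc q *ᴿ x ^ᴿ P)
    ... | inj₁ le = le
    ... | inj₂ le = begin
        1ᴿ                               ≡⟨ sym (*ᴿ-identityˡ 1ᴿ) ⟩
        1ᴿ *ᴿ 1ᴿ                         ≤⟨ *-mono₂ 0≤1 0≤1 (1≤^ Q 1≤2z) (1≤^ P 1≤x) ⟩
        (z *ᴿ fromℕ 2) ^ᴿ Q *ᴿ x ^ᴿ P    ∎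
      where
      Q : ℕ
      Q = suc q
      z half : ℝ
      z = x ** (-ᴿ α)
      half = fromℕ 2 ⁻¹
      0<half : 0ᴿ <ᴿ half
      0<half = 0<x⁻¹ 0<2
      half*2 : half *ᴿ fromℕ 2 ≡ 1ᴿ
      half*2 = ⁻¹-inverseˡ 0<2
      Small : ℕ → Set
      Small i = (half ^ᴿ i) ^ᴿ Q *ᴿ x ^ᴿ P ≤ᴿ 1ᴿ
      small⇒≤z : ∀ i → Small i → half ^ᴿ i ≤ᴿ z
      small⇒≤z i small = below⇒≤** (below⁺ 0 P q 0<x (0≤^ i (proj₁ 0<half)) (0≤ , small))
        where
        0≤ : 0ᴿ ≤ᴿ fromℕ Q *ᴿ -ᴿ α +ᴿ fromℕ P
        0≤ = +-cancelʳ-≤ (α *ᴿ fromℕ Q) (begin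
          0ᴿ +ᴿ α *ᴿ fromℕ Q                               ≡⟨ +ᴿ-identityˡ _ ⟩
          α *ᴿ fromℕ Q                                     ≤⟨ α≤P/Q ⟩
          fromℕ P                                          ≡⟨ sym (+ᴿ-identityˡ _) ⟩
          0ᴿ +ᴿ fromℕ P                                    ≡⟨ cong (_+ᴿ fromℕ P) (sym (trans (cong (fromℕ Q *ᴿ_) (+ᴿ-inverseˡ α)) (*ᴿ-zeroʳ _))) ⟩
          fromℕ Q *ᴿ (-ᴿ α +ᴿ α) +ᴿ fromℕ P                ≡⟨ solve 4 (λ q n p a → q :* (n :+ a) :+ p := q :* n :+ p :+ a :* q) refl (fromℕ Q) (-ᴿ α) (fromℕ P) α ⟩
          fromℕ Q *ᴿ -ᴿ α +ᴿ fromℕ P +ᴿ α *ᴿ fromℕ Q       ∎)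
      -- A small `half ^ᴿ suc i` lies below `z`, so `half ^ᴿ i` is at most `2 z`, and the assumed
      -- failure `le` makes it small too. Descending to exponent 0 forces `1 ≤ z`.
      descend : ∀ i → Small (suc i) → Small i
      descend i small = begin
        (half ^ᴿ i) ^ᴿ Q *ᴿ x ^ᴿ P                    ≡⟨ cong (λ w → w ^ᴿ Q *ᴿ x ^ᴿ P) (sym double) ⟩
        (half ^ᴿ suc i *ᴿ fromℕ 2) ^ᴿ Q *ᴿ x ^ᴿ P     ≤⟨ *-monoʳ-≤ (0≤^ P 0≤x) (^-monoˡ-≤ Q
                                                           (*-nonNegative (0≤^ (suc i) (proj₁ 0<half)) (0≤fromℕ 2))
                                                           (*-monoʳ-≤ (0≤fromℕ 2) (small⇒≤z (suc i) small))) ⟩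
        (z *ᴿ fromℕ 2) ^ᴿ Q *ᴿ x ^ᴿ P                 ≤⟨ le ⟩
        1ᴿ                                            ∎
        where
        double : half ^ᴿ suc i *ᴿ fromℕ 2 ≡ half ^ᴿ i
        double = trans (solve 3 (λ h w t → h :* w :* t := h :* t :* w) refl half (half ^ᴿ i) (fromℕ 2))
                       (trans (cong (_*ᴿ half ^ᴿ i) half*2) (*ᴿ-identityˡ _))
      small₀ : ∀ i → Small i → Small 0
      small₀ zero    small = small
      small₀ (suc i) small = small₀ i (descend i small)
      small-start : ∃ Small
      small-start with archimedean x
      ... | M , x≤M = I , (begin
        (half ^ᴿ I) ^ᴿ Q *ᴿ x ^ᴿ P              ≤⟨ *-mono₂ (0≤^ Q (0≤^ I (proj₁ 0<half))) (0≤^ P 0≤x) halfs xs ⟩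
        half ^ᴿ I *ᴿ fromℕ 2 ^ᴿ I               ≡⟨ sym (^-distrib-* half (fromℕ 2) I) ⟩
        (half *ᴿ fromℕ 2) ^ᴿ I                  ≡⟨ trans (cong (_^ᴿ I) half*2) (1^n≡1 I) ⟩
        1ᴿ                                      ∎)
        where
        I : ℕ
        -- Chosen because `x ≤ M ≤ 2 ^ M` bounds `x ^ P` by `2 ^ (M * P)`.
        I = M ℕ.* P
        half≤1 : half ≤ᴿ 1ᴿ
        half≤1 = subst (half ≤ᴿ_) half*2 (x≤x*y (proj₁ 0<half) 1≤2)
        halfs : (half ^ᴿ I) ^ᴿ Q ≤ᴿ half ^ᴿ I
        halfs = subst (_≤ᴿ half ^ᴿ I) (sym (^-assocʳ half I Q))
                  (^-antimonoʳ-≤ (proj₁ 0<half) half≤1 (ℕ.m≤m*n I Q))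
        xs : x ^ᴿ P ≤ᴿ fromℕ 2 ^ᴿ I
        xs = begin
          x ^ᴿ P                    ≤⟨ ^-monoˡ-≤ P 0≤x x≤M ⟩
          fromℕ M ^ᴿ P              ≤⟨ ^-monoˡ-≤ P (0≤fromℕ M) (fromℕ-mono-≤ (ℕ.<⇒≤ (n<2^n M))) ⟩
          fromℕ (2 ℕ.^ M) ^ᴿ P      ≡⟨ cong (_^ᴿ P) (fromℕ-^ 2 M) ⟩
          (fromℕ 2 ^ᴿ M) ^ᴿ P       ≡⟨ ^-assocʳ (fromℕ 2) M P ⟩
          fromℕ 2 ^ᴿ I              ∎
      1≤2z : 1ᴿ ≤ᴿ z *ᴿ fromℕ 2
      1≤2z = ≤ᴿ-trans 1≤z (x≤x*y (≤ᴿ-trans 0≤1 1≤z) 1≤2)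
        where
        1≤z : 1ᴿ ≤ᴿ z
        1≤z = small⇒≤z 0 (small₀ (proj₁ small-start) (proj₂ small-start))

    -- The least upper bound property applies to inhabited sets only. Rounding `α` up to a natural
    -- `P` makes the natural power `(x ⁻¹) ^ P` a witness; its positivity carries over to
    -- `x ** (-ᴿ α)`.
    below-inhabited : ∀ α → 0ᴿ ≤ᴿ α → ∃[ y ] (0ᴿ <ᴿ y × Below x (-ᴿ α) y)
    below-inhabited α 0≤α with archimedean α
    ... | P , α≤P = y , 0<y , below⁺ 0 P 0 0<x (proj₁ 0<y) (0≤ , y^≤)
      where
      y : ℝ
      y = (x ⁻¹) ^ᴿ P
      0<y : 0ᴿ <ᴿ y
      0<y = 0<^ P (0<x⁻¹ 0<x)
      0≤ : 0ᴿ ≤ᴿ fromℕ 1 *ᴿ -ᴿ α +ᴿ fromℕ P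
      0≤ = begin
        0ᴿ                            ≤⟨ x≤y⇒0≤y-x α≤P ⟩
        fromℕ P +ᴿ -ᴿ α               ≡⟨ +ᴿ-comm _ _ ⟩
        -ᴿ α +ᴿ fromℕ P               ≡⟨ cong (_+ᴿ fromℕ P) (sym (*ᴿ-identityˡ _)) ⟩
        1ᴿ *ᴿ -ᴿ α +ᴿ fromℕ P         ≡⟨ cong (λ w → w *ᴿ -ᴿ α +ᴿ fromℕ P) (sym fromℕ-1) ⟩
        fromℕ 1 *ᴿ -ᴿ α +ᴿ fromℕ P    ∎
      y^≤ : y ^ᴿ 1 *ᴿ x ^ᴿ P ≤ᴿ 1ᴿ
      y^≤ = ≤ᴿ-reflexive (trans (cong (_*ᴿ x ^ᴿ P) (*ᴿ-identityʳ y))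
              (trans (sym (^-distrib-* (x ⁻¹) x P)) (trans (cong (_^ᴿ P) (⁻¹-inverseˡ 0<x)) (1^n≡1 P))))

    0<** : ∀ α → 0ᴿ ≤ᴿ α → 0ᴿ <ᴿ x ** (-ᴿ α)
    0<** α 0≤α = let (y , 0<y , below) = below-inhabited α 0≤α in <-≤-trans 0<y (below⇒≤** below)

    -- If `(m′ - n) / Q ≤ - α` witnesses that `y` is below `x ** (-ᴿ α)`, then
    -- `u + m (m′ - n) / Q ≤ u - m α ≤ E`. Over the denominator `Q` this is the fraction supplied
    -- for the product.
    below-^-* : ∀ {α E y} u m → fromℕ u ≤ᴿ E +ᴿ fromℕ m *ᴿ α →
                Below x (-ᴿ α) y → Below x E (x ^ᴿ u *ᴿ y ^ᴿ m)
    below-^-* {α} {E} {y} u m u≤ below@(0≤y , _) with below⁻ 0<x below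
    ... | m′ , n , q , m′≤ , y^Q≤ =
      below⁺ (u ℕ.* Q ℕ.+ m′ ℕ.* m) (n ℕ.* m) q 0<x (*-nonNegative (0≤^ u 0≤x) (0≤^ m 0≤y)) (le , pw)
      where
      Q : ℕ
      Q = suc q
      le : fromℕ (u ℕ.* Q ℕ.+ m′ ℕ.* m) ≤ᴿ fromℕ Q *ᴿ E +ᴿ fromℕ (n ℕ.* m)
      le = +-cancelʳ-≤ (fromℕ Q *ᴿ (fromℕ m *ᴿ -ᴿ α)) (begin
        fromℕ (u ℕ.* Q ℕ.+ m′ ℕ.* m) +ᴿ Qmα
          ≡⟨ cong (_+ᴿ Qmα) (trans (fromℕ-+ (u ℕ.* Q) (m′ ℕ.* m)) (cong₂ _+ᴿ_ (fromℕ-* u Q) (fromℕ-* m′ m))) ⟩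
        fromℕ u *ᴿ fromℕ Q +ᴿ fromℕ m′ *ᴿ fromℕ m +ᴿ Qmα
          ≤⟨ +-mono Qmα (+-mono₂ (*-monoʳ-≤ (0≤fromℕ Q) u≤) (*-monoʳ-≤ (0≤fromℕ m) m′≤)) ⟩
        (E +ᴿ fromℕ m *ᴿ α) *ᴿ fromℕ Q +ᴿ (fromℕ Q *ᴿ -ᴿ α +ᴿ fromℕ n) *ᴿ fromℕ m +ᴿ Qmα
          ≡⟨ solve 6 (λ E m α Q α′ n → (E :+ m :* α) :* Q :+ (Q :* α′ :+ n) :* m :+ Q :* (m :* α′)
                                    := Q :* E :+ n :* m :+ Q :* (m :* α′) :+ m :* Q :* (α :+ α′)) refl
               E (fromℕ m) α (fromℕ Q) (-ᴿ α) (fromℕ n) ⟩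
        fromℕ Q *ᴿ E +ᴿ fromℕ n *ᴿ fromℕ m +ᴿ Qmα +ᴿ fromℕ m *ᴿ fromℕ Q *ᴿ (α +ᴿ -ᴿ α)
          ≡⟨ trans (cong (λ w → fromℕ Q *ᴿ E +ᴿ fromℕ n *ᴿ fromℕ m +ᴿ Qmα +ᴿ w)
                     (trans (cong (fromℕ m *ᴿ fromℕ Q *ᴿ_) (+ᴿ-inverseʳ α)) (*ᴿ-zeroʳ _))) (+ᴿ-identityʳ _) ⟩
        fromℕ Q *ᴿ E +ᴿ fromℕ n *ᴿ fromℕ m +ᴿ Qmα
          ≡⟨ cong (λ w → fromℕ Q *ᴿ E +ᴿ w +ᴿ Qmα) (sym (fromℕ-* n m)) ⟩
        fromℕ Q *ᴿ E +ᴿ fromℕ (n ℕ.* m) +ᴿ Qmα ∎)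
        where
        Qmα : ℝ
        Qmα = fromℕ Q *ᴿ (fromℕ m *ᴿ -ᴿ α)
      pw : (x ^ᴿ u *ᴿ y ^ᴿ m) ^ᴿ Q *ᴿ x ^ᴿ (n ℕ.* m) ≤ᴿ x ^ᴿ (u ℕ.* Q ℕ.+ m′ ℕ.* m)
      pw = begin
        (x ^ᴿ u *ᴿ y ^ᴿ m) ^ᴿ Q *ᴿ x ^ᴿ (n ℕ.* m)
          ≡⟨ cong₂ _*ᴿ_ (^-distrib-* (x ^ᴿ u) (y ^ᴿ m) Q) (sym (^-assocʳ x n m)) ⟩
        (x ^ᴿ u) ^ᴿ Q *ᴿ (y ^ᴿ m) ^ᴿ Q *ᴿ (x ^ᴿ n) ^ᴿ m
          ≡⟨ cong₂ (λ v w → v *ᴿ w *ᴿ (x ^ᴿ n) ^ᴿ m) (^-assocʳ x u Q)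
               (trans (^-assocʳ y m Q) (trans (cong (y ^ᴿ_) (ℕ.*-comm m Q)) (sym (^-assocʳ y Q m)))) ⟩
        x ^ᴿ (u ℕ.* Q) *ᴿ (y ^ᴿ Q) ^ᴿ m *ᴿ (x ^ᴿ n) ^ᴿ m
          ≡⟨ trans (*ᴿ-assoc _ _ _) (cong (x ^ᴿ (u ℕ.* Q) *ᴿ_) (sym (^-distrib-* (y ^ᴿ Q) (x ^ᴿ n) m))) ⟩
        x ^ᴿ (u ℕ.* Q) *ᴿ (y ^ᴿ Q *ᴿ x ^ᴿ n) ^ᴿ m
          ≤⟨ *-monoˡ-≤ (0≤^ (u ℕ.* Q) 0≤x) (^-monoˡ-≤ m (*-nonNegative (0≤^ Q 0≤y) (0≤^ n 0≤x)) y^Q≤) ⟩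
        x ^ᴿ (u ℕ.* Q) *ᴿ (x ^ᴿ m′) ^ᴿ m
          ≡⟨ cong (x ^ᴿ (u ℕ.* Q) *ᴿ_) (^-assocʳ x m′ m) ⟩
        x ^ᴿ (u ℕ.* Q) *ᴿ x ^ᴿ (m′ ℕ.* m)
          ≡⟨ sym (^-homo-* x (u ℕ.* Q) (m′ ℕ.* m)) ⟩
        x ^ᴿ (u ℕ.* Q ℕ.+ m′ ℕ.* m) ∎

    -- If the bound failed, every y below x ** (- α) would be at most half of it.
    **-upper : ∀ {α E} u m → 0ᴿ ≤ᴿ α → fromℕ u ≤ᴿ E +ᴿ fromℕ m *ᴿ α →
               x ^ᴿ u *ᴿ (x ** (-ᴿ α)) ^ᴿ m ≤ᴿ fromℕ 2 ^ᴿ m *ᴿ x ** E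
    **-upper {α} {E} u m 0≤α u≤ with x ^ᴿ u *ᴿ (x ** (-ᴿ α)) ^ᴿ m ≤ᴿ? fromℕ 2 ^ᴿ m *ᴿ x ** E
    ... | yes le = le
    ... | no ≰ = ⊥-elim (<⇒≰ (0<** α 0≤α) (+-cancelʳ-≤ z (begin
        z +ᴿ z           ≡⟨ sym (2*x≡x+x z) ⟩
        fromℕ 2 *ᴿ z     ≤⟨ *-monoˡ-≤ (0≤fromℕ 2) z≤z/2 ⟩
        fromℕ 2 *ᴿ (half *ᴿ z)   ≡⟨ trans (sym (*ᴿ-assoc _ _ _)) (trans (cong (_*ᴿ z) (*ᴿ-comm _ _)) half*2*) ⟩
        z                ≡⟨ sym (+ᴿ-identityˡ z) ⟩
        0ᴿ +ᴿ z          ∎)))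
      where
      z half : ℝ
      z = x ** (-ᴿ α)
      half = fromℕ 2 ⁻¹
      half*2* : ∀ {w} → half *ᴿ fromℕ 2 *ᴿ w ≡ w
      half*2* {w} = trans (cong (_*ᴿ w) (⁻¹-inverseˡ 0<2)) (*ᴿ-identityˡ w)
      2y≤z : ∀ y → Below x (-ᴿ α) y → fromℕ 2 *ᴿ y ≤ᴿ z
      2y≤z y below with fromℕ 2 *ᴿ y ≤ᴿ? z
      ... | yes le = le
      ... | no ≰z = ⊥-elim (≰ (begin
        x ^ᴿ u *ᴿ z ^ᴿ m                      ≤⟨ *-monoˡ-≤ (0≤^ u 0≤x) (^-monoˡ-≤ m (proj₁ (0<** α 0≤α)) (≰⇒≥ ≰z)) ⟩
        x ^ᴿ u *ᴿ (fromℕ 2 *ᴿ y) ^ᴿ m         ≡⟨ cong (x ^ᴿ u *ᴿ_) (^-distrib-* (fromℕ 2) y m) ⟩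
        x ^ᴿ u *ᴿ (fromℕ 2 ^ᴿ m *ᴿ y ^ᴿ m)    ≡⟨ solve 3 (λ a b c → a :* (b :* c) := b :* (a :* c)) refl (x ^ᴿ u) (fromℕ 2 ^ᴿ m) (y ^ᴿ m) ⟩
        fromℕ 2 ^ᴿ m *ᴿ (x ^ᴿ u *ᴿ y ^ᴿ m)    ≤⟨ *-monoˡ-≤ (0≤^ m (0≤fromℕ 2)) (below⇒≤** (below-^-* u m u≤ below)) ⟩
        fromℕ 2 ^ᴿ m *ᴿ x ** E                ∎))
      z≤z/2 : z ≤ᴿ half *ᴿ z
      z≤z/2 = let (y₀ , _ , below₀) = below-inhabited α 0≤α in **-lub (y₀ , below₀) λ y below → begin
        y                            ≡⟨ sym half*2* ⟩
        half *ᴿ fromℕ 2 *ᴿ y         ≡⟨ *ᴿ-assoc _ _ _ ⟩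
        half *ᴿ (fromℕ 2 *ᴿ y)       ≤⟨ *-monoˡ-≤ (proj₁ (0<x⁻¹ 0<2)) (2y≤z y below) ⟩
        half *ᴿ z                    ∎

-- Subsets and the edges inside them

module _ {A B : Set} {P : Pred B 0ℓ} {Q : Pred A 0ℓ} (P? : Decidable P) (Q? : Decidable Q) where

  filter-map : ∀ {f} → (∀ {x} → P (f x) → Q x) → (∀ {x} → Q x → P (f x)) →
               ∀ xs → filter P? (map f xs) ≡ map f (filter Q? xs)
  filter-map P⇒Q Q⇒P [] = refl
  filter-map {f} P⇒Q Q⇒P (x ∷ xs) with P? (f x) | Q? x
  ... | yes _ | yes _ = cong (f x ∷_) (filter-map P⇒Q Q⇒P xs)
  ... | yes p | no ¬q = ⊥-elim (¬q (P⇒Q p))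
  ... | no ¬p | yes q = ⊥-elim (¬p (Q⇒P q))
  ... | no _  | no _  = filter-map P⇒Q Q⇒P xs

filter-map-none : ∀ {A B : Set} {P : Pred B 0ℓ} (P? : Decidable P) {f : A → B} → (∀ {x} → ¬ P (f x)) →
                  ∀ xs → filter P? (map f xs) ≡ []
filter-map-none P? ¬P [] = refl
filter-map-none P? {f} ¬P (x ∷ xs) with P? (f x)
... | yes p = ⊥-elim (¬P p)
... | no _  = filter-map-none P? ¬P xs

allSubsets-complete : ∀ {n} (W : Subset n) → W ∈ allSubsets n
allSubsets-complete [] = here refl
allSubsets-complete (inside  ∷ W) = ∈-++⁺ˡ (∈-map⁺ (inside ∷_) (allSubsets-complete W))
allSubsets-complete {suc n} (outside ∷ W) =
  ∈-++⁺ʳ (map (inside ∷_) (allSubsets n)) (∈-map⁺ (outside ∷_) (allSubsets-complete W))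

allSubsets-unique : ∀ n → Unique (allSubsets n)
allSubsets-unique zero    = All.[] ∷ []
allSubsets-unique (suc n) = Unique.++⁺
  (Unique.map⁺ Vec.∷-injectiveʳ (allSubsets-unique n))
  (Unique.map⁺ Vec.∷-injectiveʳ (allSubsets-unique n))
  disjoint
  where
  disjoint : ∀ {W} → ¬ (W ∈ map (inside ∷_) (allSubsets n) × W ∈ map (outside ∷_) (allSubsets n))
  disjoint (∈ᵢ , ∈ₒ) with ∈-map⁻ (inside ∷_) ∈ᵢ | ∈-map⁻ (outside ∷_) ∈ₒ
  ... | _ , _ , refl | _ , _ , ()

∈-subsetsOfSize⁺ : ∀ {t n} {W : Subset n} → ∣ W ∣ ≡ t → W ∈ subsetsOfSize t n
∈-subsetsOfSize⁺ {t} {W = W} = ∈-filter⁺ (λ W → ∣ W ∣ ℕ.≟ t) (allSubsets-complete W)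

∈-subsetsOfSize⁻ : ∀ {t n} {W : Subset n} → W ∈ subsetsOfSize t n → ∣ W ∣ ≡ t
∈-subsetsOfSize⁻ {t} {n} W∈ = proj₂ (∈-filter⁻ (λ W → ∣ W ∣ ℕ.≟ t) {xs = allSubsets n} W∈)

subsetsOfSize-unique : ∀ t n → Unique (subsetsOfSize t n)
subsetsOfSize-unique t n = Unique.filter⁺ (λ W → ∣ W ∣ ℕ.≟ t) (allSubsets-unique n)

subsetsOfSize-zero : ∀ n → subsetsOfSize 0 (suc n) ≡ map (outside ∷_) (subsetsOfSize 0 n)
subsetsOfSize-zero n = trans (List.filter-++ _ (map (inside ∷_) (allSubsets n)) _)
  (cong₂ _++_ (filter-map-none _ (λ ()) (allSubsets n)) (filter-map _ _ id id (allSubsets n)))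

subsetsOfSize-suc : ∀ t n → subsetsOfSize (suc t) (suc n) ≡
  map (inside ∷_) (subsetsOfSize t n) ++ map (outside ∷_) (subsetsOfSize (suc t) n)
subsetsOfSize-suc t n = trans (List.filter-++ _ (map (inside ∷_) (allSubsets n)) _)
  (cong₂ _++_ (filter-map _ _ ℕ.suc-injective (cong suc) (allSubsets n)) (filter-map _ _ id id (allSubsets n)))

length-binom : ∀ {n} (W : Subset n) s → length (binom W s) ≡ ∣ W ∣ C s
length-binom [] zero    = refl
length-binom [] (suc s) = refl
length-binom {suc n} (b ∷ W) zero = trans (cong length eq) (trans (List.length-map (outside ∷_) (binom W 0)) (length-binom W 0))
  where
  eq : binom (b ∷ W) 0 ≡ map (outside ∷_) (binom W 0)
  eq = trans (cong (filter (Subset._⊆? (b ∷ W))) (subsetsOfSize-zero n))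
             (filter-map _ _ Subset.drop-∷-⊆ Subset.out⊆ (subsetsOfSize 0 n))
length-binom {suc n} (outside ∷ W) (suc s) =
  trans (cong length eq) (trans (List.length-map (outside ∷_) (binom W (suc s))) (length-binom W (suc s)))
  where
  eq : binom (outside ∷ W) (suc s) ≡ map (outside ∷_) (binom W (suc s))
  eq = trans (cong (filter (Subset._⊆? (outside ∷ W))) (subsetsOfSize-suc s n))
      (trans (List.filter-++ (Subset._⊆? (outside ∷ W)) (map (inside ∷_) (subsetsOfSize s n)) _)
             (cong₂ _++_ (filter-map-none _ in⊈out (subsetsOfSize s n))
                         (filter-map _ _ Subset.drop-∷-⊆ Subset.out⊆ (subsetsOfSize (suc s) n))))
    where
    in⊈out : ∀ {e} → ¬ (inside ∷ e ⊆ˢ outside ∷ W)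
    in⊈out e⊆W with () ← e⊆W here
length-binom {suc n} (inside ∷ W) (suc s) =
  trans (cong length eq)
  (trans (List.length-++ (map (inside ∷_) (binom W s)))
  (trans (cong₂ _+_ (trans (List.length-map (inside ∷_) (binom W s)) (length-binom W s))
                    (trans (List.length-map (outside ∷_) (binom W (suc s))) (length-binom W (suc s))))
         (nCk+nC[k+1]≡[n+1]C[k+1] ∣ W ∣ s)))
  where
  eq : binom (inside ∷ W) (suc s) ≡ map (inside ∷_) (binom W s) ++ map (outside ∷_) (binom W (suc s))
  eq = trans (cong (filter (Subset._⊆? (inside ∷ W))) (subsetsOfSize-suc s n))
      (trans (List.filter-++ (Subset._⊆? (inside ∷ W)) (map (inside ∷_) (subsetsOfSize s n)) _)
             (cong₂ _++_ (filter-map _ _ Subset.drop-∷-⊆ Subset.in⊆in (subsetsOfSize s n))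
                         (filter-map _ _ Subset.drop-∷-⊆ Subset.out⊆ (subsetsOfSize (suc s) n))))

∣∪∣+∣∩∣ : ∀ {n} (A B : Subset n) → ∣ A ∪ B ∣ + ∣ A ∩ B ∣ ≡ ∣ A ∣ + ∣ B ∣
∣∪∣+∣∩∣ [] [] = refl
∣∪∣+∣∩∣ (inside  ∷ A) (inside  ∷ B) = cong suc (trans (ℕ.+-suc _ _) (trans (cong suc (∣∪∣+∣∩∣ A B)) (sym (ℕ.+-suc _ _))))
∣∪∣+∣∩∣ (inside  ∷ A) (outside ∷ B) = cong suc (∣∪∣+∣∩∣ A B)
∣∪∣+∣∩∣ (outside ∷ A) (inside  ∷ B) = trans (cong suc (∣∪∣+∣∩∣ A B)) (sym (ℕ.+-suc _ _))
∣∪∣+∣∩∣ (outside ∷ A) (outside ∷ B) = ∣∪∣+∣∩∣ A B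

∣∪∣≤ : ∀ {n} (A B : Subset n) → ∣ A ∪ B ∣ ≤ ∣ A ∣ + ∣ B ∣
∣∪∣≤ A B = ℕ.≤-trans (ℕ.m≤m+n _ _) (ℕ.≤-reflexive (∣∪∣+∣∩∣ A B))

module _ {A : Set} {P : Pred A 0ℓ} (P? : Decidable P) where

  positions : (xs : List A) → Subset (length xs)
  positions []       = []
  positions (x ∷ xs) = does (P? x) ∷ positions xs

  ∈-positions⁺ : ∀ xs {i} → P (lookup xs i) → i ∈ˢ positions xs
  ∈-positions⁺ (x ∷ xs) {zero} p with P? x
  ... | yes _ = here
  ... | no ¬p = ⊥-elim (¬p p)
  ∈-positions⁺ (x ∷ xs) {suc i} p = there (∈-positions⁺ xs p)

  ∈-positions⁻ : ∀ xs {i} → i ∈ˢ positions xs → P (lookup xs i)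
  ∈-positions⁻ (x ∷ xs) {zero} i∈ with P? x | i∈
  ... | yes p | _ = p
  ... | no _  | ()
  ∈-positions⁻ (x ∷ xs) {suc i} (there i∈) = ∈-positions⁻ xs i∈

  ∣positions∣ : ∀ xs → ∣ positions xs ∣ ≡ length (filter P? xs)
  ∣positions∣ [] = refl
  ∣positions∣ (x ∷ xs) with P? x
  ... | yes _ = cong suc (∣positions∣ xs)
  ... | no _  = ∣positions∣ xs

lookup-injective : ∀ {A : Set} {xs : List A} → Unique xs → ∀ {i j} → lookup xs i ≡ lookup xs j → i ≡ j
lookup-injective {xs = x ∷ xs} u {zero} {zero} eq = refl
lookup-injective {xs = x ∷ xs} (x∉ ∷ u) {zero} {suc j} eq = ⊥-elim (All.lookup x∉ (∈-lookup j) eq)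
lookup-injective {xs = x ∷ xs} (x∉ ∷ u) {suc i} {zero} eq = ⊥-elim (All.lookup x∉ (∈-lookup i) (sym eq))
lookup-injective {xs = x ∷ xs} (_ ∷ u) {suc i} {suc j} eq = cong suc (lookup-injective u eq)

module _ {n : ℕ} (s : ℕ) where

  edgePositionsIn : Subset n → Subset (length (subsetsOfSize s n))
  edgePositionsIn W = positions (Subset._⊆? W) (subsetsOfSize s n)

  ∣edgePositionsIn∣ : ∀ W → ∣ edgePositionsIn W ∣ ≡ ∣ W ∣ C s
  ∣edgePositionsIn∣ W = trans (∣positions∣ (Subset._⊆? W) (subsetsOfSize s n)) (length-binom W s)

  edgePositionsIn-mono : ∀ {V W} → V ⊆ˢ W → edgePositionsIn V ⊆ˢ edgePositionsIn W
  edgePositionsIn-mono {V} {W} V⊆W i∈ = ∈-positions⁺ (Subset._⊆? W) (subsetsOfSize s n)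
    λ e → V⊆W (∈-positions⁻ (Subset._⊆? V) (subsetsOfSize s n) i∈ e)

  edgePositionsIn-∩ : ∀ V W → edgePositionsIn V ∩ edgePositionsIn W ⊆ˢ edgePositionsIn (V ∩ W)
  edgePositionsIn-∩ V W i∈ = ∈-positions⁺ (Subset._⊆? (V ∩ W)) (subsetsOfSize s n) λ e →
    let (i∈V , i∈W) = Subset.x∈p∩q⁻ (edgePositionsIn V) (edgePositionsIn W) i∈ in
    Subset.x∈p∩q⁺ (∈-positions⁻ (Subset._⊆? V) (subsetsOfSize s n) i∈V e
                  , ∈-positions⁻ (Subset._⊆? W) (subsetsOfSize s n) i∈W e)

  edgePositionsIn-∪ : ∀ {D} V W → D ⊆ˢ edgePositionsIn V → D ∪ edgePositionsIn W ⊆ˢ edgePositionsIn (V ∪ W)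
  edgePositionsIn-∪ {D} V W D⊆ i∈ with Subset.x∈p∪q⁻ D (edgePositionsIn W) i∈
  ... | inj₁ i∈D = edgePositionsIn-mono (Subset.p⊆p∪q W) (D⊆ i∈D)
  ... | inj₂ i∈W = edgePositionsIn-mono (Subset.q⊆p∪q V W) i∈W

  -- Inclusion-exclusion for `D` and the edges in `W`: an edge inside both `V` and `W` lies inside
  -- `V ∩ W`. There is only an inequality because `D` may miss some edges of `V`.
  new-edges : ∀ {D} V W → D ⊆ˢ edgePositionsIn V →
              ∣ D ∣ + ∣ W ∣ C s ≤ ∣ D ∪ edgePositionsIn W ∣ + ∣ V ∩ W ∣ C s
  new-edges {D} V W D⊆ = begin
    ∣ D ∣ + ∣ W ∣ C s                                         ≡⟨ cong (∣ D ∣ +_) (sym (∣edgePositionsIn∣ W)) ⟩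
    ∣ D ∣ + ∣ edgePositionsIn W ∣                             ≡⟨ sym (∣∪∣+∣∩∣ D (edgePositionsIn W)) ⟩
    ∣ D ∪ edgePositionsIn W ∣ + ∣ D ∩ edgePositionsIn W ∣     ≤⟨ ℕ.+-monoʳ-≤ _ (Subset.p⊆q⇒∣p∣≤∣q∣ common) ⟩
    ∣ D ∪ edgePositionsIn W ∣ + ∣ edgePositionsIn (V ∩ W) ∣   ≡⟨ cong (∣ D ∪ edgePositionsIn W ∣ +_) (∣edgePositionsIn∣ (V ∩ W)) ⟩
    ∣ D ∪ edgePositionsIn W ∣ + ∣ V ∩ W ∣ C s                 ∎
    where
    open ℕ.≤-Reasoning
    common : D ∩ edgePositionsIn W ⊆ˢ edgePositionsIn (V ∩ W)
    common i∈ = let (i∈D , i∈W) = Subset.x∈p∩q⁻ D (edgePositionsIn W) i∈ in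
                edgePositionsIn-∩ V W (Subset.x∈p∩q⁺ (D⊆ i∈D , i∈W))

  clique⇒edgePositions : ∀ (G : Hypergraph n s) W → IsClique G W → edgePositionsIn W ⊆ˢ Hypergraph.edgePositions G
  clique⇒edgePositions G W clique {i} i∈
    with ∈-map∘filter⁻ (lookup (subsetsOfSize s n)) (Subset._∈? Hypergraph.edgePositions G) {xs = allFin _}
           (clique (∈-filter⁺ (Subset._⊆? W) (∈-lookup {xs = subsetsOfSize s n} i) (∈-positions⁻ (Subset._⊆? W) (subsetsOfSize s n) i∈)))
  -- Edges are compared as sets whereas coins are positions. The list of `s`-sets has no repetition,
  -- so equal sets occupy equal positions.
  ... | j , _ , eq , j∈ with lookup-injective (subsetsOfSize-unique s n) {i} {j} eq
  ...   | refl = j∈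

weight : ∀ {n} → Vec ℕ n → Subset n → ℕ
weight []       []            = 1
weight (w ∷ ws) (inside  ∷ W) = w * weight ws W
weight (w ∷ ws) (outside ∷ W) = weight ws W

sum-map-* : ∀ {A : Set} w (f : A → ℕ) xs → sum (map (λ x → w * f x) xs) ≡ w * sum (map f xs)
sum-map-* w f []       = sym (ℕ.*-zeroʳ w)
sum-map-* w f (x ∷ xs) = trans (cong (w * f x +_) (sum-map-* w f xs)) (sym (ℕ.*-distribˡ-+ w (f x) _))

-- The left side is the elementary symmetric polynomial of degree `t` in the weights. Splitting off
-- the first weight `w`, it is at most `w S ^ (t - 1) + S ^ t`, where `S` is the sum of the others.
sum-weight≤ : ∀ {n} (ws : Vec ℕ n) t → sum (map (weight ws) (subsetsOfSize t n)) ≤ Vec.sum ws ^ t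
sum-weight≤ []       zero    = ℕ.≤-refl
sum-weight≤ []       (suc t) = z≤n
sum-weight≤ {suc n} (w ∷ ws) zero = begin
  sum (map (weight (w ∷ ws)) (subsetsOfSize 0 (suc n)))          ≡⟨ cong (sum ∘ map _) (subsetsOfSize-zero n) ⟩
  sum (map (weight (w ∷ ws)) (map (outside ∷_) (subsetsOfSize 0 n))) ≡⟨ cong sum (sym (List.map-∘ (subsetsOfSize 0 n))) ⟩
  sum (map (weight ws) (subsetsOfSize 0 n))                      ≤⟨ sum-weight≤ ws 0 ⟩
  1                                                              ∎
  where open ℕ.≤-Reasoning
sum-weight≤ {suc n} (w ∷ ws) (suc t) = begin
  sum (map f (subsetsOfSize (suc t) (suc n)))                    ≡⟨ cong (sum ∘ map f) (subsetsOfSize-suc t n) ⟩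
  sum (map f (map (inside ∷_) xs ++ map (outside ∷_) ys))        ≡⟨ cong sum (List.map-++ f (map (inside ∷_) xs) _) ⟩
  sum (map f (map (inside ∷_) xs) ++ map f (map (outside ∷_) ys)) ≡⟨ sum-++ (map f (map (inside ∷_) xs)) _ ⟩
  sum (map f (map (inside ∷_) xs)) + sum (map f (map (outside ∷_) ys))
    ≡⟨ cong₂ (λ u v → sum u + sum v) (sym (List.map-∘ xs)) (sym (List.map-∘ ys)) ⟩
  sum (map (λ W → w * weight ws W) xs) + sum (map (weight ws) ys) ≡⟨ cong (_+ _) (sum-map-* w (weight ws) xs) ⟩
  w * sum (map (weight ws) xs) + sum (map (weight ws) ys)        ≤⟨ ℕ.+-mono-≤ (ℕ.*-monoʳ-≤ w (sum-weight≤ ws t)) (sum-weight≤ ws (suc t)) ⟩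
  w * S ^ t + S * S ^ t                                          ≡⟨ sym (ℕ.*-distribʳ-+ (S ^ t) w S) ⟩
  (w + S) * S ^ t                                                ≤⟨ ℕ.*-monoʳ-≤ (w + S) (ℕ.^-monoˡ-≤ t (ℕ.m≤n+m S w)) ⟩
  (w + S) ^ suc t                                                ∎
  where
  open ℕ.≤-Reasoning
  f = weight (w ∷ ws)
  S = Vec.sum ws
  xs = subsetsOfSize t n
  ys = subsetsOfSize (suc t) n

length-subsetsOfSize≤ : ∀ t n → length (subsetsOfSize t n) ≤ n ^ t
length-subsetsOfSize≤ t n = begin
  length (subsetsOfSize t n)                               ≡⟨ count (subsetsOfSize t n) ⟩
  sum (map (weight (Vec.replicate n 1)) (subsetsOfSize t n)) ≤⟨ sum-weight≤ (Vec.replicate n 1) t ⟩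
  Vec.sum (Vec.replicate n 1) ^ t                          ≡⟨ cong (_^ t) (sum-ones n) ⟩
  n ^ t                                                    ∎
  where
  open ℕ.≤-Reasoning
  weight-ones : ∀ {n} (W : Subset n) → weight (Vec.replicate n 1) W ≡ 1
  weight-ones []            = refl
  weight-ones (inside  ∷ W) = trans (ℕ.*-identityˡ _) (weight-ones W)
  weight-ones (outside ∷ W) = weight-ones W
  count : ∀ (xs : List (Subset n)) → length xs ≡ sum (map (weight (Vec.replicate n 1)) xs)
  count []       = refl
  count (W ∷ xs) = cong₂ _+_ (sym (weight-ones W)) (count xs)
  sum-ones : ∀ n → Vec.sum (Vec.replicate n 1) ≡ n
  sum-ones zero    = refl
  sum-ones (suc n) = cong suc (sum-ones n)

-- With two values, the weight of `W` depends only on how many of its vertices lie in `V`, just as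
-- the bound on the cost of `W` does.
twoWeights : ∀ {n} → ℕ → ℕ → Subset n → Vec ℕ n
twoWeights a b = Vec.map (λ side → if side then a else b)

sum-twoWeights≤ : ∀ {n} a b (V : Subset n) → Vec.sum (twoWeights a b V) ≤ ∣ V ∣ * a + n * b
sum-twoWeights≤ a b [] = z≤n
sum-twoWeights≤ {suc n} a b (inside ∷ V) = begin
  a + Vec.sum (twoWeights a b V)    ≤⟨ ℕ.+-monoʳ-≤ a (sum-twoWeights≤ a b V) ⟩
  a + (∣ V ∣ * a + n * b)           ≤⟨ ℕ.+-monoʳ-≤ a (ℕ.+-monoʳ-≤ (∣ V ∣ * a) (ℕ.m≤n+m (n * b) b)) ⟩
  a + (∣ V ∣ * a + (b + n * b))     ≡⟨ sym (ℕ.+-assoc a _ _) ⟩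
  a + ∣ V ∣ * a + (b + n * b)       ∎
  where open ℕ.≤-Reasoning
sum-twoWeights≤ {suc n} a b (outside ∷ V) = begin
  b + Vec.sum (twoWeights a b V)    ≤⟨ ℕ.+-monoʳ-≤ b (sum-twoWeights≤ a b V) ⟩
  b + (∣ V ∣ * a + n * b)           ≡⟨ solve 3 (λ x y z → x :+ (y :+ z) := y :+ (x :+ z)) refl b (∣ V ∣ * a) (n * b) ⟩
  ∣ V ∣ * a + (b + n * b)           ∎
  where open ℕ.≤-Reasoning; open +-*-Solver

weight-twoWeights : ∀ {n} a b (V W : Subset n) → ∃[ l ]
  (∣ V ∩ W ∣ + l ≡ ∣ W ∣ × weight (twoWeights a b V) W ≡ a ^ ∣ V ∩ W ∣ * b ^ l)
weight-twoWeights a b [] [] = 0 , refl , refl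
weight-twoWeights a b (v ∷ V) (w ∷ W) with weight-twoWeights a b V W
weight-twoWeights a b (inside ∷ V) (inside ∷ W) | l , size , eq =
  l , cong suc size , trans (cong (a *_) eq) (sym (ℕ.*-assoc a _ _))
weight-twoWeights a b (outside ∷ V) (inside ∷ W) | l , size , eq =
  suc l , trans (ℕ.+-suc _ l) (cong suc size) ,
  trans (cong (b *_) eq) (solve 3 (λ b x y → b :* (x :* y) := x :* (b :* y)) refl b (a ^ ∣ V ∩ W ∣) (b ^ l))
  where open +-*-Solver
weight-twoWeights a b (inside  ∷ V) (outside ∷ W) | l , size , eq = l , size , eq
weight-twoWeights a b (outside ∷ V) (outside ∷ W) | l , size , eq = l , size , eq

*-^-distrib : ∀ m n o → (m * n) ^ o ≡ m ^ o * n ^ o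
*-^-distrib m n zero    = refl
*-^-distrib m n (suc o) = trans (cong (m * n *_) (*-^-distrib m n o))
  (solve 4 (λ a b c d → a :* b :* (c :* d) := a :* c :* (b :* d)) refl m n (m ^ o) (n ^ o))
  where open +-*-Solver

-- The two powers differ by the factor `(1 + 1/h) ^ t`, which `ratio` bounds by 3/2.
powers-ratio : ∀ v n h t → 2 * suc h ^ t ≤ 3 * h ^ t → (v * n * suc h) ^ t * 2 ≤ 3 * (n ^ t * (v * h) ^ t)
powers-ratio v n h t ratio = begin
  (v * n * suc h) ^ t * 2             ≡⟨ cong (_* 2) (trans (*-^-distrib (v * n) (suc h) t) (cong (_* suc h ^ t) (*-^-distrib v n t))) ⟩
  v ^ t * n ^ t * suc h ^ t * 2       ≡⟨ solve 3 (λ a b c → a :* b :* c :* con 2 := a :* b :* (con 2 :* c)) refl (v ^ t) (n ^ t) (suc h ^ t) ⟩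
  v ^ t * n ^ t * (2 * suc h ^ t)     ≤⟨ ℕ.*-monoʳ-≤ (v ^ t * n ^ t) ratio ⟩
  v ^ t * n ^ t * (3 * h ^ t)         ≡⟨ solve 3 (λ a b c → a :* b :* (con 3 :* c) := con 3 :* (b :* (a :* c))) refl (v ^ t) (n ^ t) (h ^ t) ⟩
  3 * (n ^ t * (v ^ t * h ^ t))       ≡⟨ cong (λ k → 3 * (n ^ t * k)) (sym (*-^-distrib v h t)) ⟩
  3 * (n ^ t * (v * h) ^ t)           ∎
  where open ℕ.≤-Reasoning; open +-*-Solver

-- Since `(4/3) ^ 3 = 64/27 > 2`, three orders of the moment buy one factor of 2.
54^u≤64^u : ∀ u → 2 ^ u * 3 ^ (3 * u) ≤ 4 ^ (3 * u)
54^u≤64^u u = begin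
  2 ^ u * 3 ^ (3 * u)  ≡⟨ cong (2 ^ u *_) (sym (ℕ.^-*-assoc 3 3 u)) ⟩
  2 ^ u * 27 ^ u       ≡⟨ sym (*-^-distrib 2 27 u) ⟩
  54 ^ u               ≤⟨ ℕ.^-monoˡ-≤ u (ℕ.m≤m+n 54 10) ⟩
  64 ^ u               ≡⟨ ℕ.^-*-assoc 4 3 u ⟩
  4 ^ (3 * u)          ∎
  where open ℕ.≤-Reasoning

-- Moments of the number of cliques

module FiniteSums (R : Reals) where
  open OrderedField R
  open ≤ᴿ-Reasoning

  Σᴿ : ∀ {A : Set} → (A → ℝ) → List A → ℝ
  Σᴿ f []       = 0ᴿ
  Σᴿ f (x ∷ xs) = f x +ᴿ Σᴿ f xs

  Σᴿ-mono : ∀ {A : Set} {f g : A → ℝ} xs → (∀ {x} → x ∈ᴸ xs → f x ≤ᴿ g x) → Σᴿ f xs ≤ᴿ Σᴿ g xs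
  Σᴿ-mono []       f≤g = ≤ᴿ-refl
  Σᴿ-mono (x ∷ xs) f≤g = +-mono₂ (f≤g (here refl)) (Σᴿ-mono xs (f≤g ∘ there))

  Σᴿ-*ʳ : ∀ {A : Set} (f : A → ℝ) a xs → Σᴿ f xs *ᴿ a ≡ Σᴿ (λ x → f x *ᴿ a) xs
  Σᴿ-*ʳ f a []       = *ᴿ-zeroˡ a
  Σᴿ-*ʳ f a (x ∷ xs) = trans (*ᴿ-distribʳ a (f x) _) (cong (f x *ᴿ a +ᴿ_) (Σᴿ-*ʳ f a xs))

  Σᴿ-*ˡ : ∀ {A : Set} (f : A → ℝ) a xs → a *ᴿ Σᴿ f xs ≡ Σᴿ (λ x → a *ᴿ f x) xs
  Σᴿ-*ˡ f a []       = *ᴿ-zeroʳ a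
  Σᴿ-*ˡ f a (x ∷ xs) = trans (*ᴿ-distribˡ a (f x) _) (cong (a *ᴿ f x +ᴿ_) (Σᴿ-*ˡ f a xs))

  Σᴿ-fromℕ : ∀ {A : Set} (f : A → ℕ) xs → Σᴿ (fromℕ ∘ f) xs ≡ fromℕ (sum (map f xs))
  Σᴿ-fromℕ f []       = refl
  Σᴿ-fromℕ f (x ∷ xs) = trans (cong (fromℕ (f x) +ᴿ_) (Σᴿ-fromℕ f xs)) (sym (fromℕ-+ (f x) _))

  0≤Σᴿ : ∀ {A : Set} {f : A → ℝ} xs → (∀ x → 0ᴿ ≤ᴿ f x) → 0ᴿ ≤ᴿ Σᴿ f xs
  0≤Σᴿ []       0≤f = ≤ᴿ-refl
  0≤Σᴿ (x ∷ xs) 0≤f = 0≤x+y (0≤f x) (0≤Σᴿ xs 0≤f)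

  length-filter≤Σᴿ : ∀ {A : Set} {P : Pred A 0ℓ} (P? : Decidable P) {f : A → ℝ} →
    (∀ x → 0ᴿ ≤ᴿ f x) → (∀ x → P x → 1ᴿ ≤ᴿ f x) → ∀ xs → fromℕ (length (filter P? xs)) ≤ᴿ Σᴿ f xs
  length-filter≤Σᴿ P? 0≤f 1≤f [] = ≤ᴿ-refl
  length-filter≤Σᴿ P? {f} 0≤f 1≤f (x ∷ xs) with P? x
  ... | yes p = +-mono₂ (1≤f x p) (length-filter≤Σᴿ P? 0≤f 1≤f xs)
  ... | no _  = subst (_≤ᴿ _) (+ᴿ-identityˡ _) (+-mono₂ (0≤f x) (length-filter≤Σᴿ P? 0≤f 1≤f xs))

module Expectation (R : Reals) where
  open OrderedField R
  open WithReals R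
  open ≤ᴿ-Reasoning
  open FiniteSums R

  indicator : Bool → ℝ
  indicator b = if b then 1ᴿ else 0ᴿ

  0≤indicator : ∀ b → 0ᴿ ≤ᴿ indicator b
  0≤indicator true  = 0≤1
  0≤indicator false = ≤ᴿ-refl

  -- χ D is the indicator function of the supersets of D, as a product over the coins.
  χ : ∀ {m} → Subset m → Subset m → ℝ
  χ []            []            = 1ᴿ
  χ (outside ∷ D) (_       ∷ x) = χ D x
  χ (inside  ∷ D) (inside  ∷ x) = χ D x
  χ (inside  ∷ D) (outside ∷ x) = 0ᴿ

  0≤χ : ∀ {m} (D x : Subset m) → 0ᴿ ≤ᴿ χ D x
  0≤χ []            []            = 0≤1
  0≤χ (outside ∷ D) (_       ∷ x) = 0≤χ D x
  0≤χ (inside  ∷ D) (inside  ∷ x) = 0≤χ D x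
  0≤χ (inside  ∷ D) (outside ∷ x) = ≤ᴿ-refl

  χ-⊆ : ∀ {m} (D x : Subset m) → D ⊆ˢ x → χ D x ≡ 1ᴿ
  χ-⊆ []            []            D⊆x = refl
  χ-⊆ (outside ∷ D) (_       ∷ x) D⊆x = χ-⊆ D x (Subset.drop-∷-⊆ D⊆x)
  χ-⊆ (inside  ∷ D) (inside  ∷ x) D⊆x = χ-⊆ D x (Subset.drop-∷-⊆ D⊆x)
  χ-⊆ (inside  ∷ D) (outside ∷ x) D⊆x with () ← D⊆x here

  -- A coin demanded by both factors is demanded once by the product, so edges shared between
  -- cliques are paid for only once.
  χ-∪ : ∀ {m} (D D′ x : Subset m) → χ D x *ᴿ χ D′ x ≡ χ (D ∪ D′) x
  χ-∪ []            []             []            = *ᴿ-identityˡ 1ᴿ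
  χ-∪ (outside ∷ D) (outside ∷ D′) (_       ∷ x) = χ-∪ D D′ x
  χ-∪ (outside ∷ D) (inside  ∷ D′) (inside  ∷ x) = χ-∪ D D′ x
  χ-∪ (outside ∷ D) (inside  ∷ D′) (outside ∷ x) = *ᴿ-zeroʳ (χ D x)
  χ-∪ (inside  ∷ D) (outside ∷ D′) (inside  ∷ x) = χ-∪ D D′ x
  χ-∪ (inside  ∷ D) (outside ∷ D′) (outside ∷ x) = *ᴿ-zeroˡ (χ D′ x)
  χ-∪ (inside  ∷ D) (inside  ∷ D′) (inside  ∷ x) = χ-∪ D D′ x
  χ-∪ (inside  ∷ D) (inside  ∷ D′) (outside ∷ x) = *ᴿ-zeroˡ 0ᴿ

  module _ (p : ℝ) where

    𝔼 : ∀ m → (Subset m → ℝ) → ℝ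
    𝔼 zero    f = f []
    𝔼 (suc m) f = p *ᴿ 𝔼 m (λ x → f (inside ∷ x)) +ᴿ (1ᴿ -ᴿ p) *ᴿ 𝔼 m (λ x → f (outside ∷ x))

    private
      mix : ∀ {a b c d} → a ≡ b → c ≡ d → p *ᴿ a +ᴿ (1ᴿ -ᴿ p) *ᴿ c ≡ p *ᴿ b +ᴿ (1ᴿ -ᴿ p) *ᴿ d
      mix = cong₂ (λ u v → p *ᴿ u +ᴿ (1ᴿ -ᴿ p) *ᴿ v)

      mix-same : ∀ a → p *ᴿ a +ᴿ (1ᴿ -ᴿ p) *ᴿ a ≡ a
      mix-same a = trans (sym (*ᴿ-distribʳ a p _))
        (trans (cong (_*ᴿ a) (trans (+ᴿ-comm p _) (x-y+y≡x 1ᴿ p))) (*ᴿ-identityˡ a))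

    flipPr≡𝔼 : ∀ m (E : Subset m → Bool) → flipPr p m E ≡ 𝔼 m (λ x → indicator (E x))
    flipPr≡𝔼 zero    E = refl
    flipPr≡𝔼 (suc m) E = mix (flipPr≡𝔼 m _) (flipPr≡𝔼 m _)

    𝔼-cong : ∀ m {f g : Subset m → ℝ} → (∀ x → f x ≡ g x) → 𝔼 m f ≡ 𝔼 m g
    𝔼-cong zero    f≡g = f≡g []
    𝔼-cong (suc m) f≡g = mix (𝔼-cong m (f≡g ∘ (inside ∷_))) (𝔼-cong m (f≡g ∘ (outside ∷_)))

    𝔼-const : ∀ m a → 𝔼 m (λ _ → a) ≡ a
    𝔼-const zero    a = refl
    𝔼-const (suc m) a = trans (mix (𝔼-const m a) (𝔼-const m a)) (mix-same a)

    𝔼-+ : ∀ m (f g : Subset m → ℝ) → 𝔼 m (λ x → f x +ᴿ g x) ≡ 𝔼 m f +ᴿ 𝔼 m g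
    𝔼-+ zero    f g = refl
    𝔼-+ (suc m) f g = trans (mix (𝔼-+ m (f ∘ (inside ∷_)) (g ∘ (inside ∷_))) (𝔼-+ m (f ∘ (outside ∷_)) (g ∘ (outside ∷_))))
      (solve 6 (λ p q a b c d → p :* (a :+ b) :+ q :* (c :+ d) := (p :* a :+ q :* c) :+ (p :* b :+ q :* d)) refl
        p (1ᴿ -ᴿ p) _ _ _ _)

    𝔼-*ʳ : ∀ m (f : Subset m → ℝ) a → 𝔼 m (λ x → f x *ᴿ a) ≡ 𝔼 m f *ᴿ a
    𝔼-*ʳ zero    f a = refl
    𝔼-*ʳ (suc m) f a = trans (mix (𝔼-*ʳ m (f ∘ (inside ∷_)) a) (𝔼-*ʳ m (f ∘ (outside ∷_)) a))
      (solve 5 (λ p q u v a → p :* (u :* a) :+ q :* (v :* a) := (p :* u :+ q :* v) :* a) refl p (1ᴿ -ᴿ p) _ _ a)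

    𝔼-Σᴿ : ∀ m {A : Set} (f : A → Subset m → ℝ) xs → 𝔼 m (λ x → Σᴿ (λ W → f W x) xs) ≡ Σᴿ (λ W → 𝔼 m (f W)) xs
    𝔼-Σᴿ m f []       = 𝔼-const m 0ᴿ
    𝔼-Σᴿ m f (W ∷ xs) = trans (𝔼-+ m (f W) _) (cong (𝔼 m (f W) +ᴿ_) (𝔼-Σᴿ m f xs))

    -- Independence: each coin in `D` contributes a factor `p`, each other coin a factor 1.
    𝔼-χ : ∀ {m} (D : Subset m) → 𝔼 m (χ D) ≡ p ^ᴿ ∣ D ∣
    𝔼-χ []            = refl
    𝔼-χ (outside ∷ D) = trans (mix-same _) (𝔼-χ D)
    𝔼-χ {suc m} (inside  ∷ D) = trans (mix (𝔼-χ D) (𝔼-const m 0ᴿ))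
      (trans (cong (p *ᴿ p ^ᴿ ∣ D ∣ +ᴿ_) (*ᴿ-zeroʳ _)) (+ᴿ-identityʳ _))

    module _ (0≤p : 0ᴿ ≤ᴿ p) (p≤1 : p ≤ᴿ 1ᴿ) where

      𝔼-mono : ∀ m {f g : Subset m → ℝ} → (∀ x → f x ≤ᴿ g x) → 𝔼 m f ≤ᴿ 𝔼 m g
      𝔼-mono zero    f≤g = f≤g []
      𝔼-mono (suc m) f≤g = +-mono₂ (*-monoˡ-≤ 0≤p (𝔼-mono m (f≤g ∘ (inside ∷_))))
                                   (*-monoˡ-≤ (x≤y⇒0≤y-x p≤1) (𝔼-mono m (f≤g ∘ (outside ∷_))))

module CliqueMoments (R : Reals) (p : Reals.ℝ R)
  (0<p : Reals._<ᴿ_ R (Reals.0ᴿ R) p) (p≤1 : Reals._≤ᴿ_ R p (Reals.1ᴿ R)) (n s t : ℕ) where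
  open OrderedField R
  open WithReals R
  open ≤ᴿ-Reasoning
  open FiniteSums R
  open Expectation R

  0≤p : 0ᴿ ≤ᴿ p
  0≤p = proj₁ 0<p

  N : ℕ
  N = length (subsetsOfSize s n)

  Coins : Set
  Coins = Subset N

  edgesIn : Subset n → Coins
  edgesIn = edgePositionsIn s

  -- Written as a polynomial in the coins, so that the expectation of its powers can be expanded one
  -- clique at a time.
  cliqueCount : Coins → ℝ
  cliqueCount x = Σᴿ (λ W → χ (edgesIn W) x) (subsetsOfSize t n)

  0≤cliqueCount : ∀ x → 0ᴿ ≤ᴿ cliqueCount x
  0≤cliqueCount x = 0≤Σᴿ (subsetsOfSize t n) λ W → 0≤χ (edgesIn W) x

  length-cl≤cliqueCount : ∀ x → fromℕ (length (cl t (hypergraph {n} {s} x))) ≤ᴿ cliqueCount x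
  length-cl≤cliqueCount x = length-filter≤Σᴿ (isClique? (hypergraph x)) (λ W → 0≤χ (edgesIn W) x)
    (λ W clique → ≤ᴿ-reflexive (sym (χ-⊆ (edgesIn W) x (clique⇒edgePositions s (hypergraph x) W clique))))
    (subsetsOfSize t n)

  mean : ℝ
  mean = fromℕ n ^ᴿ t *ᴿ p ^ᴿ (t C s)

  module _ (v h : ℕ) (sparse : ∀ j → j ≤ t → fromℕ (v * h) ^ᴿ j ≤ᴿ fromℕ n ^ᴿ j *ᴿ p ^ᴿ (j C s)) where

    unit : ℝ
    unit = fromℕ (v * h) ^ᴿ t

    bound : ℝ
    bound = p ^ᴿ (t C s) *ᴿ fromℕ ((v * n * suc h) ^ t)

    -- By `new-edges`, `W` costs at most `p ^ (t C s)` divided by `p ^ (j C s)`, where `j` counts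
    -- the vertices of `W` in `V`. `sparse` replaces that divisor by the factor `(n / (v h)) ^ j`,
    -- and multiplication by `unit` leaves weight `n` on each of the `j` common vertices and `v h`
    -- on each of the others.
    extension≤ : ∀ V {D} W → D ⊆ˢ edgesIn V → ∣ W ∣ ≡ t →
      p ^ᴿ ∣ D ∪ edgesIn W ∣ *ᴿ unit ≤ᴿ p ^ᴿ ∣ D ∣ *ᴿ p ^ᴿ (t C s) *ᴿ fromℕ (weight (twoWeights n (v * h) V) W)
    extension≤ V {D} W D⊆ refl with weight-twoWeights n (v * h) V W
    ... | l , j+l≡t , weight≡ = begin
      p ^ᴿ u *ᴿ a ^ᴿ ∣ W ∣                      ≡⟨ cong (λ k → p ^ᴿ u *ᴿ a ^ᴿ k) (sym j+l≡t) ⟩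
      p ^ᴿ u *ᴿ a ^ᴿ (j + l)                    ≡⟨ cong (p ^ᴿ u *ᴿ_) (^-homo-* a j l) ⟩
      p ^ᴿ u *ᴿ (a ^ᴿ j *ᴿ a ^ᴿ l)              ≤⟨ *-monoˡ-≤ (0≤^ u 0≤p) (*-monoʳ-≤ (0≤^ l (0≤fromℕ (v * h))) (sparse j j≤t)) ⟩
      p ^ᴿ u *ᴿ (fromℕ n ^ᴿ j *ᴿ p ^ᴿ (j C s) *ᴿ a ^ᴿ l)
        ≡⟨ solve 4 (λ x y z w → x :* (y :* z :* w) := x :* z :* (y :* w)) refl (p ^ᴿ u) (fromℕ n ^ᴿ j) (p ^ᴿ (j C s)) (a ^ᴿ l) ⟩
      p ^ᴿ u *ᴿ p ^ᴿ (j C s) *ᴿ (fromℕ n ^ᴿ j *ᴿ a ^ᴿ l)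
        ≡⟨ cong₂ _*ᴿ_ (sym (^-homo-* p u (j C s))) (sym weight≡′) ⟩
      p ^ᴿ (u + j C s) *ᴿ fromℕ (weight (twoWeights n (v * h) V) W)
        ≤⟨ *-monoʳ-≤ (0≤fromℕ (weight (twoWeights n (v * h) V) W)) (^-antimonoʳ-≤ 0≤p p≤1 (new-edges s V W D⊆)) ⟩
      p ^ᴿ (∣ D ∣ + ∣ W ∣ C s) *ᴿ fromℕ (weight (twoWeights n (v * h) V) W)
        ≡⟨ cong (_*ᴿ _) (^-homo-* p ∣ D ∣ (∣ W ∣ C s)) ⟩
      p ^ᴿ ∣ D ∣ *ᴿ p ^ᴿ (∣ W ∣ C s) *ᴿ fromℕ (weight (twoWeights n (v * h) V) W) ∎
      where
      u j : ℕ
      u = ∣ D ∪ edgesIn W ∣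
      j = ∣ V ∩ W ∣
      a : ℝ
      a = fromℕ (v * h)
      j≤t : j ≤ ∣ W ∣
      j≤t = ℕ.≤-trans (ℕ.m≤m+n j l) (ℕ.≤-reflexive j+l≡t)
      weight≡′ : fromℕ (weight (twoWeights n (v * h) V) W) ≡ fromℕ n ^ᴿ j *ᴿ a ^ᴿ l
      weight≡′ = trans (cong fromℕ weight≡) (trans (fromℕ-* (n ^ j) ((v * h) ^ l)) (cong₂ _*ᴿ_ (fromℕ-^ n j) (fromℕ-^ (v * h) l)))

    -- The total vertex weight is at most `∣ V ∣ n + n v h ≤ v n (h + 1)`, and its `t`-th power
    -- bounds the weights of all `t`-sets together.
    sum-extensions≤ : ∀ V {D} → D ⊆ˢ edgesIn V → ∣ V ∣ ≤ v →
      Σᴿ (λ W → p ^ᴿ ∣ D ∪ edgesIn W ∣ *ᴿ unit) (subsetsOfSize t n) ≤ᴿ p ^ᴿ ∣ D ∣ *ᴿ bound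
    sum-extensions≤ V {D} D⊆ ∣V∣≤v = begin
      Σᴿ (λ W → p ^ᴿ ∣ D ∪ edgesIn W ∣ *ᴿ unit) Ws   ≤⟨ Σᴿ-mono Ws (λ {W} W∈ → extension≤ V W D⊆ (∈-subsetsOfSize⁻ W∈)) ⟩
      Σᴿ (λ W → q *ᴿ fromℕ (weight ws W)) Ws         ≡⟨ sym (Σᴿ-*ˡ _ q Ws) ⟩
      q *ᴿ Σᴿ (λ W → fromℕ (weight ws W)) Ws         ≡⟨ cong (q *ᴿ_) (Σᴿ-fromℕ (weight ws) Ws) ⟩
      q *ᴿ fromℕ (sum (map (weight ws) Ws))          ≤⟨ *-monoˡ-≤ (*-nonNegative (0≤^ ∣ D ∣ 0≤p) (0≤^ (t C s) 0≤p)) (fromℕ-mono-≤ weights≤) ⟩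
      q *ᴿ fromℕ ((v * n * suc h) ^ t)               ≡⟨ *ᴿ-assoc _ _ _ ⟩
      p ^ᴿ ∣ D ∣ *ᴿ bound                            ∎
      where
      Ws : List (Subset n)
      Ws = subsetsOfSize t n
      ws : Vec ℕ n
      ws = twoWeights n (v * h) V
      q : ℝ
      q = p ^ᴿ ∣ D ∣ *ᴿ p ^ᴿ (t C s)
      weights≤ : sum (map (weight ws) Ws) ≤ (v * n * suc h) ^ t
      weights≤ = ℕ.≤-trans (sum-weight≤ ws t) (ℕ.^-monoˡ-≤ t
        (ℕ.≤-trans (sum-twoWeights≤ n (v * h) V)
        (ℕ.≤-trans (ℕ.+-monoˡ-≤ (n * (v * h)) (ℕ.*-monoˡ-≤ n ∣V∣≤v)) (ℕ.≤-reflexive distrib))))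
        where
        distrib : v * n + n * (v * h) ≡ v * n * suc h
        distrib = N.solve 3 (λ v n h → v N.:* n N.:+ n N.:* (v N.:* h) N.:= v N.:* n N.:* (N.con 1 N.:+ h)) refl v n h
          where module N = +-*-Solver

    -- Expanding one factor of the power conditions on one more clique W; the
    -- vertices seen so far stay inside V, so only ∣ V ∩ W ∣ matters.
    moment≤ : ∀ r V {D} → D ⊆ˢ edgesIn V → ∣ V ∣ + r * t ≤ v →
      𝔼 p N (λ x → χ D x *ᴿ cliqueCount x ^ᴿ r) *ᴿ unit ^ᴿ r ≤ᴿ p ^ᴿ ∣ D ∣ *ᴿ bound ^ᴿ r
    moment≤ zero V {D} D⊆ V≤ = ≤ᴿ-reflexive (cong (_*ᴿ 1ᴿ)
      (trans (𝔼-cong p N (λ x → *ᴿ-identityʳ (χ D x))) (𝔼-χ p D)))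
    moment≤ (suc r) V {D} D⊆ V≤ = begin
      𝔼 p N (λ x → χ D x *ᴿ (cliqueCount x *ᴿ cliqueCount x ^ᴿ r)) *ᴿ (unit *ᴿ unit ^ᴿ r)
        ≡⟨ cong (_*ᴿ (unit *ᴿ unit ^ᴿ r)) (trans (𝔼-cong p N expand) (𝔼-Σᴿ p N (λ W x → χ (D ∪ edgesIn W) x *ᴿ cliqueCount x ^ᴿ r) Ws)) ⟩
      Σᴿ (λ W → 𝔼 p N (λ x → χ (D ∪ edgesIn W) x *ᴿ cliqueCount x ^ᴿ r)) Ws *ᴿ (unit *ᴿ unit ^ᴿ r)
        ≡⟨ Σᴿ-*ʳ _ _ Ws ⟩
      Σᴿ (λ W → 𝔼 p N (λ x → χ (D ∪ edgesIn W) x *ᴿ cliqueCount x ^ᴿ r) *ᴿ (unit *ᴿ unit ^ᴿ r)) Ws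
        ≤⟨ Σᴿ-mono Ws (λ W∈ → step _ (∈-subsetsOfSize⁻ W∈)) ⟩
      Σᴿ (λ W → p ^ᴿ ∣ D ∪ edgesIn W ∣ *ᴿ unit *ᴿ bound ^ᴿ r) Ws
        ≡⟨ sym (Σᴿ-*ʳ _ _ Ws) ⟩
      Σᴿ (λ W → p ^ᴿ ∣ D ∪ edgesIn W ∣ *ᴿ unit) Ws *ᴿ bound ^ᴿ r
        ≤⟨ *-monoʳ-≤ (0≤^ r 0≤bound) (sum-extensions≤ V D⊆ (ℕ.≤-trans (ℕ.m≤m+n _ _) V≤)) ⟩
      p ^ᴿ ∣ D ∣ *ᴿ bound *ᴿ bound ^ᴿ r
        ≡⟨ *ᴿ-assoc _ _ _ ⟩
      p ^ᴿ ∣ D ∣ *ᴿ (bound *ᴿ bound ^ᴿ r) ∎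
      where
      Ws : List (Subset n)
      Ws = subsetsOfSize t n
      0≤unit : 0ᴿ ≤ᴿ unit
      0≤unit = 0≤^ t (0≤fromℕ (v * h))
      0≤bound : 0ᴿ ≤ᴿ bound
      0≤bound = *-nonNegative (0≤^ (t C s) 0≤p) (0≤fromℕ ((v * n * suc h) ^ t))
      expand : ∀ x → χ D x *ᴿ (cliqueCount x *ᴿ cliqueCount x ^ᴿ r) ≡
                     Σᴿ (λ W → χ (D ∪ edgesIn W) x *ᴿ cliqueCount x ^ᴿ r) Ws
      expand x = trans (sym (*ᴿ-assoc _ _ _)) (trans (cong (_*ᴿ cliqueCount x ^ᴿ r)
        (trans (Σᴿ-*ˡ _ (χ D x) Ws) (Σᴿ-cong Ws λ W → χ-∪ D (edgesIn W) x))) (Σᴿ-*ʳ _ _ Ws))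
        where
        Σᴿ-cong : ∀ {A : Set} {f g : A → ℝ} xs → (∀ x → f x ≡ g x) → Σᴿ f xs ≡ Σᴿ g xs
        Σᴿ-cong []       f≡g = refl
        Σᴿ-cong (x ∷ xs) f≡g = cong₂ _+ᴿ_ (f≡g x) (Σᴿ-cong xs f≡g)
      step : ∀ W → ∣ W ∣ ≡ t →
        𝔼 p N (λ x → χ (D ∪ edgesIn W) x *ᴿ cliqueCount x ^ᴿ r) *ᴿ (unit *ᴿ unit ^ᴿ r) ≤ᴿ
        p ^ᴿ ∣ D ∪ edgesIn W ∣ *ᴿ unit *ᴿ bound ^ᴿ r
      step W ∣W∣≡t = begin
        e *ᴿ (unit *ᴿ unit ^ᴿ r)              ≡⟨ solve 3 (λ e u w → e :* (u :* w) := e :* w :* u) refl e unit (unit ^ᴿ r) ⟩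
        e *ᴿ unit ^ᴿ r *ᴿ unit                ≤⟨ *-monoʳ-≤ 0≤unit (moment≤ r (V ∪ W) (edgePositionsIn-∪ s V W D⊆) size) ⟩
        p ^ᴿ ∣ D ∪ edgesIn W ∣ *ᴿ bound ^ᴿ r *ᴿ unit
          ≡⟨ solve 3 (λ e u w → e :* w :* u := e :* u :* w) refl (p ^ᴿ ∣ D ∪ edgesIn W ∣) unit (bound ^ᴿ r) ⟩
        p ^ᴿ ∣ D ∪ edgesIn W ∣ *ᴿ unit *ᴿ bound ^ᴿ r ∎
        where
        e : ℝ
        e = 𝔼 p N (λ x → χ (D ∪ edgesIn W) x *ᴿ cliqueCount x ^ᴿ r)
        size : ∣ V ∪ W ∣ + r * t ≤ v
        size = ℕ.≤-trans (ℕ.+-monoˡ-≤ (r * t) (∣∪∣≤ V W))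
              (ℕ.≤-trans (ℕ.≤-reflexive (trans (ℕ.+-assoc ∣ V ∣ ∣ W ∣ (r * t)) (cong (λ k → ∣ V ∣ + (k + r * t)) ∣W∣≡t))) V≤)

    module _ (1≤n : 1 ≤ n) (1≤v : 1 ≤ v) (1≤h : 1 ≤ h) (ratio : 2 * suc h ^ t ≤ 3 * h ^ t) where

      manyCliques : Coins → Bool
      manyCliques x = does (fromℕ 2 *ᴿ fromℕ n ^ᴿ t *ᴿ p ^ᴿ (t C s) ≤ᴿ? fromℕ (length (cl t (hypergraph {n} {s} x))))

      private
        0<mean : 0ᴿ <ᴿ mean
        0<mean = 0<x*y (0<^ t (0<fromℕ 1≤n)) (0<^ (t C s) 0<p)

      -- The factor `χ ∅ x` equals 1; it gives the right side the form to which `moment≤` applies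
      -- with nothing chosen yet.
      markov : ∀ r → flipPr p N manyCliques *ᴿ (fromℕ 2 *ᴿ mean) ^ᴿ r ≤ᴿ 𝔼 p N (λ x → χ ∅ x *ᴿ cliqueCount x ^ᴿ r)
      markov r = begin
        flipPr p N manyCliques *ᴿ (fromℕ 2 *ᴿ mean) ^ᴿ r            ≡⟨ cong (_*ᴿ (fromℕ 2 *ᴿ mean) ^ᴿ r) (flipPr≡𝔼 p N manyCliques) ⟩
        𝔼 p N (λ x → indicator (manyCliques x)) *ᴿ (fromℕ 2 *ᴿ mean) ^ᴿ r ≡⟨ sym (𝔼-*ʳ p N _ _) ⟩
        𝔼 p N (λ x → indicator (manyCliques x) *ᴿ (fromℕ 2 *ᴿ mean) ^ᴿ r) ≤⟨ 𝔼-mono p 0≤p p≤1 N pointwise ⟩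
        𝔼 p N (λ x → χ ∅ x *ᴿ cliqueCount x ^ᴿ r)                    ∎
        where
        pointwise : ∀ x → indicator (manyCliques x) *ᴿ (fromℕ 2 *ᴿ mean) ^ᴿ r ≤ᴿ χ ∅ x *ᴿ cliqueCount x ^ᴿ r
        pointwise x rewrite χ-⊆ ∅ x Subset.⊥⊆ with fromℕ 2 *ᴿ fromℕ n ^ᴿ t *ᴿ p ^ᴿ (t C s) ≤ᴿ? fromℕ (length (cl t (hypergraph {n} {s} x)))
        ... | yes le = *-monoˡ-≤ 0≤1 (^-monoˡ-≤ r (*-nonNegative (0≤fromℕ 2) (proj₁ 0<mean))
                                       (≤ᴿ-trans (≤ᴿ-reflexive (sym (*ᴿ-assoc _ _ _))) (≤ᴿ-trans le (length-cl≤cliqueCount x))))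
        ... | no _   = subst (_≤ᴿ 1ᴿ *ᴿ cliqueCount x ^ᴿ r) (sym (*ᴿ-zeroˡ ((fromℕ 2 *ᴿ mean) ^ᴿ r))) (*-nonNegative 0≤1 (0≤^ r (0≤cliqueCount x)))

      -- Being at or above twice the mean against a moment of at most `(3/2 mean) ^ r` gives the
      -- ratio 3/4. All sides are multiplied by `unit ^ r` and `2 ^ r` so that no division occurs.
      tail : ∀ r → r * t ≤ v → flipPr p N manyCliques *ᴿ fromℕ 4 ^ᴿ r ≤ᴿ fromℕ 3 ^ᴿ r
      tail r rt≤v = *-cancelʳ-≤ ((mean *ᴿ unit) ^ᴿ r) (0<^ r (0<x*y 0<mean 0<unit)) (begin
        pr *ᴿ fromℕ 4 ^ᴿ r *ᴿ (mean *ᴿ unit) ^ᴿ r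
          ≡⟨ trans (*ᴿ-assoc _ _ _) (cong (pr *ᴿ_) (trans (sym (^-distrib-* (fromℕ 4) (mean *ᴿ unit) r)) (trans (cong (_^ᴿ r) four)
               (trans (^-distrib-* (fromℕ 2 *ᴿ mean *ᴿ unit) (fromℕ 2) r) (cong (_*ᴿ fromℕ 2 ^ᴿ r) (^-distrib-* (fromℕ 2 *ᴿ mean) unit r)))))) ⟩
        pr *ᴿ ((fromℕ 2 *ᴿ mean) ^ᴿ r *ᴿ unit ^ᴿ r *ᴿ fromℕ 2 ^ᴿ r)
          ≡⟨ solve 4 (λ a b c d → a :* (b :* c :* d) := a :* b :* c :* d) refl pr ((fromℕ 2 *ᴿ mean) ^ᴿ r) (unit ^ᴿ r) (fromℕ 2 ^ᴿ r) ⟩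
        pr *ᴿ (fromℕ 2 *ᴿ mean) ^ᴿ r *ᴿ unit ^ᴿ r *ᴿ fromℕ 2 ^ᴿ r
          ≤⟨ *-monoʳ-≤ (0≤^ r (0≤fromℕ 2)) (*-monoʳ-≤ (0≤^ r (proj₁ 0<unit)) (markov r)) ⟩
        𝔼 p N (λ x → χ ∅ x *ᴿ cliqueCount x ^ᴿ r) *ᴿ unit ^ᴿ r *ᴿ fromℕ 2 ^ᴿ r
          ≤⟨ *-monoʳ-≤ (0≤^ r (0≤fromℕ 2)) (moment≤ r ∅ {∅} Subset.⊥⊆ size) ⟩
        p ^ᴿ ∣ ∅ {N} ∣ *ᴿ bound ^ᴿ r *ᴿ fromℕ 2 ^ᴿ r
          ≡⟨ cong (λ k → p ^ᴿ k *ᴿ bound ^ᴿ r *ᴿ fromℕ 2 ^ᴿ r) (Subset.∣⊥∣≡0 N) ⟩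
        1ᴿ *ᴿ bound ^ᴿ r *ᴿ fromℕ 2 ^ᴿ r
          ≡⟨ cong (_*ᴿ fromℕ 2 ^ᴿ r) (*ᴿ-identityˡ _) ⟩
        bound ^ᴿ r *ᴿ fromℕ 2 ^ᴿ r
          ≡⟨ sym (^-distrib-* bound (fromℕ 2) r) ⟩
        (bound *ᴿ fromℕ 2) ^ᴿ r
          ≤⟨ ^-monoˡ-≤ r (*-nonNegative (*-nonNegative (0≤^ (t C s) 0≤p) (0≤fromℕ ((v * n * suc h) ^ t))) (0≤fromℕ 2)) bound≤ ⟩
        (fromℕ 3 *ᴿ (mean *ᴿ unit)) ^ᴿ r
          ≡⟨ ^-distrib-* (fromℕ 3) (mean *ᴿ unit) r ⟩
        fromℕ 3 ^ᴿ r *ᴿ (mean *ᴿ unit) ^ᴿ r ∎)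
        where
        pr : ℝ
        pr = flipPr p N manyCliques
        0<unit : 0ᴿ <ᴿ unit
        0<unit = 0<^ t (0<fromℕ (ℕ.*-mono-≤ 1≤v 1≤h))
        size : ∣ ∅ {n} ∣ + r * t ≤ v
        size = subst (λ k → k + r * t ≤ v) (sym (Subset.∣⊥∣≡0 n)) rt≤v
        four : fromℕ 4 *ᴿ (mean *ᴿ unit) ≡ fromℕ 2 *ᴿ mean *ᴿ unit *ᴿ fromℕ 2
        four = trans (cong (_*ᴿ (mean *ᴿ unit)) (fromℕ-* 2 2))
          (solve 3 (λ w m u → w :* w :* (m :* u) := w :* m :* u :* w) refl (fromℕ 2) mean unit)
        bound≤ : bound *ᴿ fromℕ 2 ≤ᴿ fromℕ 3 *ᴿ (mean *ᴿ unit)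
        bound≤ = begin
          p ^ᴿ (t C s) *ᴿ fromℕ ((v * n * suc h) ^ t) *ᴿ fromℕ 2
            ≡⟨ trans (*ᴿ-assoc _ _ _) (cong (p ^ᴿ (t C s) *ᴿ_) (sym (fromℕ-* ((v * n * suc h) ^ t) 2))) ⟩
          p ^ᴿ (t C s) *ᴿ fromℕ ((v * n * suc h) ^ t * 2)
            ≤⟨ *-monoˡ-≤ (0≤^ (t C s) 0≤p) (fromℕ-mono-≤ (powers-ratio v n h t ratio)) ⟩
          p ^ᴿ (t C s) *ᴿ fromℕ (3 * (n ^ t * (v * h) ^ t))
            ≡⟨ cong (p ^ᴿ (t C s) *ᴿ_) (trans (fromℕ-* 3 (n ^ t * (v * h) ^ t)) (cong (fromℕ 3 *ᴿ_)
                 (trans (fromℕ-* (n ^ t) ((v * h) ^ t)) (cong₂ _*ᴿ_ (fromℕ-^ n t) (fromℕ-^ (v * h) t))))) ⟩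
          p ^ᴿ (t C s) *ᴿ (fromℕ 3 *ᴿ (fromℕ n ^ᴿ t *ᴿ unit))
            ≡⟨ solve 4 (λ p w n u → p :* (w :* (n :* u)) := w :* (n :* p :* u)) refl (p ^ᴿ (t C s)) (fromℕ 3) (fromℕ n ^ᴿ t) unit ⟩
          fromℕ 3 *ᴿ (mean *ᴿ unit) ∎

      tail-2^ : ∀ u → 3 * u * t ≤ v → flipPr p N manyCliques *ᴿ fromℕ (2 ^ u) ≤ᴿ 1ᴿ
      tail-2^ u 3ut≤v = *-cancelʳ-≤ (fromℕ (3 ^ (3 * u))) (0<fromℕ (ℕ.m^n>0 3 (3 * u))) (begin
        pr *ᴿ fromℕ (2 ^ u) *ᴿ fromℕ (3 ^ (3 * u))    ≡⟨ trans (*ᴿ-assoc _ _ _) (cong (pr *ᴿ_) (sym (fromℕ-* (2 ^ u) (3 ^ (3 * u))))) ⟩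
        pr *ᴿ fromℕ (2 ^ u * 3 ^ (3 * u))             ≤⟨ *-monoˡ-≤ 0≤pr (fromℕ-mono-≤ (54^u≤64^u u)) ⟩
        pr *ᴿ fromℕ (4 ^ (3 * u))                     ≡⟨ cong (pr *ᴿ_) (fromℕ-^ 4 (3 * u)) ⟩
        pr *ᴿ fromℕ 4 ^ᴿ (3 * u)                      ≤⟨ tail (3 * u) 3ut≤v ⟩
        fromℕ 3 ^ᴿ (3 * u)                            ≡⟨ trans (sym (fromℕ-^ 3 (3 * u))) (sym (*ᴿ-identityˡ _)) ⟩
        1ᴿ *ᴿ fromℕ (3 ^ (3 * u))                     ∎)
        where
        pr : ℝ
        pr = flipPr p N manyCliques
        0≤pr : 0ᴿ ≤ᴿ pr
        0≤pr = subst₂ _≤ᴿ_ (𝔼-const p N 0ᴿ) (sym (flipPr≡𝔼 p N manyCliques))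
                 (𝔼-mono p 0≤p p≤1 N (λ x → 0≤indicator (manyCliques x)))

-- The algorithm

elements : ∀ {n} → Subset n → List (Fin n)
elements {n} A = filter (Subset._∈? A) (allFin n)

length-elements : ∀ {n} (A : Subset n) → length (elements A) ≡ ∣ A ∣
length-elements [] = refl
length-elements {suc n} (b ∷ A) = length-elements-∷ b
  where
  tail : ∀ b → length (filter (Subset._∈? (b ∷ A)) (List.tabulate Fin.suc)) ≡ ∣ A ∣
  tail b = trans (cong length (trans (cong (filter (Subset._∈? (b ∷ A))) (sym (List.map-tabulate id Fin.suc)))
                                     (filter-map (Subset._∈? (b ∷ A)) (Subset._∈? A) Subset.drop-there there (allFin n))))
           (trans (List.length-map Fin.suc (elements A)) (length-elements A))
  length-elements-∷ : ∀ b → length (elements (b ∷ A)) ≡ ∣ b ∷ A ∣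
  length-elements-∷ inside  = cong suc (tail inside)
  length-elements-∷ outside = tail outside

nCk≤2^n : ∀ n k → n C k ≤ 2 ^ n
nCk≤2^n n       zero    = ℕ.m^n>0 2 n
nCk≤2^n zero    (suc k) = z≤n
nCk≤2^n (suc n) (suc k) = subst (_≤ 2 ^ suc n) (nCk+nC[k+1]≡[n+1]C[k+1] n k)
  (ℕ.+-mono-≤ (nCk≤2^n n k) (subst (n C suc k ≤_) (sym (ℕ.+-identityʳ _)) (nCk≤2^n n (suc k))))

infix 4 _<ˢ_
_<ˢ_ : ∀ {n} → Subset n → Fin n → Set
A <ˢ v = ∀ {w} → w ∈ˢ A → w Fin.< v

<ˢ⇒∉ : ∀ {n} {A : Subset n} {v} → A <ˢ v → v ∉ˢ A
<ˢ⇒∉ A<v v∈A = ℕ.<-irrefl refl (A<v v∈A)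

∣∪⁅⁆∣≤ : ∀ {n} (A : Subset n) v → ∣ A ∪ ⁅ v ⁆ ∣ ≤ suc ∣ A ∣
∣∪⁅⁆∣≤ A v = ℕ.≤-trans (∣∪∣≤ A ⁅ v ⁆) (ℕ.≤-reflexive (trans (cong (∣ A ∣ +_) (Subset.∣⁅x⁆∣≡1 v)) (ℕ.+-comm ∣ A ∣ 1)))

∣∪⁅⁆∣ : ∀ {n} {A : Subset n} {v} → v ∉ˢ A → ∣ A ∪ ⁅ v ⁆ ∣ ≡ suc ∣ A ∣
∣∪⁅⁆∣ {n} {A} {v} v∉A = trans (sym (ℕ.+-identityʳ _)) (trans (cong (∣ A ∪ ⁅ v ⁆ ∣ +_) (sym disjoint))
  (trans (∣∪∣+∣∩∣ A ⁅ v ⁆) (trans (cong (∣ A ∣ +_) (Subset.∣⁅x⁆∣≡1 v)) (ℕ.+-comm ∣ A ∣ 1))))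
  where
  empty : ∀ w → ¬ (w ∈ˢ A ∩ ⁅ v ⁆)
  empty w w∈ with Subset.x∈p∩q⁻ A ⁅ v ⁆ w∈
  ... | w∈A , w∈v = v∉A (subst (_∈ˢ A) (Subset.x∈⁅y⁆⇒x≡y v w∈v) w∈A)
  disjoint : ∣ A ∩ ⁅ v ⁆ ∣ ≡ 0
  disjoint = trans (cong ∣_∣ (Subset.Empty-unique λ (w , w∈) → empty w w∈)) (Subset.∣⊥∣≡0 n)

-- Each new vertex is the maximum of its union, so equal unions have equal maxima; deleting the
-- maximum recovers the smaller set. Hence no clique is generated twice.
∪⁅⁆-injective : ∀ {n} {A A′ : Subset n} {v v′} → A <ˢ v → A′ <ˢ v′ → A ∪ ⁅ v ⁆ ≡ A′ ∪ ⁅ v′ ⁆ → v ≡ v′ × A ≡ A′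
∪⁅⁆-injective {A = A} {A′} {v} {v′} A<v A′<v′ eq = v≡v′ , Subset.⊆-antisym (part eq A<v v≡v′) (part (sym eq) A′<v′ (sym v≡v′))
  where
  maximum : ∀ {A A′ : Subset _} {v v′} → A ∪ ⁅ v ⁆ ≡ A′ ∪ ⁅ v′ ⁆ → A′ <ˢ v′ → v Fin.≤ v′
  maximum {A} {A′} {v} {v′} eq A′<v′
    with Subset.x∈p∪q⁻ A′ ⁅ v′ ⁆ (subst (v ∈ˢ_) eq (Subset.q⊆p∪q A ⁅ v ⁆ (Subset.x∈⁅x⁆ v)))
  ... | inj₁ v∈A′ = ℕ.<⇒≤ (A′<v′ v∈A′)
  ... | inj₂ v∈v′ = ℕ.≤-reflexive (cong Fin.toℕ (Subset.x∈⁅y⁆⇒x≡y v′ v∈v′))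
  v≡v′ : v ≡ v′
  v≡v′ = Fin.≤-antisym (maximum eq A′<v′) (maximum (sym eq) A<v)
  part : ∀ {A A′ : Subset _} {v v′} → A ∪ ⁅ v ⁆ ≡ A′ ∪ ⁅ v′ ⁆ → A <ˢ v → v ≡ v′ → A ⊆ˢ A′
  part {A} {A′} {v} eq A<v refl {w} w∈A with Subset.x∈p∪q⁻ A′ ⁅ v ⁆ (subst (w ∈ˢ_) eq (Subset.p⊆p∪q ⁅ v ⁆ w∈A))
  ... | inj₁ w∈A′ = w∈A′
  ... | inj₂ w∈v  = ⊥-elim (<ˢ⇒∉ A<v (subst (_∈ˢ A) (Subset.x∈⁅y⁆⇒x≡y v w∈v) w∈A))

remove-maximum : ∀ {n t} (W : Subset n) → ∣ W ∣ ≡ suc t → ∃[ A ] ∃[ v ] (W ≡ A ∪ ⁅ v ⁆ × A <ˢ v × ∣ A ∣ ≡ t)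
remove-maximum (outside ∷ W) size with remove-maximum W size
... | A , v , eq , A<v , ∣A∣ = outside ∷ A , suc v , cong (outside ∷_) eq , below , ∣A∣
  where
  below : outside ∷ A <ˢ suc v
  below (there w∈) = s≤s (A<v w∈)
-- Vectors list the vertices in increasing order, so a first vertex in the set is its maximum
-- exactly when nothing follows, that is, when the set has one element.
remove-maximum {suc n} {zero} (inside ∷ W) size = outside ∷ ∅ , zero , cong (inside ∷_) eq , below , Subset.∣⊥∣≡0 n
  where
  W≡∅ : W ≡ ∅
  W≡∅ = Subset.Empty-unique λ (w , w∈) → ℕ.<⇒≢ (ℕ.≤-trans (ℕ.≤-reflexive (sym (Subset.∣⁅x⁆∣≡1 w)))
          (Subset.p⊆q⇒∣p∣≤∣q∣ λ u∈ → subst (_∈ˢ W) (sym (Subset.x∈⁅y⁆⇒x≡y w u∈)) w∈)) (sym (ℕ.suc-injective size))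
  eq : W ≡ ∅ ∪ ∅
  eq = trans W≡∅ (sym (Subset.∪-idem ∅))
  below : outside ∷ ∅ <ˢ zero
  below (there w∈) = ⊥-elim (Subset.∉⊥ w∈)
remove-maximum {t = suc t} (inside ∷ W) size with remove-maximum W (ℕ.suc-injective size)
... | A , v , eq , A<v , ∣A∣ = inside ∷ A , suc v , cong (inside ∷_) eq , below , cong suc ∣A∣
  where
  below : inside ∷ A <ˢ suc v
  below here       = s≤s z≤n
  below (there w∈) = s≤s (A<v w∈)

unique⊆⇒length≤ : ∀ {A : Set} {xs ys : List A} → Unique xs → (∀ {x} → x ∈ᴸ xs → x ∈ᴸ ys) → length xs ≤ length ys
unique⊆⇒length≤ {xs = xs} {ys} unique xs⊆ys = Fin.injective⇒≤ {f = position} injective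
  where
  position : Fin (length xs) → Fin (length ys)
  position i = index (xs⊆ys (∈-lookup i))
  injective : ∀ {i j} → position i ≡ position j → i ≡ j
  injective {i} {j} eq = lookup-injective unique (trans (lookup-index (xs⊆ys (∈-lookup i)))
    (trans (cong (lookup ys) eq) (sym (lookup-index (xs⊆ys (∈-lookup j))))))

unique-map⁺ : ∀ {A B : Set} {f : A → B} {xs} → (∀ {x y} → x ∈ᴸ xs → y ∈ᴸ xs → f x ≡ f y → x ≡ y) →
              Unique xs → Unique (map f xs)
unique-map⁺ inj []       = []
unique-map⁺ inj (x∉ ∷ u) =
  All.map⁺ (All.tabulate λ y∈ fx≡fy → All.lookup x∉ y∈ (inj (here refl) (there y∈) fx≡fy)) ∷
  unique-map⁺ (λ x∈ y∈ → inj (there x∈) (there y∈)) u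

-- A computation that halts without output satisfies every invariant but is still charged for its
-- steps.
Safe : ∀ {A : Set} → ℕ → (A → Set) → Comp A → Set
Safe c I m = steps m ≤ c × (∀ a → output m ≡ just a → I a)

Trivial : ∀ {A : Set} → A → Set
Trivial _ = ⊤

safe-tick : ∀ {A : Set} {c} {I : A → Set} {m} → Safe c I m → Safe (suc c) I (tick m)
safe-tick (c≥ , out) = s≤s c≥ , out

safe-return : ∀ {A : Set} {I : A → Set} {a} → I a → Safe 0 I (return a)
safe-return Ia = z≤n , λ { _ refl → Ia }

safe-weaken : ∀ {A : Set} {c d} {I : A → Set} {m} → c ≤ d → Safe c I m → Safe d I m
safe-weaken c≤d (c≥ , out) = ℕ.≤-trans c≥ c≤d , out

safe->>= : ∀ {A B : Set} {c d} {I : A → Set} {J : B → Set} (m : Comp A) {f : A → Comp B} →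
           Safe c I m → (∀ a → I a → Safe d J (f a)) → Safe (c + d) J (m >>= f)
safe->>= (t , nothing) (t≤c , _)   safe = ℕ.≤-trans t≤c (ℕ.m≤m+n _ _) , λ _ ()
safe->>= (t , just a)  (t≤c , out) safe = let (u≤d , out′) = safe a (out a refl) in ℕ.+-mono-≤ t≤c u≤d , out′

safe-forEach : ∀ {A B : Set} {c} {I : B → Set} {f : A → B → Comp B} (as : List A) b →
               (∀ {a} → a ∈ᴸ as → ∀ b → I b → Safe c I (f a b)) → I b → Safe (length as * suc c) I (forEach as b f)
safe-forEach []       b safe Ib = safe-return Ib
safe-forEach {f = f} (a ∷ as) b safe Ib =
  safe->>= (tick (f a b)) (safe-tick (safe (here refl) b Ib)) λ b′ Ib′ → safe-forEach as b′ (safe ∘ there) Ib′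

output->>= : ∀ {A B : Set} (m : Comp A) {f : A → Comp B} {a} → output m ≡ just a → output (m >>= f) ≡ output (f a)
output->>= (t , just a) refl = refl

output-forEach : ∀ {A B : Set} {f : A → B → Comp B} {g : B → A → B} → (∀ a b → output (f a b) ≡ just (g b a)) →
                 ∀ as b → output (forEach as b f) ≡ just (foldl g b as)
output-forEach pure []       b = refl
output-forEach {f = f} pure (a ∷ as) b = trans (output->>= (tick (f a b)) (pure a b)) (output-forEach pure as _)

foldl-∧ : ∀ {A : Set} {P : Pred A 0ℓ} (P? : Decidable P) b as →
          foldl (λ b a → b ∧ does (P? a)) b as ≡ b ∧ does (all? P? as)
foldl-∧ P? b []       = sym (Bool.∧-identityʳ b)
foldl-∧ P? b (a ∷ as) = trans (foldl-∧ P? (b ∧ does (P? a)) as) (Bool.∧-assoc b _ _)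

-- Steps spent on one pair (v , A) when all tested sets have size at most k; the extra steps of levelCost are those of the two loops.
pairCost levelCost : ℕ → ℕ
pairCost k  = k * 2 + (2 ^ k * 2 + 2)
levelCost k = suc (suc (pairCost k))

module Algorithm (R : Reals) {n s : ℕ} (G : Hypergraph n s) where
  open OrderedField R
  open WithReals R
  open ≤ᴿ-Reasoning

  safe-isAbove : ∀ (v : Fin n) A → Safe (∣ A ∣ * 2) Trivial (isAbove v A)
  safe-isAbove v A = subst (λ l → Safe (l * 2) Trivial (isAbove v A)) (length-elements A)
    (safe-forEach (elements A) true (λ _ b _ → safe-tick (safe-return tt)) tt)

  safe-testClique : ∀ (W : Subset n) → Safe (2 ^ ∣ W ∣ * 2) Trivial (testClique G W)
  safe-testClique W = safe-weaken (ℕ.*-monoˡ-≤ 2 (ℕ.≤-trans (ℕ.≤-reflexive (length-binom W s)) (nCk≤2^n ∣ W ∣ s)))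
    (safe-forEach (binom W s) true (λ _ b _ → safe-tick (safe-return tt)) tt)

  -- Both conditions hold for every list returned by `next`, whatever the hypergraph, because
  -- reaching the cutoff halts the run. This is what makes the time bound a worst-case one.
  Bounded : ℕ → ℝ → List (Subset n) → Set
  Bounded t cutoff S = All (λ A → ∣ A ∣ ≤ t) S × fromℕ (length S) ≤ᴿ cutoff

  safe-insert : ∀ {t cutoff} W S → ∣ W ∣ ≤ t → Bounded t cutoff S → Safe 2 (Bounded t cutoff) (insert cutoff W S)
  safe-insert {cutoff = cutoff} W S ∣W∣≤t (sizes , _) with cutoff ≤ᴿ? fromℕ (length (W ∷ S))
  ... | yes _ = ℕ.≤-refl , λ _ ()
  ... | no ≰  = ℕ.≤-refl , λ { _ refl → ∣W∣≤t ∷ sizes , ≰⇒≥ ≰ }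

  safe-next : ∀ {k t cutoff} S → t < k → 0ᴿ ≤ᴿ cutoff → All (λ A → ∣ A ∣ ≤ t) S →
    Safe (n * suc (length S * suc (pairCost k))) (Bounded (suc t) cutoff) (next G cutoff S)
  safe-next {k} {t} {cutoff} S t<k 0≤cutoff sizes =
    subst (λ l → Safe (l * suc (length S * suc (pairCost k))) (Bounded (suc t) cutoff) (next G cutoff S)) (List.length-tabulate {n = n} id)
      (safe-forEach (allFin n) [] (λ {v} _ S₁ S₁-ok →
        safe-forEach S S₁ (λ {A} A∈S S′ S′-ok → body v A S′ (All.lookup sizes A∈S) S′-ok) S₁-ok) ([] , 0≤cutoff))
    where
    body : ∀ v A S′ → ∣ A ∣ ≤ t → Bounded (suc t) cutoff S′ → Safe (pairCost k) (Bounded (suc t) cutoff)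
      (isAbove v A >>= λ above → testClique G (A ∪ ⁅ v ⁆) >>= λ clique →
        if clique ∧ above then insert cutoff (A ∪ ⁅ v ⁆) S′ else return S′)
    body v A S′ ∣A∣≤t S′-ok = safe->>= {I = Trivial} (isAbove v A)
      (safe-weaken (ℕ.*-monoˡ-≤ 2 (ℕ.≤-trans ∣A∣≤t (ℕ.<⇒≤ t<k))) (safe-isAbove v A)) λ above _ →
      safe->>= {I = Trivial} (testClique G (A ∪ ⁅ v ⁆))
      (safe-weaken (ℕ.*-monoˡ-≤ 2 (ℕ.^-monoʳ-≤ 2 (ℕ.≤-trans size t<k))) (safe-testClique (A ∪ ⁅ v ⁆))) λ clique _ →
      branch (clique ∧ above)
      where
      size : ∣ A ∪ ⁅ v ⁆ ∣ ≤ suc t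
      size = ℕ.≤-trans (∣∪⁅⁆∣≤ A v) (s≤s ∣A∣≤t)
      branch : ∀ b → Safe 2 (Bounded (suc t) cutoff) (if b then insert cutoff (A ∪ ⁅ v ⁆) S′ else return S′)
      branch true  = safe-insert (A ∪ ⁅ v ⁆) S′ size S′-ok
      branch false = safe-weaken z≤n (safe-return S′-ok)

  steps->>= : ∀ {A B : Set} {c} {I : A → Set} {x} (m : Comp A) {f : A → Comp B} → Safe c I m → 0ᴿ ≤ᴿ x →
              (∀ a → I a → fromℕ (steps (f a)) ≤ᴿ x) → fromℕ (steps (m >>= f)) ≤ᴿ fromℕ c +ᴿ x
  steps->>= (t , nothing) (t≤c , _) 0≤x f≤ = ≤ᴿ-trans (fromℕ-mono-≤ t≤c) (x≤x+y 0≤x)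
  steps->>= (t , just a) {f} (t≤c , out) 0≤x f≤ =
    subst (_≤ᴿ _) (sym (fromℕ-+ t (steps (f a)))) (+-mono₂ (fromℕ-mono-≤ t≤c) (f≤ a (out a refl)))

  module _ (k : ℕ) (cut : ℕ → ℝ) (B : ℝ) (0≤cut : ∀ i → 0ᴿ ≤ᴿ cut i) (n≤B : fromℕ n ≤ᴿ B) where

    private
      0≤B : 0ᴿ ≤ᴿ B
      0≤B = ≤ᴿ-trans (0≤fromℕ n) n≤B

    -- `n ≤ B` pays for the steps of the outer loop itself, `n l ≤ B` for the pairs of a vertex and
    -- a set.
    next-cost : ∀ l → fromℕ n *ᴿ fromℕ l ≤ᴿ B → fromℕ (n * suc (l * suc (pairCost k))) ≤ᴿ B *ᴿ fromℕ (levelCost k)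
    next-cost l nl≤B = begin
      fromℕ (n * suc (l * c))                                ≡⟨ fromℕ-* n (suc (l * c)) ⟩
      fromℕ n *ᴿ (1ᴿ +ᴿ fromℕ (l * c))                       ≡⟨ cong (λ w → fromℕ n *ᴿ (1ᴿ +ᴿ w)) (fromℕ-* l c) ⟩
      fromℕ n *ᴿ (1ᴿ +ᴿ fromℕ l *ᴿ fromℕ c)                  ≡⟨ solve 3 (λ n l c → n :* (con 1 :+ l :* c) := n :+ n :* l :* c) refl (fromℕ n) (fromℕ l) (fromℕ c) ⟩
      fromℕ n +ᴿ fromℕ n *ᴿ fromℕ l *ᴿ fromℕ c               ≤⟨ +-mono₂ n≤B (*-monoʳ-≤ (0≤fromℕ c) nl≤B) ⟩
      B +ᴿ B *ᴿ fromℕ c                                      ≡⟨ solve 2 (λ B c → B :+ B :* c := B :* (con 1 :+ c)) refl B (fromℕ c) ⟩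
      B *ᴿ fromℕ (levelCost k)                                   ∎
      where
      c : ℕ
      c = suc (pairCost k)

    -- A round costs of order `n` times the length of the list it extends, besides the `n` turns of
    -- its outer loop. The first length is bounded by hypothesis, the later ones by their cutoffs,
    -- so only cutoffs strictly between `t` and `t + m` enter.
    steps-grow : ∀ m t S → t + m ≤ k → (∀ i → t < i → i < t + m → fromℕ n *ᴿ cut i ≤ᴿ B) →
      All (λ A → ∣ A ∣ ≤ t) S → fromℕ n *ᴿ fromℕ (length S) ≤ᴿ B →
      fromℕ (steps (grow G cut (suc t) m S)) ≤ᴿ fromℕ m *ᴿ (B *ᴿ fromℕ (levelCost k))
    steps-grow zero    t S t+m≤k cut≤B sizes nS≤B = ≤ᴿ-reflexive (sym (*ᴿ-zeroˡ _))
    steps-grow (suc m) t S t+m≤k cut≤B sizes nS≤B = begin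
      fromℕ (steps (next G (cut (suc t)) S >>= grow G cut (suc (suc t)) m))
        ≤⟨ steps->>= (next G (cut (suc t)) S) (safe-next S t<k (0≤cut (suc t)) sizes) 0≤rest (rest m t+m≤k cut≤B) ⟩
      fromℕ (n * suc (length S * suc (pairCost k))) +ᴿ fromℕ m *ᴿ (B *ᴿ fromℕ (levelCost k))
        ≤⟨ +-mono _ (next-cost (length S) nS≤B) ⟩
      B *ᴿ fromℕ (levelCost k) +ᴿ fromℕ m *ᴿ (B *ᴿ fromℕ (levelCost k))
        ≡⟨ solve 2 (λ x m → x :+ m :* x := (con 1 :+ m) :* x) refl (B *ᴿ fromℕ (levelCost k)) (fromℕ m) ⟩
      fromℕ (suc m) *ᴿ (B *ᴿ fromℕ (levelCost k)) ∎
      where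
      t<k : t < k
      t<k = ℕ.≤-trans (ℕ.≤-trans (s≤s (ℕ.m≤m+n t m)) (ℕ.≤-reflexive (sym (ℕ.+-suc t m)))) t+m≤k
      0≤rest : 0ᴿ ≤ᴿ fromℕ m *ᴿ (B *ᴿ fromℕ (levelCost k))
      0≤rest = *-nonNegative (0≤fromℕ m) (*-nonNegative 0≤B (0≤fromℕ (levelCost k)))
      -- The last set S_k is never extended, so its cutoff plays no role.
      rest : ∀ m → t + suc m ≤ k → (∀ i → t < i → i < t + suc m → fromℕ n *ᴿ cut i ≤ᴿ B) →
        ∀ S′ → Bounded (suc t) (cut (suc t)) S′ →
        fromℕ (steps (grow G cut (suc (suc t)) m S′)) ≤ᴿ fromℕ m *ᴿ (B *ᴿ fromℕ (levelCost k))
      rest zero    _     _     S′ _                 = ≤ᴿ-reflexive (sym (*ᴿ-zeroˡ _))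
      rest (suc m) t+m≤k cut≤B S′ (sizes′ , length≤) = steps-grow (suc m) (suc t) S′
        (subst (_≤ k) (ℕ.+-suc t (suc m)) t+m≤k)
        (λ i t<i i<t+m → cut≤B i (ℕ.<⇒≤ t<i) (subst (i <_) (sym (ℕ.+-suc t (suc m))) i<t+m))
        sizes′
        (≤ᴿ-trans (*-monoˡ-≤ (0≤fromℕ n) length≤)
          (cut≤B (suc t) ℕ.≤-refl (subst (suc t <_) (sym (trans (ℕ.+-suc t (suc m)) (cong suc (ℕ.+-suc t m))))
            (s≤s (s≤s (ℕ.m≤m+n t m))))))

-- Correctness of the output when no cutoff is reached

module Correctness (R : Reals) {n s : ℕ} (G : Hypergraph n s) where
  open OrderedField R
  open WithReals R

  -- The conjuncts follow the order of `clique ∧ above`, so that deciding them computes the very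
  -- Boolean tested by the algorithm.
  Extends : Fin n → Subset n → Set
  Extends v A = All (_∈ edges G) (binom (A ∪ ⁅ v ⁆) s) × All (Fin._< v) (elements A)

  extends? : ∀ (v : Fin n) A → Dec (Extends v A)
  extends? v A = all? (_∈? edges G) (binom (A ∪ ⁅ v ⁆) s) ×-dec all? (Fin._<? v) (elements A)

  extensions : Fin n → List (Subset n) → List (Subset n)
  extensions v S = map (_∪ ⁅ v ⁆) (filter (extends? v) S)

  step : ℝ → Fin n → Subset n → List (Subset n) → Comp (List (Subset n))
  step cutoff v A S′ =
    isAbove v A >>= λ above →
    testClique G (A ∪ ⁅ v ⁆) >>= λ clique →
    if clique ∧ above then insert cutoff (A ∪ ⁅ v ⁆) S′ else return S′

  output-step : ∀ cutoff (v : Fin n) A S′ → output (step cutoff v A S′) ≡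
    output (if does (extends? v A) then insert cutoff (A ∪ ⁅ v ⁆) S′ else return S′)
  output-step cutoff v A S′ = trans
    (output->>= (isAbove v A) (trans (output-forEach (λ _ _ → refl) (elements A) true) (cong just (foldl-∧ (Fin._<? v) true (elements A)))))
    (output->>= (testClique G (A ∪ ⁅ v ⁆)) (trans (output-forEach (λ _ _ → refl) (binom (A ∪ ⁅ v ⁆) s) true)
      (cong just (foldl-∧ (_∈? edges G) true (binom (A ∪ ⁅ v ⁆) s)))))

  output-insert : ∀ {cutoff} (W : Subset n) S → ¬ (cutoff ≤ᴿ fromℕ (length (W ∷ S))) → output (insert cutoff W S) ≡ just (W ∷ S)
  output-insert {cutoff} W S ≰ with cutoff ≤ᴿ? fromℕ (length (W ∷ S))
  ... | yes le = ⊥-elim (≰ le)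
  ... | no _   = refl

  ≰-weaken : ∀ {cutoff l m} → l ≤ m → ¬ (cutoff ≤ᴿ fromℕ m) → ¬ (cutoff ≤ᴿ fromℕ l)
  ≰-weaken l≤m ≰ le = ≰ (≤ᴿ-trans le (fromℕ-mono-≤ l≤m))

  length≤ʳ++ : ∀ {A : Set} (xs ys : List A) → length ys ≤ length (xs ʳ++ ys)
  length≤ʳ++ xs ys = ℕ.≤-trans (ℕ.m≤n+m (length ys) (length xs)) (ℕ.≤-reflexive (sym (List.length-ʳ++ xs)))

  -- The list only grows, so a final length below the cutoff keeps every intermediate length below
  -- it and no insertion halts. Insertion prepends, hence the reversed append.
  output-inner : ∀ {cutoff} v as S′ → ¬ (cutoff ≤ᴿ fromℕ (length (extensions v as ʳ++ S′))) →
    output (forEach as S′ (step cutoff v)) ≡ just (extensions v as ʳ++ S′)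
  output-inner v [] S′ ≰ = refl
  output-inner {cutoff} v (A ∷ as) S′ ≰ = go (extends? v A)
    where
    Goal : List (Subset n) → Set
    Goal new = output (forEach (A ∷ as) S′ (step cutoff v)) ≡ just (map (_∪ ⁅ v ⁆) new ʳ++ S′)
    taken : Bool → Maybe (List (Subset n))
    taken b = output (if b then insert cutoff (A ∪ ⁅ v ⁆) S′ else return S′)
    go : Dec (Extends v A) → Goal (filter (extends? v) (A ∷ as))
    go (yes ext) = subst Goal (sym accept) (trans
      (output->>= (tick (step cutoff v A S′)) (trans (output-step cutoff v A S′)
        (trans (cong taken (dec-true (extends? v A) ext))
               (output-insert (A ∪ ⁅ v ⁆) S′ (≰-weaken (length≤ʳ++ (extensions v as) _) ≰′)))))
      (output-inner v as _ ≰′))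
      where
      accept : filter (extends? v) (A ∷ as) ≡ A ∷ filter (extends? v) as
      accept = List.filter-accept (extends? v) ext
      ≰′ : ¬ (cutoff ≤ᴿ fromℕ (length (extensions v as ʳ++ ((A ∪ ⁅ v ⁆) ∷ S′))))
      ≰′ = subst (λ new → ¬ (cutoff ≤ᴿ fromℕ (length (map (_∪ ⁅ v ⁆) new ʳ++ S′)))) accept ≰
    go (no ¬ext) = subst Goal (sym reject) (trans
      (output->>= (tick (step cutoff v A S′)) (trans (output-step cutoff v A S′) (cong taken (dec-false (extends? v A) ¬ext))))
      (output-inner v as S′ (subst (λ new → ¬ (cutoff ≤ᴿ fromℕ (length (map (_∪ ⁅ v ⁆) new ʳ++ S′)))) reject ≰)))
      where
      reject : filter (extends? v) (A ∷ as) ≡ filter (extends? v) as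
      reject = List.filter-reject (extends? v) ¬ext

  output-outer : ∀ {cutoff} S vs S′ → ¬ (cutoff ≤ᴿ fromℕ (length (concatMap (λ v → extensions v S) vs ʳ++ S′))) →
    output (forEach vs S′ (λ v S₁ → forEach S S₁ (step cutoff v))) ≡ just (concatMap (λ v → extensions v S) vs ʳ++ S′)
  output-outer S [] S′ ≰ = refl
  output-outer {cutoff} S (v ∷ vs) S′ ≰ rewrite List.++-ʳ++ (extensions v S) {concatMap (λ v → extensions v S) vs} {S′} = trans
    (output->>= (tick (forEach S S′ (step cutoff v)))
      (output-inner v S S′ (≰-weaken (length≤ʳ++ (concatMap (λ v → extensions v S) vs) _) ≰)))
    (output-outer S vs _ ≰)

  IsLevel : ℕ → Subset n → Set
  IsLevel t W = ∣ W ∣ ≡ t × IsClique G W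

  cl⁺ : ∀ {t W} → IsLevel t W → W ∈ cl t G
  cl⁺ (size , clique) = ∈-filter⁺ (isClique? G) (∈-subsetsOfSize⁺ size) clique

  cl⁻ : ∀ {t W} → W ∈ cl t G → IsLevel t W
  cl⁻ {t} W∈ = let (W∈′ , clique) = ∈-filter⁻ (isClique? G) {xs = subsetsOfSize t n} W∈ in ∈-subsetsOfSize⁻ W∈′ , clique

  record Enumerates (t : ℕ) (S : List (Subset n)) : Set where
    field
      unique   : Unique S
      sound    : ∀ {W} → W ∈ S → IsLevel t W
      complete : ∀ {W} → IsLevel t W → W ∈ S

  enumerates-reverse : ∀ {t S} → Enumerates t S → Enumerates t (reverse S)
  enumerates-reverse {t} {S} enum = record
    { unique   = Permutation.Unique-resp-↭ (setoid (Subset n)) (↭⇒↭ₛ (↭-sym (↭-reverse S))) (Enumerates.unique enum)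
    ; sound    = λ W∈ → Enumerates.sound enum (∈-resp-↭ (↭-reverse S) W∈)
    ; complete = λ level → ∈-resp-↭ (↭-sym (↭-reverse S)) (Enumerates.complete enum level)
    }

  enumerates-length : ∀ {t S} → Enumerates t S → length S ≤ length (cl t G)
  enumerates-length enum = unique⊆⇒length≤ (Enumerates.unique enum) λ W∈ → cl⁺ (Enumerates.sound enum W∈)

  extends⇒<ˢ : ∀ {v A} → Extends v A → A <ˢ v
  extends⇒<ˢ {v} {A} (_ , above) w∈ = All.lookup above (∈-filter⁺ (Subset._∈? A) (∈-allFin _) w∈)

  ∈-extensions⁻ : ∀ {v S W} → W ∈ extensions v S → ∃[ A ] (A ∈ S × W ≡ A ∪ ⁅ v ⁆ × Extends v A)
  ∈-extensions⁻ {v} {S} = ∈-map∘filter⁻ (_∪ ⁅ v ⁆) (extends? v) {xs = S}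

  allExtensions : List (Subset n) → List (Subset n)
  allExtensions S = concatMap (λ v → extensions v S) (allFin n)

  -- Extending by a larger vertex and removing the maximum are mutually inverse, and subsets of
  -- cliques are cliques. Uniqueness is needed both for a single new vertex and between different
  -- ones.
  enumerates-suc : ∀ {t S} → Enumerates t S → Enumerates (suc t) (allExtensions S)
  enumerates-suc {t} {S} enum = record { unique = unique′ ; sound = sound′ ; complete = complete′ }
    where
    open Enumerates enum
    unique-extensions : ∀ v → Unique (extensions v S)
    unique-extensions v = unique-map⁺
      (λ {A} {A′} A∈ A′∈ eq → proj₂ (∪⁅⁆-injective (below A∈) (below A′∈) eq))
      (Unique.filter⁺ (extends? v) unique)
      where
      below : ∀ {A} → A ∈ filter (extends? v) S → A <ˢ v
      below A∈ = extends⇒<ˢ (proj₂ (∈-filter⁻ (extends? v) {xs = S} A∈))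
    disjoint : ∀ {v v′} → v ≢ v′ → ∀ {W} → ¬ (W ∈ extensions v S × W ∈ extensions v′ S)
    disjoint v≢v′ (W∈ , W∈′) with ∈-extensions⁻ {S = S} W∈ | ∈-extensions⁻ {S = S} W∈′
    ... | A , _ , refl , ext | A′ , _ , eq , ext′ = v≢v′ (proj₁ (∪⁅⁆-injective (extends⇒<ˢ ext) (extends⇒<ˢ ext′) eq))
    unique′ : Unique (allExtensions S)
    unique′ = Unique.concat⁺ (All.map⁺ (All.tabulate λ {v} _ → unique-extensions v))
                             (AllPairs.map⁺ (AllPairs.map disjoint (Unique.allFin⁺ n)))
    sound′ : ∀ {W} → W ∈ allExtensions S → IsLevel (suc t) W
    sound′ W∈ with find (∈-concatMap⁻ (λ v → extensions v S) {xs = allFin n} W∈)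
    ... | v , _ , W∈v with ∈-extensions⁻ {v} {S} W∈v
    ...   | A , A∈ , refl , ext@(clique , _) =
      trans (∣∪⁅⁆∣ (<ˢ⇒∉ (extends⇒<ˢ ext))) (cong suc (proj₁ (sound A∈))) , All.lookup clique
    complete′ : ∀ {W} → IsLevel (suc t) W → W ∈ allExtensions S
    complete′ {W} (size , clique) with remove-maximum W size
    ... | A , v , refl , A<v , ∣A∣ = ∈-concatMap⁺ (λ v → extensions v S) (lose (∈-allFin v)
      (∈-map∘filter⁺ (_∪ ⁅ v ⁆) (extends? v) (A , complete (∣A∣ , clique-A) , refl , All.tabulate clique ,
        All.tabulate λ w∈ → A<v (proj₂ (∈-filter⁻ (Subset._∈? A) {xs = allFin n} w∈)))))
      where
      clique-A : IsClique G A
      clique-A e∈ = let (e∈′ , e⊆A) = ∈-filter⁻ (Subset._⊆? A) {xs = subsetsOfSize s n} e∈ in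
        clique (∈-filter⁺ (Subset._⊆? (A ∪ ⁅ v ⁆)) e∈′ λ w∈ → Subset.p⊆p∪q ⁅ v ⁆ (e⊆A w∈))

  -- The generated list has no repetition and consists of cliques, so its length is at most the
  -- number of cliques that is assumed to stay below the cutoff.
  output-next : ∀ {t S cutoff} → Enumerates t S → ¬ (cutoff ≤ᴿ fromℕ (length (cl (suc t) G))) →
    output (next G cutoff S) ≡ just (reverse (allExtensions S))
  output-next {S = S} enum ≰ = output-outer S (allFin n) [] (≰-weaken
    (ℕ.≤-trans (ℕ.≤-reflexive (List.length-reverse (allExtensions S))) (enumerates-length (enumerates-suc enum))) ≰)

  output-grow : ∀ (cut : ℕ → ℝ) m t S → (∀ i → t < i → i ≤ t + m → ¬ (cut i ≤ᴿ fromℕ (length (cl i G)))) →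
    Enumerates t S → ∃[ S′ ] (output (grow G cut (suc t) m S) ≡ just S′ × Enumerates (t + m) S′)
  output-grow cut zero    t S few enum = S , refl , subst (λ i → Enumerates i S) (sym (ℕ.+-identityʳ t)) enum
  output-grow cut (suc m) t S few enum =
    let (S′ , out , enum′) = output-grow cut m (suc t) (reverse (allExtensions S))
          (λ i t<i i≤ → few i (ℕ.<⇒≤ t<i) (subst (i ≤_) (sym (ℕ.+-suc t m)) i≤)) (enumerates-reverse (enumerates-suc enum))
    in S′ , trans (output->>= (next G (cut (suc t)) S) (output-next enum (few (suc t) ℕ.≤-refl
              (subst (suc t ≤_) (sym (ℕ.+-suc t m)) (s≤s (ℕ.m≤m+n t m)))))) out
          , subst (λ i → Enumerates i S′) (sym (ℕ.+-suc t m)) enum′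

  output-initial : ∀ t → output (forEach (subsetsOfSize t n) []
      (λ A S → forEach (filter (Subset._∈? A) (allFin n)) (A ∷ S) λ _ → return)) ≡ just (reverse (subsetsOfSize t n))
  output-initial t = output-forEach (λ A S → trans (output-forEach {g = λ S _ → S} (λ _ _ → refl) (elements A) (A ∷ S)) (cong just (constant (elements A)))) (subsetsOfSize t n) []
    where
    constant : ∀ {A B : Set} (as : List A) {b : B} → foldl (λ b _ → b) b as ≡ b
    constant []       = refl
    constant (_ ∷ as) = constant as

  -- A set with fewer than `s` vertices contains no `s`-subset, so the clique condition is vacuous.
  enumerates-initial : ∀ {t} → t < s → Enumerates t (subsetsOfSize t n)
  enumerates-initial {t} t<s = record
    { unique   = subsetsOfSize-unique t n
    ; sound    = λ W∈ → ∈-subsetsOfSize⁻ W∈ , λ e∈ → ⊥-elim (no-edges (∈-subsetsOfSize⁻ W∈) e∈)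
    ; complete = λ (size , _) → ∈-subsetsOfSize⁺ size
    }
    where
    no-edges : ∀ {W e} → ∣ W ∣ ≡ t → ¬ (e ∈ binom W s)
    no-edges {W} refl e∈ = let (e∈′ , e⊆W) = ∈-filter⁻ (Subset._⊆? W) {xs = subsetsOfSize s n} e∈ in
      ℕ.<⇒≱ t<s (subst (_≤ ∣ W ∣) (∈-subsetsOfSize⁻ e∈′) (Subset.p⊆q⇒∣p∣≤∣q∣ e⊆W))

  outputsCliques-true : ∀ k (cut : ℕ → ℝ) → 1 ≤ s → s ≤ k →
    (∀ i → s ≤ i → i ≤ k → ¬ (cut i ≤ᴿ fromℕ (length (cl i G)))) → outputsCliques k cut G ≡ true
  outputsCliques-true k cut (s≤s {n = t} z≤n) s≤k few =
    let (S , out , enum) = output-grow cut (k ∸ t) t (reverse (subsetsOfSize t n))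
          (λ i t<i i≤ → few i t<i (subst (i ≤_) t+[k∸t]≡k i≤)) (enumerates-reverse (enumerates-initial ℕ.≤-refl))
        out′ : output (it-gen-cliques k cut G) ≡ just S
        out′ = trans (output->>= (initial n s) (output-initial t)) out
        enum′ = subst (λ i → Enumerates i S) t+[k∸t]≡k enum
    in trans (cong (maybe′ (λ S → does ((S ⊆? cl k G) ×-dec (cl k G ⊆? S))) false) out′)
             (dec-true ((S ⊆? cl k G) ×-dec (cl k G ⊆? S))
               ((λ W∈ → cl⁺ (Enumerates.sound enum′ W∈)) , λ W∈ → Enumerates.complete enum′ (cl⁻ W∈)))
    where
    t+[k∸t]≡k : t + (k ∸ t) ≡ k
    t+[k∸t]≡k = ℕ.m+[n∸m]≡n (ℕ.<⇒≤ s≤k)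

-- The absorption identity. It will compare `j C s`, which governs the expected number of
-- `j`-cliques, with `(j - 1) C (s - 1)`, in terms of which κ is defined.
[k+1]*[n+1]C[k+1]≡[n+1]*nCk : ∀ n k → suc k * (suc n C suc k) ≡ suc n * (n C k)
[k+1]*[n+1]C[k+1]≡[n+1]*nCk zero    zero    = refl
[k+1]*[n+1]C[k+1]≡[n+1]*nCk zero    (suc k) = ℕ.*-zeroʳ (suc (suc k))
[k+1]*[n+1]C[k+1]≡[n+1]*nCk (suc n) zero    = trans (ℕ.*-identityˡ _) (trans (nC1≡n (suc (suc n))) (sym (ℕ.*-identityʳ _)))
[k+1]*[n+1]C[k+1]≡[n+1]*nCk (suc n) (suc k) = begin
  suc (suc k) * (suc (suc n) C suc (suc k))    ≡⟨ cong (suc (suc k) *_) (sym (nCk+nC[k+1]≡[n+1]C[k+1] (suc n) (suc k))) ⟩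
  suc (suc k) * (x + y)                        ≡⟨ solve 3 (λ k x y → (con 1 :+ k) :* (x :+ y) := k :* x :+ x :+ (con 1 :+ k) :* y) refl (suc k) x y ⟩
  suc k * x + x + suc (suc k) * y              ≡⟨ cong₂ (λ u v → u + x + v) ([k+1]*[n+1]C[k+1]≡[n+1]*nCk n k) ([k+1]*[n+1]C[k+1]≡[n+1]*nCk n (suc k)) ⟩
  suc n * (n C k) + x + suc n * (n C suc k)    ≡⟨ solve 4 (λ n a x b → n :* a :+ x :+ n :* b := x :+ n :* (a :+ b)) refl (suc n) (n C k) x (n C suc k) ⟩
  x + suc n * (n C k + n C suc k)              ≡⟨ cong (λ z → x + suc n * z) (nCk+nC[k+1]≡[n+1]C[k+1] n k) ⟩
  suc (suc n) * x                              ∎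
  where
  open ≡-Reasoning
  open +-*-Solver
  x = suc n C suc k
  y = suc n C suc (suc k)

C-mono-≤ : ∀ {m n} k → m ≤ n → m C k ≤ n C k
C-mono-≤ {m} {n} k m≤n = subst (λ n → m C k ≤ n C k) (ℕ.m+[n∸m]≡n m≤n) (grows (n ∸ m))
  where
  C≤suc : ∀ n k → n C k ≤ suc n C k
  C≤suc n zero    = ℕ.≤-refl
  C≤suc n (suc k) = subst (n C suc k ≤_) (nCk+nC[k+1]≡[n+1]C[k+1] n k) (ℕ.m≤n+m _ _)
  grows : ∀ d → m C k ≤ (m + d) C k
  grows zero    = ℕ.≤-reflexive (cong (_C k) (sym (ℕ.+-identityʳ m)))
  grows (suc d) = ℕ.≤-trans (grows d) (subst (λ x → (m + d) C k ≤ x C k) (sym (ℕ.+-suc m d)) (C≤suc (m + d) k))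

-- The running time and its dominant exponent

module Runtime (R : Reals) where
  open OrderedField R
  open WithReals R
  open RealPowers R
  open FiniteSums R
  open ≤ᴿ-Reasoning

  steps-it-gen-cliques : ∀ {n t} (G : Hypergraph n (suc t)) k (cut : ℕ → ℝ) B → suc t ≤ k → (∀ i → 0ᴿ ≤ᴿ cut i) →
    1 ≤ n → fromℕ n *ᴿ fromℕ n ^ᴿ t ≤ᴿ B → (∀ i → t < i → i < k → fromℕ n *ᴿ cut i ≤ᴿ B) →
    fromℕ n ≤ᴿ B →
    fromℕ (steps (it-gen-cliques k cut G)) ≤ᴿ B *ᴿ fromℕ (suc t + k * levelCost k)
  steps-it-gen-cliques {n} {t} G k cut B t<k 0≤cut 1≤n initial≤B cut≤B n≤B = begin
    fromℕ (steps (it-gen-cliques k cut G))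
      ≤⟨ Algorithm.steps->>= R G (initial n (suc t)) safe-initial 0≤rest rest ⟩
    fromℕ (length Ws * suc t) +ᴿ fromℕ k *ᴿ (B *ᴿ fromℕ level)
      ≤⟨ +-mono _ initial-cost ⟩
    B *ᴿ fromℕ (suc t) +ᴿ fromℕ k *ᴿ (B *ᴿ fromℕ level)
      ≡⟨ solve 4 (λ B a k l → B :* a :+ k :* (B :* l) := B :* (a :+ k :* l)) refl B (fromℕ (suc t)) (fromℕ k) (fromℕ level) ⟩
    B *ᴿ (fromℕ (suc t) +ᴿ fromℕ k *ᴿ fromℕ level)
      ≡⟨ cong (B *ᴿ_) (trans (cong (fromℕ (suc t) +ᴿ_) (sym (fromℕ-* k level))) (sym (fromℕ-+ (suc t) (k * level)))) ⟩
    B *ᴿ fromℕ (suc t + k * level) ∎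
    where
    level : ℕ
    level = levelCost k
    Ws : List (Subset n)
    Ws = subsetsOfSize t n
    0≤rest : 0ᴿ ≤ᴿ fromℕ k *ᴿ (B *ᴿ fromℕ level)
    0≤rest = *-nonNegative (0≤fromℕ k) (*-nonNegative (≤ᴿ-trans (0≤fromℕ n) n≤B) (0≤fromℕ level))
    -- Each initial set costs `t` label steps and one loop step. The invariant identifies the output
    -- itself, since its length and the sizes of its sets are used below.
    safe-initial : Safe (length Ws * suc t) (_≡ reverse Ws) (initial n (suc t))
    safe-initial = proj₁ (safe-forEach {I = Trivial} Ws [] (λ {A} A∈ S _ →
        subst (λ l → Safe l Trivial (forEach (elements A) (A ∷ S) λ _ → return))
          (trans (ℕ.*-identityʳ _) (trans (length-elements A) (∈-subsetsOfSize⁻ A∈)))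
          (safe-forEach {I = Trivial} (elements A) (A ∷ S) (λ _ _ _ → safe-return tt) tt)) tt)
      , λ S out → just-injective (trans (sym out) (Correctness.output-initial R G t))
    initial-cost : fromℕ (length Ws * suc t) ≤ᴿ B *ᴿ fromℕ (suc t)
    initial-cost = begin
      fromℕ (length Ws * suc t)              ≡⟨ fromℕ-* (length Ws) (suc t) ⟩
      fromℕ (length Ws) *ᴿ fromℕ (suc t)     ≤⟨ *-monoʳ-≤ (0≤fromℕ (suc t)) (begin
        fromℕ (length Ws)           ≤⟨ fromℕ-mono-≤ (length-subsetsOfSize≤ t n) ⟩
        fromℕ (n ^ t)               ≡⟨ fromℕ-^ n t ⟩
        fromℕ n ^ᴿ t                ≤⟨ x≤x*y (0≤^ t (0≤fromℕ n)) (1≤fromℕ 1≤n) ⟩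
        fromℕ n ^ᴿ t *ᴿ fromℕ n     ≡⟨ *ᴿ-comm _ _ ⟩
        fromℕ n *ᴿ fromℕ n ^ᴿ t     ≤⟨ initial≤B ⟩
        B                           ∎) ⟩
      B *ᴿ fromℕ (suc t)                     ∎
    m≤k : k ∸ t ≤ k
    m≤k = ℕ.m∸n≤m k t
    t+m≡k : t + (k ∸ t) ≡ k
    t+m≡k = ℕ.m+[n∸m]≡n (ℕ.<⇒≤ t<k)
    rest : ∀ S → S ≡ reverse Ws → fromℕ (steps (grow G cut (suc t) (k ∸ t) S)) ≤ᴿ fromℕ k *ᴿ (B *ᴿ fromℕ level)
    rest S refl = ≤ᴿ-trans
      (Algorithm.steps-grow R G k cut B 0≤cut n≤B (k ∸ t) t S (ℕ.≤-reflexive t+m≡k)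
        (λ i t<i i<k → cut≤B i t<i (subst (i <_) t+m≡k i<k))
        (All.tabulate λ W∈ → ℕ.≤-reflexive (∈-subsetsOfSize⁻ (∈-resp-↭ (↭-reverse Ws) W∈)))
        (begin
          fromℕ n *ᴿ fromℕ (length (reverse Ws))  ≡⟨ cong (λ l → fromℕ n *ᴿ fromℕ l) (List.length-reverse Ws) ⟩
          fromℕ n *ᴿ fromℕ (length Ws)            ≤⟨ *-monoˡ-≤ (0≤fromℕ n) (fromℕ-mono-≤ (length-subsetsOfSize≤ t n)) ⟩
          fromℕ n *ᴿ fromℕ (n ^ t)                ≡⟨ cong (fromℕ n *ᴿ_) (fromℕ-^ n t) ⟩
          fromℕ n *ᴿ fromℕ n ^ᴿ t                 ≤⟨ initial≤B ⟩
          B                                       ∎))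
      (*-monoʳ-≤ (*-nonNegative (≤ᴿ-trans (0≤fromℕ n) n≤B) (0≤fromℕ level)) (fromℕ-mono-≤ m≤k))

  x∈xs⇒fx≤Σᴿ : ∀ {A : Set} {f : A → ℝ} {x xs} → (∀ x → 0ᴿ ≤ᴿ f x) → x ∈ᴸ xs → f x ≤ᴿ Σᴿ f xs
  x∈xs⇒fx≤Σᴿ {xs = _ ∷ xs} 0≤f (here refl) = x≤x+y (0≤Σᴿ xs 0≤f)
  x∈xs⇒fx≤Σᴿ {f = f} {xs = y ∷ xs} 0≤f (there x∈) = ≤ᴿ-trans (x∈xs⇒fx≤Σᴿ 0≤f x∈)
    (subst (_≤ᴿ f y +ᴿ Σᴿ f xs) (+ᴿ-identityˡ _) (+-mono _ (0≤f y)))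

  module _ {α : ℝ} (0<α : 0ᴿ <ᴿ α) (c : ℕ → ℝ) (0≤c≤1 : ∀ n → 0ᴿ ≤ᴿ c n × c n ≤ᴿ 1ᴿ)
           (c=Θ : c =Θ (λ n → fromℕ n ** (-ᴿ α))) where

    -- n ^ (i + 1 - α (i C s)) is the order of n C_i, the cost of generating S_{i+1}; it is largest at i = peak.
    runs-in-peak : ∀ t k peak → suc t ≤ k →
      (∀ i → t ≤ i → i < k → fromℕ (suc i) +ᴿ α *ᴿ fromℕ (peak C suc t) ≤ᴿ fromℕ (suc peak) +ᴿ α *ᴿ fromℕ (i C suc t)) →
      RunsInO (suc t) k (cutoffs (suc t) c) (λ n → fromℕ n ** (fromℕ (suc peak) -ᴿ α *ᴿ fromℕ (peak C suc t)))
    runs-in-peak t k peak t<k dominated = K *ᴿ fromℕ cost , N₀ ℕ.⊔ 1 , bound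
      where
      b = proj₁ (proj₂ c=Θ)
      N₀ = proj₁ (proj₂ (proj₂ c=Θ))
      0<b : 0ᴿ <ᴿ b
      0<b = proj₁ (proj₂ (proj₂ (proj₂ (proj₂ c=Θ))))
      E : ℝ
      E = fromℕ (suc peak) -ᴿ α *ᴿ fromℕ (peak C suc t)
      cost : ℕ
      cost = suc t + k * levelCost k
      -- The three factors come from the cutoff `C_i`, from the upper constant `b` of the Θ-bound,
      -- and from the loss in `**-upper`. The sum `K` dominates them all; its extra 1 covers the
      -- initial sets.
      coefficient : ℕ → ℝ
      coefficient i = fromℕ 2 *ᴿ b ^ᴿ (i C suc t) *ᴿ fromℕ 2 ^ᴿ (i C suc t)
      0≤coefficient : ∀ i → 0ᴿ ≤ᴿ coefficient i
      0≤coefficient i = *-nonNegative (*-nonNegative (0≤fromℕ 2) (0≤^ (i C suc t) (proj₁ 0<b))) (0≤^ (i C suc t) (0≤fromℕ 2))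
      K : ℝ
      K = 1ᴿ +ᴿ Σᴿ coefficient (upTo k)
      1≤K : 1ᴿ ≤ᴿ K
      1≤K = x≤x+y (0≤Σᴿ (upTo k) 0≤coefficient)
      coefficient≤K : ∀ i → i < k → coefficient i ≤ᴿ K
      coefficient≤K i i<k = ≤ᴿ-trans (x∈xs⇒fx≤Σᴿ 0≤coefficient (∈-upTo⁺ i<k))
        (subst (_≤ᴿ K) (+ᴿ-identityˡ _) (+-mono _ 0≤1))
      exponent : ∀ i → t ≤ i → i < k → fromℕ (suc i) ≤ᴿ E +ᴿ fromℕ (i C suc t) *ᴿ α
      exponent i t≤i i<k = +-cancelʳ-≤ (α *ᴿ fromℕ (peak C suc t)) (begin
        fromℕ (suc i) +ᴿ u                                      ≤⟨ dominated i t≤i i<k ⟩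
        fromℕ (suc peak) +ᴿ α *ᴿ fromℕ (i C suc t)              ≡⟨ cong₂ _+ᴿ_ (sym (x-y+y≡x (fromℕ (suc peak)) u)) (*ᴿ-comm _ _) ⟩
        E +ᴿ u +ᴿ fromℕ (i C suc t) *ᴿ α                        ≡⟨ solve 3 (λ a b c → a :+ b :+ c := a :+ c :+ b) refl E u (fromℕ (i C suc t) *ᴿ α) ⟩
        E +ᴿ fromℕ (i C suc t) *ᴿ α +ᴿ u                        ∎)
        where
        u : ℝ
        u = α *ᴿ fromℕ (peak C suc t)
      bound : ∀ n → N₀ ℕ.⊔ 1 ≤ n → (G : Hypergraph n (suc t)) →
        fromℕ (steps (it-gen-cliques k (cutoffs (suc t) c n) G)) ≤ᴿ K *ᴿ fromℕ cost *ᴿ fromℕ n ** E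
      bound n n≥ G = begin
        fromℕ (steps (it-gen-cliques k (cutoffs (suc t) c n) G))
          ≤⟨ steps-it-gen-cliques G k (cutoffs (suc t) c n) (K *ᴿ x ** E) t<k 0≤cut 1≤n initial≤ cut≤ n≤ ⟩
        K *ᴿ x ** E *ᴿ fromℕ cost
          ≡⟨ solve 3 (λ a b c → a :* b :* c := a :* c :* b) refl K (x ** E) (fromℕ cost) ⟩
        K *ᴿ fromℕ cost *ᴿ x ** E ∎
        where
        x z : ℝ
        x = fromℕ n
        z = x ** (-ᴿ α)
        1≤n : 1 ≤ n
        1≤n = ℕ.≤-trans (ℕ.m≤n⊔m N₀ 1) n≥
        1≤x : 1ᴿ ≤ᴿ x
        1≤x = 1≤fromℕ 1≤n
        c≤ : c n ≤ᴿ b *ᴿ z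
        c≤ = proj₂ (proj₂ (proj₂ (proj₂ (proj₂ (proj₂ c=Θ)))) n (ℕ.≤-trans (ℕ.m≤m⊔n N₀ 1) n≥))
        0≤cut : ∀ i → 0ᴿ ≤ᴿ cutoffs (suc t) c n i
        0≤cut i = *-nonNegative (*-nonNegative (0≤fromℕ 2) (0≤^ i (0≤fromℕ n))) (0≤^ (i C suc t) (proj₁ (0≤c≤1 n)))
        -- The initial sets are the case `i = t` of the domination hypothesis, in which
        -- `t C suc t = 0` and no factor of `c` appears.
        initial≤E : x *ᴿ x ^ᴿ t ≤ᴿ x ** E
        initial≤E = begin
          x ^ᴿ suc t                     ≡⟨ sym (*ᴿ-identityʳ _) ⟩
          x ^ᴿ suc t *ᴿ z ^ᴿ 0           ≤⟨ **-upper 1≤x (suc t) 0 (proj₁ 0<α)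
                                             (subst (λ m → fromℕ (suc t) ≤ᴿ E +ᴿ fromℕ m *ᴿ α) (k>n⇒nCk≡0 (ℕ.n<1+n t)) (exponent t ℕ.≤-refl t<k)) ⟩
          fromℕ 2 ^ᴿ 0 *ᴿ x ** E         ≡⟨ *ᴿ-identityˡ _ ⟩
          x ** E                         ∎
        0≤x**E : 0ᴿ ≤ᴿ x ** E
        0≤x**E = ≤ᴿ-trans (0≤^ (suc t) (0≤fromℕ n)) initial≤E
        initial≤ : x *ᴿ x ^ᴿ t ≤ᴿ K *ᴿ x ** E
        initial≤ = ≤ᴿ-trans initial≤E (subst (x ** E ≤ᴿ_) (*ᴿ-comm _ _) (x≤x*y 0≤x**E 1≤K))
        n≤ : x ≤ᴿ K *ᴿ x ** E
        n≤ = ≤ᴿ-trans (x≤x*y (0≤fromℕ n) (1≤^ t 1≤x)) initial≤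
        cut≤ : ∀ i → t < i → i < k → x *ᴿ cutoffs (suc t) c n i ≤ᴿ K *ᴿ x ** E
        cut≤ i t<i i<k = begin
          x *ᴿ (fromℕ 2 *ᴿ x ^ᴿ i *ᴿ c n ^ᴿ m)
            ≤⟨ *-monoˡ-≤ (0≤fromℕ n) (*-monoˡ-≤ (*-nonNegative (0≤fromℕ 2) (0≤^ i (0≤fromℕ n)))
                 (^-monoˡ-≤ m (proj₁ (0≤c≤1 n)) c≤)) ⟩
          x *ᴿ (fromℕ 2 *ᴿ x ^ᴿ i *ᴿ (b *ᴿ z) ^ᴿ m)
            ≡⟨ cong (λ w → x *ᴿ (fromℕ 2 *ᴿ x ^ᴿ i *ᴿ w)) (^-distrib-* b z m) ⟩
          x *ᴿ (fromℕ 2 *ᴿ x ^ᴿ i *ᴿ (b ^ᴿ m *ᴿ z ^ᴿ m))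
            ≡⟨ solve 5 (λ x w y b z → x :* (w :* y :* (b :* z)) := w :* b :* (x :* y :* z)) refl x (fromℕ 2) (x ^ᴿ i) (b ^ᴿ m) (z ^ᴿ m) ⟩
          fromℕ 2 *ᴿ b ^ᴿ m *ᴿ (x ^ᴿ suc i *ᴿ z ^ᴿ m)
            ≤⟨ *-monoˡ-≤ (*-nonNegative (0≤fromℕ 2) (0≤^ m (proj₁ 0<b)))
                 (**-upper 1≤x (suc i) m (proj₁ 0<α) (exponent i (ℕ.<⇒≤ t<i) i<k)) ⟩
          fromℕ 2 *ᴿ b ^ᴿ m *ᴿ (fromℕ 2 ^ᴿ m *ᴿ x ** E)
            ≡⟨ sym (*ᴿ-assoc _ _ _) ⟩
          coefficient i *ᴿ x ** E
            ≤⟨ *-monoʳ-≤ 0≤x**E (coefficient≤K i i<k) ⟩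
          K *ᴿ x ** E ∎
          where
          m : ℕ
          m = i C suc t

  module _ {α : ℝ} (0≤α : 0ᴿ ≤ᴿ α) (t τ : ℕ) (τ-largest : IsLargest (λ m → α *ᴿ fromℕ (m C t) <ᴿ 1ᴿ) τ) where

    private
      -- By Pascal's rule, passing from `i` to `i + 1` changes the exponent `i + 1 - α (i C s)` by
      -- `1 - Increment i`, so the sign of that change is decided by τ.
      Increment : ℕ → ℝ
      Increment i = α *ᴿ fromℕ (i C t)

      pascal : ∀ i → α *ᴿ fromℕ (suc i C suc t) ≡ Increment i +ᴿ α *ᴿ fromℕ (i C suc t)
      pascal i = trans (cong (λ m → α *ᴿ fromℕ m) (sym (nCk+nC[k+1]≡[n+1]C[k+1] i t)))
        (trans (cong (α *ᴿ_) (fromℕ-+ (i C t) (i C suc t))) (*ᴿ-distribˡ α _ _))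

      Increment≤1 : ∀ {i} → i ≤ τ → Increment i ≤ᴿ 1ᴿ
      Increment≤1 i≤τ = ≤ᴿ-trans (*-monoˡ-≤ 0≤α (fromℕ-mono-≤ (C-mono-≤ t i≤τ))) (proj₁ (proj₁ τ-largest))

      1≤Increment : ∀ {i} → τ < i → 1ᴿ ≤ᴿ Increment i
      1≤Increment {i} τ<i with 1ᴿ ≤ᴿ? Increment i
      ... | yes le = le
      ... | no ≰   = ⊥-elim (ℕ.<⇒≱ τ<i (proj₂ τ-largest i (≰⇒> ≰)))

    -- Every increment from an index up to `τ` is at most 1, so the exponent still rises on the step
    -- from `τ` to `τ + 1`. Subtracted terms are moved across the inequality.
    rising : ∀ i d → i + d ≤ suc τ →
      fromℕ (suc i) +ᴿ α *ᴿ fromℕ ((i + d) C suc t) ≤ᴿ fromℕ (suc (i + d)) +ᴿ α *ᴿ fromℕ (i C suc t)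
    rising i zero    _     rewrite ℕ.+-identityʳ i = ≤ᴿ-refl
    rising i (suc d) i+d≤τ rewrite ℕ.+-suc i d = begin
      fromℕ (suc i) +ᴿ α *ᴿ fromℕ (suc (i + d) C suc t)
        ≡⟨ cong (fromℕ (suc i) +ᴿ_) (pascal (i + d)) ⟩
      fromℕ (suc i) +ᴿ (Increment (i + d) +ᴿ α *ᴿ fromℕ ((i + d) C suc t))
        ≡⟨ solve 3 (λ a b c → a :+ (b :+ c) := b :+ (a :+ c)) refl (fromℕ (suc i)) (Increment (i + d)) (α *ᴿ fromℕ ((i + d) C suc t)) ⟩
      Increment (i + d) +ᴿ (fromℕ (suc i) +ᴿ α *ᴿ fromℕ ((i + d) C suc t))
        ≤⟨ +-mono₂ (Increment≤1 (ℕ.s≤s⁻¹ i+d≤τ)) (rising i d (ℕ.<⇒≤ i+d≤τ)) ⟩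
      1ᴿ +ᴿ (fromℕ (suc (i + d)) +ᴿ α *ᴿ fromℕ (i C suc t))
        ≡⟨ sym (+ᴿ-assoc _ _ _) ⟩
      fromℕ (suc (suc (i + d))) +ᴿ α *ᴿ fromℕ (i C suc t) ∎

    -- Maximality of `τ` makes every later increment at least 1.
    falling : ∀ d → let i = suc τ + d in
      fromℕ (suc i) +ᴿ α *ᴿ fromℕ (suc τ C suc t) ≤ᴿ fromℕ (suc (suc τ)) +ᴿ α *ᴿ fromℕ (i C suc t)
    falling zero    rewrite ℕ.+-identityʳ τ = ≤ᴿ-refl
    falling (suc d) rewrite ℕ.+-suc τ d = begin
      1ᴿ +ᴿ fromℕ (suc i) +ᴿ α *ᴿ fromℕ (suc τ C suc t)
        ≡⟨ +ᴿ-assoc _ _ _ ⟩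
      1ᴿ +ᴿ (fromℕ (suc i) +ᴿ α *ᴿ fromℕ (suc τ C suc t))
        ≤⟨ +-mono₂ (1≤Increment (s≤s (ℕ.m≤m+n τ d))) (falling d) ⟩
      Increment i +ᴿ (fromℕ (suc (suc τ)) +ᴿ α *ᴿ fromℕ (i C suc t))
        ≡⟨ solve 3 (λ a b c → b :+ (a :+ c) := a :+ (b :+ c)) refl (fromℕ (suc (suc τ))) (Increment i) (α *ᴿ fromℕ (i C suc t)) ⟩
      fromℕ (suc (suc τ)) +ᴿ (Increment i +ᴿ α *ᴿ fromℕ (i C suc t))
        ≡⟨ cong (fromℕ (suc (suc τ)) +ᴿ_) (sym (pascal i)) ⟩
      fromℕ (suc (suc τ)) +ᴿ α *ᴿ fromℕ (suc i C suc t) ∎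
      where
      i : ℕ
      i = suc (τ + d)

    dominated-before : ∀ {i peak} → i ≤ peak → peak ≤ suc τ →
      fromℕ (suc i) +ᴿ α *ᴿ fromℕ (peak C suc t) ≤ᴿ fromℕ (suc peak) +ᴿ α *ᴿ fromℕ (i C suc t)
    dominated-before {i} {peak} i≤peak peak≤ =
      subst (λ p → p ≤ suc τ → fromℕ (suc i) +ᴿ α *ᴿ fromℕ (p C suc t) ≤ᴿ fromℕ (suc p) +ᴿ α *ᴿ fromℕ (i C suc t))
        (ℕ.m+[n∸m]≡n i≤peak) (rising i (peak ∸ i)) peak≤

    dominated-after : ∀ {i} → suc τ ≤ i →
      fromℕ (suc i) +ᴿ α *ᴿ fromℕ (suc τ C suc t) ≤ᴿ fromℕ (suc (suc τ)) +ᴿ α *ᴿ fromℕ (i C suc t)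
    dominated-after {i} τ<i =
      subst (λ i → fromℕ (suc i) +ᴿ α *ᴿ fromℕ (suc τ C suc t) ≤ᴿ fromℕ (suc (suc τ)) +ᴿ α *ᴿ fromℕ (i C suc t))
        (ℕ.m+[n∸m]≡n τ<i) (falling (i ∸ suc τ))

-- Concentration

-- Bernoulli's inequality (1 - 1/(h+1)) ^ t ≥ 1 - t/(h+1), cleared of denominators.
bernoulli : ∀ h t → suc h * suc h ^ t ≤ suc h * h ^ t + t * suc h ^ t
bernoulli h zero    = ℕ.≤-reflexive (sym (ℕ.+-identityʳ _))
bernoulli h (suc t) = begin
  N * (N * N ^ t)                          ≤⟨ ℕ.*-monoʳ-≤ N (bernoulli h t) ⟩
  N * (N * h ^ t + t * N ^ t)              ≡⟨ solve 4 (λ h x t y → (con 1 :+ h) :* ((con 1 :+ h) :* x :+ t :* y)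
                                                    := (con 1 :+ h) :* (h :* x) :+ ((con 1 :+ h) :* x :+ t :* ((con 1 :+ h) :* y))) refl h (h ^ t) t (N ^ t) ⟩
  N * h ^ suc t + (N * h ^ t + t * N ^ suc t)
    ≤⟨ ℕ.+-monoʳ-≤ (N * h ^ suc t) (ℕ.+-monoˡ-≤ (t * N ^ suc t) (ℕ.*-monoʳ-≤ N (ℕ.^-monoˡ-≤ t (ℕ.n≤1+n h)))) ⟩
  N * h ^ suc t + suc t * N ^ suc t        ∎
  where
  open ℕ.≤-Reasoning
  open +-*-Solver
  N = suc h

-- Bernoulli's inequality gives `(h / (h + 1)) ^ t ≥ 1 - t / (h + 1) ≥ 2/3`.
2[1+h]^t≤3h^t : ∀ h t → 3 * t ≤ suc h → 2 * suc h ^ t ≤ 3 * h ^ t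
2[1+h]^t≤3h^t h t 3t≤N = ℕ.*-cancelˡ-≤ N (ℕ.+-cancelʳ-≤ (N * N ^ t) _ _ (begin
  N * (2 * N ^ t) + N * N ^ t          ≡⟨ solve 2 (λ N x → N :* (con 2 :* x) :+ N :* x := con 3 :* (N :* x)) refl N (N ^ t) ⟩
  3 * (N * N ^ t)                      ≤⟨ ℕ.*-monoʳ-≤ 3 (bernoulli h t) ⟩
  3 * (N * h ^ t + t * N ^ t)          ≡⟨ solve 4 (λ N x t y → con 3 :* (N :* x :+ t :* y) := N :* (con 3 :* x) :+ con 3 :* t :* y) refl N (h ^ t) t (N ^ t) ⟩
  N * (3 * h ^ t) + 3 * t * N ^ t      ≤⟨ ℕ.+-monoʳ-≤ (N * (3 * h ^ t)) (ℕ.*-monoˡ-≤ (N ^ t) 3t≤N) ⟩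
  N * (3 * h ^ t) + N * N ^ t          ∎))
  where
  open ℕ.≤-Reasoning
  open +-*-Solver
  N = suc h

Eventually : (ℕ → Set) → Set
Eventually P = ∃[ N ] (∀ n → N ≤ n → P n)

eventually-× : ∀ {P Q : ℕ → Set} → Eventually P → Eventually Q → Eventually (λ n → P n × Q n)
eventually-× (M , p) (N , q) = M ℕ.⊔ N , λ n le → p n (ℕ.≤-trans (ℕ.m≤m⊔n M N) le) , q n (ℕ.≤-trans (ℕ.m≤n⊔m M N) le)

eventually-∀≤ : ∀ {P : ℕ → ℕ → Set} k → (∀ j → j ≤ k → Eventually (P j)) → Eventually (λ n → ∀ j → j ≤ k → P j n)
eventually-∀≤ zero    ev = let (N , p) = ev 0 z≤n in N , λ { n le _ z≤n → p n le }
eventually-∀≤ {P} (suc k) ev with eventually-∀≤ k (λ j j≤k → ev j (ℕ.m≤n⇒m≤1+n j≤k)) | ev (suc k) ℕ.≤-refl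
... | ev₁ | ev₂ = let (N , p) = eventually-× ev₁ ev₂ in N , λ n le j j≤ → split n j j≤ (p n le)
  where
  split : ∀ n j → j ≤ suc k → (∀ j → j ≤ k → P j n) × P (suc k) n → P j n
  split n j j≤ (all , last) with ℕ.m≤n⇒m<n∨m≡n j≤
  ... | inj₁ (s≤s j≤k) = all j j≤k
  ... | inj₂ refl      = last

-- With `E = D + 1` and `q = l / E`, the bound `l + 1 ≤ E * 2 ^ q` yields
-- `(l + 1) ^ E ≤ E ^ E * 2 ^ l`. The degree `E` exceeds `D` by one, and that spare factor `l + 1`
-- absorbs all constants.
polynomial≤exponential : ∀ M D → Eventually (λ l → M * suc (suc l) ^ D ≤ 2 ^ l)
polynomial≤exponential M D = M * 2 ^ D * E ^ E , bound
  where
  E = suc D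
  bound : ∀ l → M * 2 ^ D * E ^ E ≤ l → M * suc (suc l) ^ D ≤ 2 ^ l
  bound l l≥ = ℕ.*-cancelˡ-≤ (E ^ E) {{ℕ.m^n≢0 E E}} (begin
    E ^ E * (M * suc (suc l) ^ D)         ≤⟨ ℕ.*-monoʳ-≤ (E ^ E) (ℕ.*-monoʳ-≤ M (ℕ.^-monoˡ-≤ D 2+l≤)) ⟩
    E ^ E * (M * (2 * suc l) ^ D)         ≡⟨ cong (λ x → E ^ E * (M * x)) (*-^-distrib 2 (suc l) D) ⟩
    E ^ E * (M * (2 ^ D * suc l ^ D))     ≡⟨ solve 4 (λ e m d l → e :* (m :* (d :* l)) := m :* d :* e :* l) refl (E ^ E) M (2 ^ D) (suc l ^ D) ⟩
    M * 2 ^ D * E ^ E * suc l ^ D         ≤⟨ ℕ.*-monoˡ-≤ (suc l ^ D) (ℕ.m≤n⇒m≤1+n l≥) ⟩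
    suc l ^ E                             ≤⟨ ℕ.^-monoˡ-≤ E 1+l≤ ⟩
    (E * 2 ^ q) ^ E                       ≡⟨ *-^-distrib E (2 ^ q) E ⟩
    E ^ E * (2 ^ q) ^ E                   ≡⟨ cong (E ^ E *_) (ℕ.^-*-assoc 2 q E) ⟩
    E ^ E * 2 ^ (q * E)                   ≤⟨ ℕ.*-monoʳ-≤ (E ^ E) (ℕ.^-monoʳ-≤ 2 qE≤l) ⟩
    E ^ E * 2 ^ l                         ∎)
    where
    open ℕ.≤-Reasoning
    open +-*-Solver
    q = l / E
    qE≤l : q * E ≤ l
    qE≤l = ℕ.≤-trans (ℕ.m≤n+m (q * E) (l % E)) (ℕ.≤-reflexive (sym (m≡m%n+[m/n]*n l E)))
    1+l≤ : suc l ≤ E * 2 ^ q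
    1+l≤ = begin
      suc l                  ≡⟨ cong suc (m≡m%n+[m/n]*n l E) ⟩
      suc (l % E) + q * E    ≤⟨ ℕ.+-monoˡ-≤ (q * E) (m%n<n l E) ⟩
      E + q * E              ≡⟨ ℕ.*-comm (suc q) E ⟩
      E * suc q              ≤⟨ ℕ.*-monoʳ-≤ E (n<2^n q) ⟩
      E * 2 ^ q              ∎
    2+l≤ : suc (suc l) ≤ 2 * suc l
    2+l≤ = s≤s (ℕ.≤-trans (ℕ.m≤n+m (suc l) l) (ℕ.≤-reflexive (cong (l +_) (sym (ℕ.+-identityʳ (suc l))))))

binaryMagnitude : ∀ n → ∃[ l ] (2 ^ l ≤ suc n × suc n < 2 ^ suc l)
binaryMagnitude zero = 0 , s≤s z≤n , s≤s (s≤s z≤n)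
binaryMagnitude (suc n) with binaryMagnitude n
... | l , lower , upper with ℕ.m≤n⇒m<n∨m≡n upper
...   | inj₁ lt = l , ℕ.m≤n⇒m≤1+n lower , lt
...   | inj₂ eq = suc l , ℕ.≤-reflexive (sym eq) ,
  subst (_< 2 ^ suc (suc l)) (sym eq) (ℕ.^-monoʳ-< 2 (s≤s (s≤s z≤n)) (ℕ.n<1+n (suc l)))

-- The number of binary digits of a positive `n`; the predecessor undoes the shift in
-- `binaryMagnitude`, and 0 receives the default value 1.
bits : ℕ → ℕ
bits n = suc (proj₁ (binaryMagnitude (ℕ.pred n)))

n≤2^bits : ∀ n → n ≤ 2 ^ bits n
n≤2^bits zero    = z≤n
n≤2^bits (suc n) = ℕ.<⇒≤ (proj₂ (proj₂ (binaryMagnitude n)))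

polylogarithmic≤ : ∀ M D → Eventually (λ n → M * suc (bits n) ^ D ≤ n)
polylogarithmic≤ M D = let (l₀ , exp) = polynomial≤exponential M D in 2 ^ suc l₀ , bound l₀ exp
  where
  bound : ∀ l₀ → (∀ l → l₀ ≤ l → M * suc (suc l) ^ D ≤ 2 ^ l) → ∀ n → 2 ^ suc l₀ ≤ n → M * suc (bits n) ^ D ≤ n
  bound l₀ exp zero    n≥ with () ← ℕ.≤-trans (ℕ.m^n>0 2 (suc l₀)) n≥
  bound l₀ exp (suc n) n≥ with binaryMagnitude n
  ... | l , lower , upper = ℕ.≤-trans (exp l (ℕ.≮⇒≥ λ l<l₀ → ℕ.<⇒≱ upper
          (ℕ.≤-trans (ℕ.^-monoʳ-≤ 2 (ℕ.m≤n⇒m≤1+n l<l₀)) n≥))) lower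

-- Brings the product `v h` of the moment bound, with `L = bits n`, into the form of a constant
-- times `suc (bits n)` required by `polylog≤`.
linear-in-log : ∀ D L k h → suc (3 * (D * L) * k) * h ≤ suc (3 * D * k) * h * suc L
linear-in-log D L k h = begin
  suc (3 * (D * L) * k) * h              ≤⟨ ℕ.*-monoˡ-≤ h (ℕ.+-mono-≤ (s≤s (z≤n {L})) ℕ.≤-refl) ⟩
  (suc L + 3 * (D * L) * k) * h          ≤⟨ ℕ.*-monoˡ-≤ h (ℕ.+-monoʳ-≤ (suc L) (ℕ.*-monoˡ-≤ k (ℕ.*-monoʳ-≤ 3 (ℕ.*-monoʳ-≤ D (ℕ.n≤1+n L))))) ⟩
  (suc L + 3 * (D * suc L) * k) * h      ≡⟨ solve 4 (λ l d k h → (l :+ con 3 :* (d :* l) :* k) :* h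
                                              := (con 1 :+ con 3 :* d :* k) :* h :* l) refl (suc L) D k h ⟩
  suc (3 * D * k) * h * suc L            ∎
  where
  open ℕ.≤-Reasoning
  open +-*-Solver

module Concentration (R : Reals) where
  open OrderedField R
  open WithReals R
  open RealPowers R
  open FiniteSums R
  open Expectation R
  open ≤ᴿ-Reasoning

  Σᴿ≤length : ∀ {A : Set} {f : A → ℝ} xs → (∀ {x} → x ∈ᴸ xs → f x ≤ᴿ 1ᴿ) → Σᴿ f xs ≤ᴿ fromℕ (length xs)
  Σᴿ≤length []       f≤1 = ≤ᴿ-refl
  Σᴿ≤length (x ∷ xs) f≤1 = +-mono₂ (f≤1 (here refl)) (Σᴿ≤length xs (f≤1 ∘ there))

  -- With `gap = j - α b`, take `Q` larger than `b / gap` and `P` the ceiling of `α Q`. Rounding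
  -- costs at most `b` in `b P ≤ α b Q + b`, which is less than `gap * Q`.
  rational-above : ∀ {α} b j → 0ᴿ ≤ᴿ α → α *ᴿ fromℕ b <ᴿ fromℕ j →
    ∃[ P ] ∃[ q ] (α *ᴿ fromℕ (suc q) ≤ᴿ fromℕ P × b * P < j * suc q)
  rational-above {α} b j 0≤α αb<j = P , q , αQ≤P , ℕ.≰⇒> λ jQ≤bP → <⇒≰ 0<gap (+-cancelʳ-≤ (fromℕ q *ᴿ gap) (begin
      gap +ᴿ fromℕ q *ᴿ gap                          ≡⟨ solve 2 (λ g q → g :+ q :* g := (con 1 :+ q) :* g) refl gap (fromℕ q) ⟩
      fromℕ Q *ᴿ gap                                 ≤⟨ Qgap≤b jQ≤bP ⟩
      fromℕ b                                        ≤⟨ b≤qgap ⟩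
      fromℕ q *ᴿ gap                                 ≡⟨ sym (+ᴿ-identityˡ _) ⟩
      0ᴿ +ᴿ fromℕ q *ᴿ gap                           ∎))
    where
    gap : ℝ
    gap = fromℕ j -ᴿ α *ᴿ fromℕ b
    gap+αb : gap +ᴿ α *ᴿ fromℕ b ≡ fromℕ j
    gap+αb = x-y+y≡x (fromℕ j) (α *ᴿ fromℕ b)
    0<gap : 0ᴿ <ᴿ gap
    0<gap = ≰⇒> λ gap≤0 → <⇒≰ αb<j (subst₂ _≤ᴿ_ gap+αb (+ᴿ-identityˡ _) (+-mono (α *ᴿ fromℕ b) gap≤0))
    q : ℕ
    q = proj₁ (archimedean (fromℕ b *ᴿ gap ⁻¹))
    Q : ℕ
    Q = suc q
    b≤qgap : fromℕ b ≤ᴿ fromℕ q *ᴿ gap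
    b≤qgap = begin
      fromℕ b                       ≡⟨ sym (trans (*ᴿ-assoc _ _ _) (trans (cong (fromℕ b *ᴿ_) (⁻¹-inverseˡ 0<gap)) (*ᴿ-identityʳ _))) ⟩
      fromℕ b *ᴿ gap ⁻¹ *ᴿ gap      ≤⟨ *-monoʳ-≤ (proj₁ 0<gap) (proj₂ (archimedean (fromℕ b *ᴿ gap ⁻¹))) ⟩
      fromℕ q *ᴿ gap                ∎
    ceil = ceiling (*-nonNegative 0≤α (0≤fromℕ Q))
    P : ℕ
    P = proj₁ ceil
    αQ≤P : α *ᴿ fromℕ Q ≤ᴿ fromℕ P
    αQ≤P = proj₁ (proj₂ ceil)
    Qgap≤b : j * Q ≤ b * P → fromℕ Q *ᴿ gap ≤ᴿ fromℕ b
    Qgap≤b jQ≤bP = +-cancelʳ-≤ (fromℕ Q *ᴿ (α *ᴿ fromℕ b)) (begin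
      fromℕ Q *ᴿ gap +ᴿ fromℕ Q *ᴿ (α *ᴿ fromℕ b)      ≡⟨ sym (*ᴿ-distribˡ (fromℕ Q) gap _) ⟩
      fromℕ Q *ᴿ (gap +ᴿ α *ᴿ fromℕ b)                 ≡⟨ cong (fromℕ Q *ᴿ_) gap+αb ⟩
      fromℕ Q *ᴿ fromℕ j                               ≡⟨ trans (*ᴿ-comm _ _) (sym (fromℕ-* j Q)) ⟩
      fromℕ (j * Q)                                    ≤⟨ fromℕ-mono-≤ jQ≤bP ⟩
      fromℕ (b * P)                                    ≡⟨ fromℕ-* b P ⟩
      fromℕ b *ᴿ fromℕ P                               ≤⟨ *-monoˡ-≤ (0≤fromℕ b) (proj₂ (proj₂ ceil)) ⟩
      fromℕ b *ᴿ (α *ᴿ fromℕ Q +ᴿ 1ᴿ)                  ≡⟨ solve 3 (λ b a q → b :* (a :* q :+ con 1) := b :+ q :* (a :* b)) refl (fromℕ b) α (fromℕ Q) ⟩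
      fromℕ b +ᴿ fromℕ Q *ᴿ (α *ᴿ fromℕ b)             ∎)

  module _ {α : ℝ} (0<α : 0ᴿ <ᴿ α) (c : ℕ → ℝ) (0≤c≤1 : ∀ n → 0ᴿ ≤ᴿ c n × c n ≤ᴿ 1ᴿ)
           (c=Θ : c =Θ (λ n → fromℕ n ** (-ᴿ α))) where

    private
      a : ℝ
      a = proj₁ c=Θ
      N₀ : ℕ
      N₀ = proj₁ (proj₂ (proj₂ c=Θ))
      0<a : 0ᴿ <ᴿ a
      0<a = proj₁ (proj₂ (proj₂ (proj₂ c=Θ)))

    c-lower : ∀ n → N₀ ≤ n → a *ᴿ fromℕ n ** (-ᴿ α) ≤ᴿ c n
    c-lower n n≥ = proj₁ (proj₂ (proj₂ (proj₂ (proj₂ (proj₂ c=Θ)))) n n≥)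

    0<c : ∀ n → N₀ ≤ n → 1 ≤ n → 0ᴿ <ᴿ c n
    0<c n n≥ 1≤n = <-≤-trans (0<x*y 0<a (0<** (1≤fromℕ 1≤n) α (proj₁ 0<α))) (c-lower n n≥)

    -- n ^ j c ^ b has order n ^ (j - α b), which beats every power of log n; comparing
    -- Q-th powers for a suitable P / Q ≥ α makes all exponents natural numbers.
    polylog≤ : ∀ w j b → α *ᴿ fromℕ b <ᴿ fromℕ j →
      Eventually (λ n → fromℕ (w * suc (bits n)) ^ᴿ j ≤ᴿ fromℕ n ^ᴿ j *ᴿ c n ^ᴿ b)
    polylog≤ w j b αb<j = N₀ ℕ.⊔ (proj₁ grows ℕ.⊔ 1) , bound
      where
      ratio = rational-above b j (proj₁ 0<α) αb<j
      P q Q : ℕ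
      P = proj₁ ratio
      q = proj₁ (proj₂ ratio)
      Q = suc q
      αQ≤P : α *ᴿ fromℕ Q ≤ᴿ fromℕ P
      αQ≤P = proj₁ (proj₂ (proj₂ ratio))
      bP<jQ : b * P < j * Q
      bP<jQ = proj₂ (proj₂ (proj₂ ratio))
      A : ℕ
      A = proj₁ (archimedean ((a ^ᴿ (b * Q)) ⁻¹))
      1≤Aa : 1ᴿ ≤ᴿ fromℕ A *ᴿ a ^ᴿ (b * Q)
      1≤Aa = begin
        1ᴿ                                      ≡⟨ sym (⁻¹-inverseˡ (0<^ (b * Q) 0<a)) ⟩
        (a ^ᴿ (b * Q)) ⁻¹ *ᴿ a ^ᴿ (b * Q)       ≤⟨ *-monoʳ-≤ (0≤^ (b * Q) (proj₁ 0<a)) (proj₂ (archimedean ((a ^ᴿ (b * Q)) ⁻¹))) ⟩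
        fromℕ A *ᴿ a ^ᴿ (b * Q)                 ∎
      -- `A` outweighs the constant `a` of the Θ-bound, the power of 2 pays for the loss in
      -- `**-lower`, and the last factor accounts for `w`.
      M : ℕ
      M = A * 2 ^ (b * Q) * w ^ (j * Q)
      grows : Eventually (λ n → M * suc (bits n) ^ (j * Q) ≤ n)
      grows = polylogarithmic≤ M (j * Q)
      bound : ∀ n → N₀ ℕ.⊔ (proj₁ grows ℕ.⊔ 1) ≤ n → fromℕ (w * suc (bits n)) ^ᴿ j ≤ᴿ fromℕ n ^ᴿ j *ᴿ c n ^ᴿ b
      bound n n≥ = ^-cancelˡ-≤ q (0≤^ j (0≤fromℕ (w * B))) (*-nonNegative (0≤^ j (0≤fromℕ n)) (0≤^ b 0≤c))
        (subst₂ _≤ᴿ_ (sym (^-assocʳ (fromℕ (w * B)) j Q))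
                     (trans (cong₂ _*ᴿ_ (sym (^-assocʳ x j Q)) (sym (^-assocʳ (c n) b Q))) (sym (^-distrib-* (x ^ᴿ j) (c n ^ᴿ b) Q)))
          (*-cancelʳ-≤ (fromℕ 2 ^ᴿ (b * Q)) (0<^ (b * Q) 0<2) chain))
        where
        B : ℕ
        B = suc (bits n)
        x z : ℝ
        x = fromℕ n
        z = x ** (-ᴿ α)
        1≤n : 1 ≤ n
        1≤n = ℕ.≤-trans (ℕ.m≤n⊔m (proj₁ grows) 1) (ℕ.≤-trans (ℕ.m≤n⊔m N₀ _) n≥)
        1≤x : 1ᴿ ≤ᴿ x
        1≤x = 1≤fromℕ 1≤n
        0≤c : 0ᴿ ≤ᴿ c n
        0≤c = proj₁ (0≤c≤1 n)
        MB≤n : M * B ^ (j * Q) ≤ n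
        MB≤n = proj₂ grows n (ℕ.≤-trans (ℕ.m≤m⊔n _ 1) (ℕ.≤-trans (ℕ.m≤n⊔m N₀ _) n≥))
        0≤z : 0ᴿ ≤ᴿ z
        0≤z = proj₁ (0<** 1≤x α (proj₁ 0<α))
        X T : ℝ
        X = fromℕ (w * B) ^ᴿ (j * Q)
        T = fromℕ 2 ^ᴿ (b * Q)
        a^ : ℝ
        a^ = a ^ᴿ (b * Q)
        XTA≡ : X *ᴿ T *ᴿ fromℕ A ≡ fromℕ (M * B ^ (j * Q))
        XTA≡ = trans (cong₂ (λ u v → u *ᴿ v *ᴿ fromℕ A) (sym (fromℕ-^ (w * B) (j * Q))) (sym (fromℕ-^ 2 (b * Q))))
          (trans (cong (_*ᴿ fromℕ A) (sym (fromℕ-* ((w * B) ^ (j * Q)) (2 ^ (b * Q)))))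
          (trans (sym (fromℕ-* ((w * B) ^ (j * Q) * 2 ^ (b * Q)) A)) (cong fromℕ nat)))
          where
          nat : (w * B) ^ (j * Q) * 2 ^ (b * Q) * A ≡ M * B ^ (j * Q)
          nat = trans (cong (λ u → u * 2 ^ (b * Q) * A) (*-^-distrib w B (j * Q)))
            (S.solve 4 (λ u v y A → u S.:* v S.:* y S.:* A S.:= A S.:* y S.:* u S.:* v) refl (w ^ (j * Q)) (B ^ (j * Q)) (2 ^ (b * Q)) A)
            where module S = +-*-Solver
        -- Since `b * P + 1 ≤ j * Q`, one factor `x` remains after bounding the power of `c n`; it
        -- absorbs `M` and the power of the logarithm.
        chain : X *ᴿ T ≤ᴿ x ^ᴿ (j * Q) *ᴿ c n ^ᴿ (b * Q) *ᴿ T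
        chain = begin
          X *ᴿ T                                              ≤⟨ x≤x*y (*-nonNegative (0≤^ (j * Q) (0≤fromℕ (w * B))) (0≤^ (b * Q) (0≤fromℕ 2))) 1≤Aa ⟩
          X *ᴿ T *ᴿ (fromℕ A *ᴿ a^)                           ≡⟨ sym (*ᴿ-assoc _ _ _) ⟩
          X *ᴿ T *ᴿ fromℕ A *ᴿ a^                             ≡⟨ cong (_*ᴿ a^) XTA≡ ⟩
          fromℕ (M * B ^ (j * Q)) *ᴿ a^                       ≤⟨ *-monoʳ-≤ (0≤^ (b * Q) (proj₁ 0<a)) (fromℕ-mono-≤ MB≤n) ⟩
          x *ᴿ a^                                             ≤⟨ x≤x*y (*-nonNegative (0≤fromℕ n) (0≤^ (b * Q) (proj₁ 0<a)))
                                                                  (1≤^ b (**-lower 1≤x P q αQ≤P)) ⟩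
          x *ᴿ a^ *ᴿ ((z *ᴿ fromℕ 2) ^ᴿ Q *ᴿ x ^ᴿ P) ^ᴿ b
            ≡⟨ cong (x *ᴿ a^ *ᴿ_) (trans (^-distrib-* ((z *ᴿ fromℕ 2) ^ᴿ Q) (x ^ᴿ P) b) (cong₂ _*ᴿ_
                 (trans (^-assocʳ (z *ᴿ fromℕ 2) Q b) (trans (cong ((z *ᴿ fromℕ 2) ^ᴿ_) (ℕ.*-comm Q b)) (^-distrib-* z (fromℕ 2) (b * Q))))
                 (trans (^-assocʳ x P b) (cong (x ^ᴿ_) (ℕ.*-comm P b))))) ⟩
          x *ᴿ a^ *ᴿ (z ^ᴿ (b * Q) *ᴿ T *ᴿ x ^ᴿ (b * P))
            ≡⟨ solve 5 (λ x a z t y → x :* a :* (z :* t :* y) := x :* y :* (a :* z) :* t) refl x a^ (z ^ᴿ (b * Q)) T (x ^ᴿ (b * P)) ⟩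
          x ^ᴿ suc (b * P) *ᴿ (a^ *ᴿ z ^ᴿ (b * Q)) *ᴿ T
            ≡⟨ cong (λ u → x ^ᴿ suc (b * P) *ᴿ u *ᴿ T) (sym (^-distrib-* a z (b * Q))) ⟩
          x ^ᴿ suc (b * P) *ᴿ (a *ᴿ z) ^ᴿ (b * Q) *ᴿ T
            ≤⟨ *-monoʳ-≤ (0≤^ (b * Q) (0≤fromℕ 2)) (*-mono₂ (0≤^ (suc (b * P)) (0≤fromℕ n)) (0≤^ (b * Q) (*-nonNegative (proj₁ 0<a) 0≤z))
                 (^-monoʳ-≤ 1≤x bP<jQ) (^-monoˡ-≤ (b * Q) (*-nonNegative (proj₁ 0<a) 0≤z) (c-lower n (ℕ.≤-trans (ℕ.m≤m⊔n N₀ _) n≥)))) ⟩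
          x ^ᴿ (j * Q) *ᴿ c n ^ᴿ (b * Q) *ᴿ T                 ∎

    module _ (s k : ℕ) (1≤s : 1 ≤ s) (s≤k : s ≤ k) (subcritical : ∀ j → 1 ≤ j → j ≤ k → α *ᴿ fromℕ (j C s) <ᴿ fromℕ j) where

      private
        -- Chosen with `h + 1 = 3 k`, so that `(1 + 1/h) ^ t ≤ 3/2` for every `t ≤ k`; in this form
        -- its positivity holds by computation.
        h : ℕ
        h = 2 + 3 * ℕ.pred k
        1+h≡3k : suc h ≡ 3 * k
        1+h≡3k = positive (ℕ.≤-trans 1≤s s≤k)
          where
          positive : ∀ {k} → 1 ≤ k → suc (2 + 3 * ℕ.pred k) ≡ 3 * k
          positive {suc k} _ = sym (ℕ.*-suc 3 k)

      -- v vertices leave room for r = 3 (d + 1) log n cliques in the moment bound.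
      module _ (d : ℕ) where

        private
          u v : ℕ → ℕ
          u n = suc d * bits n
          v n = suc (3 * u n * k)
          w : ℕ
          w = suc (3 * suc d * k) * h

          vh≤ : ∀ n → v n * h ≤ w * suc (bits n)
          vh≤ n = linear-in-log (suc d) (bits n) k h

          Sparse : ℕ → Set
          Sparse n = ∀ j → j ≤ k → fromℕ (v n * h) ^ᴿ j ≤ᴿ fromℕ n ^ᴿ j *ᴿ c n ^ᴿ (j C s)

          sparse : Eventually Sparse
          sparse = eventually-∀≤ k λ
            -- For `j = 0` both sides are 1, because `s` is positive.
            { zero    _   → 0 , λ n _ → ≤ᴿ-reflexive (sym (trans (*ᴿ-identityˡ _) (cong (c n ^ᴿ_) (k>n⇒nCk≡0 1≤s))))
            ; (suc j) j<k → let (N , p) = polylog≤ w (suc j) (suc j C s) (subcritical (suc j) (s≤s z≤n) j<k)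
                            in N , λ n n≥ → ≤ᴿ-trans (^-monoˡ-≤ (suc j) (0≤fromℕ (v n * h)) (fromℕ-mono-≤ (vh≤ n))) (p n n≥)
            }

          -- The union bound runs over `k + 1` sizes. With `k + 1 ≤ n` this factor costs one power
          -- of `n`, which is why each tail is made as small as `n ^ (- (d + 1))`.
          Large : ℕ → Set
          Large n = Sparse n × (N₀ ℕ.⊔ suc k ≤ n)

        module _ (n : ℕ) (large : Large n) where

          private
            p : ℝ
            p = c n
            n>k : suc k ≤ n
            n>k = ℕ.≤-trans (ℕ.m≤n⊔m N₀ (suc k)) (proj₂ large)
            1≤n : 1 ≤ n
            1≤n = ℕ.≤-trans (s≤s z≤n) n>k
            0<p : 0ᴿ <ᴿ p
            0<p = 0<c n (ℕ.≤-trans (ℕ.m≤m⊔n N₀ (suc k)) (proj₂ large)) 1≤n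
            p≤1 : p ≤ᴿ 1ᴿ
            p≤1 = proj₂ (0≤c≤1 n)
            coins : ℕ
            coins = length (subsetsOfSize s n)
            graph : Subset coins → Hypergraph n s
            graph x = hypergraph x
            good : Subset coins → Bool
            good x = outputsCliques k (cutoffs s c n) (graph x)
            TooMany : ℕ → Subset coins → Set
            TooMany t x = cutoffs s c n t ≤ᴿ fromℕ (length (cl t (graph x)))
            tooMany : ℕ → Subset coins → Bool
            tooMany t x = does (cutoffs s c n t ≤ᴿ? fromℕ (length (cl t (graph x))))
            failure : ℝ
            failure = 1ᴿ -ᴿ Pr n p s (outputsCliques k (cutoffs s c n))
            sizes : List ℕ
            sizes = upTo (suc k)
            𝔼ₚ : (Subset coins → ℝ) → ℝ
            𝔼ₚ = 𝔼 p coins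

          tooMany-tail : ∀ t → t ≤ k → 𝔼ₚ (indicator ∘ tooMany t) *ᴿ fromℕ n ^ᴿ suc d ≤ᴿ 1ᴿ
          tooMany-tail t t≤k = begin
            𝔼ₚ (indicator ∘ tooMany t) *ᴿ fromℕ n ^ᴿ suc d       ≡⟨ cong₂ _*ᴿ_ (sym (flipPr≡𝔼 p coins (tooMany t))) (sym (fromℕ-^ n (suc d))) ⟩
            flipPr p coins (tooMany t) *ᴿ fromℕ (n ^ suc d)      ≤⟨ *-monoˡ-≤ 0≤pr (fromℕ-mono-≤ n^≤) ⟩
            flipPr p coins (tooMany t) *ᴿ fromℕ (2 ^ u n)        ≤⟨ CliqueMoments.tail-2^ R p 0<p p≤1 n s t (v n) h (λ j j≤t → proj₁ large j (ℕ.≤-trans j≤t t≤k))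
                                                                     1≤n (s≤s z≤n) (s≤s z≤n)
                                                                     (2[1+h]^t≤3h^t h t (ℕ.≤-trans (ℕ.*-monoʳ-≤ 3 t≤k) (ℕ.≤-reflexive (sym 1+h≡3k))))
                                                                     (u n) (ℕ.m≤n⇒m≤1+n (ℕ.*-monoʳ-≤ (3 * u n) t≤k)) ⟩
            1ᴿ                                                   ∎
            where
            n^≤ : n ^ suc d ≤ 2 ^ u n
            n^≤ = ℕ.≤-trans (ℕ.^-monoˡ-≤ (suc d) (n≤2^bits n))
                    (ℕ.≤-reflexive (trans (ℕ.^-*-assoc 2 (bits n) (suc d)) (cong (2 ^_) (ℕ.*-comm (bits n) (suc d)))))
            0≤pr : 0ᴿ ≤ᴿ flipPr p coins (tooMany t)
            0≤pr = subst₂ _≤ᴿ_ (𝔼-const p coins 0ᴿ) (sym (flipPr≡𝔼 p coins (tooMany t)))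
                     (𝔼-mono p (proj₁ 0<p) p≤1 coins (0≤indicator ∘ tooMany t))

          -- The union bound in pointwise form: a run that meets no cutoff succeeds. Taking
          -- expectations gives `failure≤`.
          good-or-tooMany : ∀ x → 1ᴿ ≤ᴿ indicator (good x) +ᴿ Σᴿ (λ t → indicator (tooMany t x)) sizes
          good-or-tooMany x = by-cases (any? (λ t → cutoffs s c n t ≤ᴿ? fromℕ (length (cl t (graph x)))) sizes)
            where
            total : List ℕ → ℝ
            total = Σᴿ (λ t → indicator (tooMany t x))
            0≤total : ∀ ts → 0ᴿ ≤ᴿ total ts
            0≤total ts = 0≤Σᴿ ts λ t → 0≤indicator (tooMany t x)
            x≤y+x : ∀ {x y} → 0ᴿ ≤ᴿ y → x ≤ᴿ y +ᴿ x
            x≤y+x {x} {y} 0≤y = subst (x ≤ᴿ_) (+ᴿ-comm x y) (x≤x+y 0≤y)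
            found⇒1≤ : ∀ {ts} → Any (λ t → TooMany t x) ts → 1ᴿ ≤ᴿ total ts
            found⇒1≤ {t ∷ ts} (here many) = ≤ᴿ-trans
              (≤ᴿ-reflexive (cong indicator (sym (dec-true (cutoffs s c n t ≤ᴿ? fromℕ (length (cl t (graph x)))) many))))
              (x≤x+y (0≤total ts))
            found⇒1≤ {t ∷ ts} (there found) = ≤ᴿ-trans (found⇒1≤ found) (x≤y+x (0≤indicator (tooMany t x)))
            by-cases : Dec (Any (λ t → TooMany t x) sizes) → 1ᴿ ≤ᴿ indicator (good x) +ᴿ total sizes
            by-cases (yes found) = ≤ᴿ-trans (found⇒1≤ found) (x≤y+x (0≤indicator (good x)))
            by-cases (no ¬found) = ≤ᴿ-trans
              (≤ᴿ-reflexive (cong indicator (sym (Correctness.outputsCliques-true R (graph x) k (cutoffs s c n) 1≤s s≤k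
                (λ i _ i≤k many → ¬found (lose (∈-upTo⁺ (s≤s i≤k)) many))))))
              (x≤x+y (0≤total sizes))

          failure≤ : failure ≤ᴿ Σᴿ (λ t → 𝔼ₚ (indicator ∘ tooMany t)) sizes
          failure≤ = +-cancelʳ-≤ (flipPr p coins good) (begin
            failure +ᴿ flipPr p coins good                          ≡⟨ x-y+y≡x 1ᴿ _ ⟩
            1ᴿ                                                      ≡⟨ sym (𝔼-const p coins 1ᴿ) ⟩
            𝔼ₚ (λ _ → 1ᴿ)                                           ≤⟨ 𝔼-mono p (proj₁ 0<p) p≤1 coins good-or-tooMany ⟩
            𝔼ₚ (λ x → indicator (good x) +ᴿ Σᴿ (λ t → indicator (tooMany t x)) sizes)
              ≡⟨ 𝔼-+ p coins _ _ ⟩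
            𝔼ₚ (indicator ∘ good) +ᴿ 𝔼ₚ (λ x → Σᴿ (λ t → indicator (tooMany t x)) sizes)
              ≡⟨ cong₂ _+ᴿ_ (sym (flipPr≡𝔼 p coins good)) (𝔼-Σᴿ p coins (λ t → indicator ∘ tooMany t) sizes) ⟩
            flipPr p coins good +ᴿ Σᴿ (λ t → 𝔼ₚ (indicator ∘ tooMany t)) sizes
              ≡⟨ +ᴿ-comm _ _ ⟩
            Σᴿ (λ t → 𝔼ₚ (indicator ∘ tooMany t)) sizes +ᴿ flipPr p coins good ∎)

          failure*n^d≤1 : failure *ᴿ fromℕ n ^ᴿ d ≤ᴿ 1ᴿ
          failure*n^d≤1 = *-cancelʳ-≤ (fromℕ n) (0<fromℕ 1≤n) (begin
            failure *ᴿ fromℕ n ^ᴿ d *ᴿ fromℕ n                                    ≡⟨ trans (*ᴿ-assoc _ _ _) (cong (failure *ᴿ_) (*ᴿ-comm _ _)) ⟩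
            failure *ᴿ fromℕ n ^ᴿ suc d                                           ≤⟨ *-monoʳ-≤ (0≤^ (suc d) (0≤fromℕ n)) failure≤ ⟩
            Σᴿ (λ t → 𝔼ₚ (indicator ∘ tooMany t)) sizes *ᴿ fromℕ n ^ᴿ suc d       ≡⟨ Σᴿ-*ʳ _ _ sizes ⟩
            Σᴿ (λ t → 𝔼ₚ (indicator ∘ tooMany t) *ᴿ fromℕ n ^ᴿ suc d) sizes       ≤⟨ Σᴿ≤length sizes (λ t∈ → tooMany-tail _ (ℕ.s≤s⁻¹ (∈-upTo⁻ t∈))) ⟩
            fromℕ (length sizes)                                                  ≤⟨ fromℕ-mono-≤ (subst (_≤ n) (sym (List.length-upTo (suc k))) n>k) ⟩
            fromℕ n                                                               ≡⟨ sym (*ᴿ-identityˡ _) ⟩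
            1ᴿ *ᴿ fromℕ n                                                         ∎)

          failure-small : -ᴿ ((fromℕ n ⁻¹) ^ᴿ d) ≤ᴿ failure × failure ≤ᴿ (fromℕ n ⁻¹) ^ᴿ d
          failure-small = lower , *-cancelʳ-≤ (fromℕ n ^ᴿ d) (0<^ d 0<n) (≤ᴿ-trans failure*n^d≤1 (≤ᴿ-reflexive (sym inverse)))
            where
            0<n : 0ᴿ <ᴿ fromℕ n
            0<n = 0<fromℕ 1≤n
            inverse : (fromℕ n ⁻¹) ^ᴿ d *ᴿ fromℕ n ^ᴿ d ≡ 1ᴿ
            inverse = trans (sym (^-distrib-* (fromℕ n ⁻¹) (fromℕ n) d)) (trans (cong (_^ᴿ d) (⁻¹-inverseˡ 0<n)) (1^n≡1 d))
            indicator≤1 : ∀ b → indicator b ≤ᴿ 1ᴿ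
            indicator≤1 true  = ≤ᴿ-refl
            indicator≤1 false = 0≤1
            0≤failure : 0ᴿ ≤ᴿ failure
            0≤failure = x≤y⇒0≤y-x (subst₂ _≤ᴿ_ (sym (flipPr≡𝔼 p coins good)) (𝔼-const p coins 1ᴿ)
              (𝔼-mono p (proj₁ 0<p) p≤1 coins (indicator≤1 ∘ good)))
            lower : -ᴿ ((fromℕ n ⁻¹) ^ᴿ d) ≤ᴿ failure
            lower = ≤ᴿ-trans (+-cancelʳ-≤ ((fromℕ n ⁻¹) ^ᴿ d) (begin
              -ᴿ ((fromℕ n ⁻¹) ^ᴿ d) +ᴿ (fromℕ n ⁻¹) ^ᴿ d     ≡⟨ +ᴿ-inverseˡ _ ⟩
              0ᴿ                                              ≤⟨ 0≤^ d (proj₁ (0<x⁻¹ 0<n)) ⟩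
              (fromℕ n ⁻¹) ^ᴿ d                               ≡⟨ sym (+ᴿ-identityˡ _) ⟩
              0ᴿ +ᴿ (fromℕ n ⁻¹) ^ᴿ d                         ∎)) 0≤failure

        eventually-failure-small : Eventually (λ n → -ᴿ ((fromℕ n ⁻¹) ^ᴿ d) ≤ᴿ 1ᴿ -ᴿ Pr n (c n) s (outputsCliques k (cutoffs s c n)) ×
                                                     1ᴿ -ᴿ Pr n (c n) s (outputsCliques k (cutoffs s c n)) ≤ᴿ (fromℕ n ⁻¹) ^ᴿ d)
        eventually-failure-small = let (N , large) = eventually-× sparse (N₀ ℕ.⊔ suc k , λ _ n≥ → n≥) in
          N , λ n n≥ → failure-small n (large n n≥)

      failure-negligible : Negligible (λ n → 1ᴿ -ᴿ Pr n (c n) s (outputsCliques k (cutoffs s c n)))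
      failure-negligible = eventually-failure-small

  -- By absorption, `s (j C s) = j ((j - 1) C (s - 1))`, so `α (j C s) < j` is equivalent to
  -- `α ((j - 1) C (s - 1)) < s`. The latter holds for `j - 1 ≤ κ` by monotonicity, whence the range
  -- up to `κ + 1`.
  subcritical-below-κ : ∀ {α} t κ → 0ᴿ ≤ᴿ α → α *ᴿ fromℕ (κ C t) <ᴿ fromℕ (suc t) →
    ∀ j → 1 ≤ j → j ≤ suc κ → α *ᴿ fromℕ (j C suc t) <ᴿ fromℕ j
  subcritical-below-κ {α} t κ 0≤α critical (suc j) 1≤j (s≤s j≤κ) = ≰⇒> λ j≤αC → <⇒≰ critical
    (≤ᴿ-trans (*-cancelˡ-≤ (fromℕ (suc j)) (0<fromℕ-suc j) (begin
      fromℕ (suc j) *ᴿ fromℕ (suc t)                       ≤⟨ *-monoʳ-≤ (0≤fromℕ (suc t)) j≤αC ⟩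
      α *ᴿ fromℕ (suc j C suc t) *ᴿ fromℕ (suc t)          ≡⟨ trans (*ᴿ-assoc _ _ _) (cong (α *ᴿ_) (trans (sym (fromℕ-* (suc j C suc t) (suc t)))
                                                               (cong fromℕ (trans (ℕ.*-comm (suc j C suc t) (suc t)) ([k+1]*[n+1]C[k+1]≡[n+1]*nCk j t))))) ⟩
      α *ᴿ fromℕ (suc j * (j C t))                         ≡⟨ cong (α *ᴿ_) (fromℕ-* (suc j) (j C t)) ⟩
      α *ᴿ (fromℕ (suc j) *ᴿ fromℕ (j C t))                ≡⟨ solve 3 (λ a j x → a :* (j :* x) := j :* (a :* x)) refl α (fromℕ (suc j)) (fromℕ (j C t)) ⟩
      fromℕ (suc j) *ᴿ (α *ᴿ fromℕ (j C t))                ∎))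
    (*-monoˡ-≤ 0≤α (fromℕ-mono-≤ (C-mono-≤ t j≤κ))))

theorem5p6 : (R : Reals) → let open Reals R in let open WithReals R in
    (s k : ℕ) → 2 ≤ s → s ≤ k →
    (α : ℝ) → 0ᴿ <ᴿ α → α <ᴿ 1ᴿ →
    (c : ℕ → ℝ) → (∀ n → 0ᴿ ≤ᴿ c n × c n ≤ᴿ 1ᴿ) →
    c =Θ (λ n → fromℕ n ** (-ᴿ α)) →
    (τ κ : ℕ) →
    IsLargest (λ m → α *ᴿ fromℕ (m C (s ∸ 1)) <ᴿ 1ᴿ) τ →
    IsLargest (λ m → α *ᴿ fromℕ (m C (s ∸ 1)) <ᴿ fromℕ s) κ →
    (((τ + 2 ≤ k × k ≤ κ + 1) ⊎ k < τ + 2) →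
    Negligible (λ n → 1ᴿ -ᴿ Pr n (c n) s (outputsCliques k (cutoffs s c n))))
    ×
    (τ + 2 ≤ k → k ≤ κ + 1 →
    RunsInO s k (cutoffs s c) (λ n → fromℕ n ** (fromℕ (τ + 2) -ᴿ α *ᴿ fromℕ ((τ + 1) C s))))
    ×
    (k < τ + 2 →
    RunsInO s k (cutoffs s c) (λ n → fromℕ n ** (fromℕ k -ᴿ α *ᴿ fromℕ ((k ∸ 1) C s))))
theorem5p6 R (suc t) (suc k′) 2≤s s≤k α 0<α α<1 c 0≤c≤1 c=Θ τ κ τ-largest κ-largest =
  negligible , runtime₁ , runtime₂
  where
  open OrderedField R
  open WithReals R
  open Runtime R
  k : ℕ
  k = suc k′
  k≤1+κ : ((τ + 2 ≤ k × k ≤ κ + 1) ⊎ k < τ + 2) → k ≤ suc κ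
  k≤1+κ (inj₁ (_ , k≤)) = subst (k ≤_) (ℕ.+-comm κ 1) k≤
  -- Here `k ≤ τ + 1`, and `τ ≤ κ` because the bound 1 defining τ is at most the bound `s` defining
  -- κ.
  k≤1+κ (inj₂ k<)       = ℕ.≤-trans (ℕ.s≤s⁻¹ (subst (k <_) (ℕ.+-comm τ 2) k<)) (s≤s τ≤κ)
    where
    τ≤κ : τ ≤ κ
    τ≤κ = proj₂ κ-largest τ (<-≤-trans (proj₁ τ-largest) (1≤fromℕ {suc t} (s≤s z≤n)))
  negligible : ((τ + 2 ≤ k × k ≤ κ + 1) ⊎ k < τ + 2) →
    Negligible (λ n → 1ᴿ -ᴿ Pr n (c n) (suc t) (outputsCliques k (cutoffs (suc t) c n)))
  negligible cases = Concentration.failure-negligible R 0<α c 0≤c≤1 c=Θ (suc t) k (s≤s z≤n) s≤k λ j 1≤j j≤k →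
    Concentration.subcritical-below-κ R t κ (proj₁ 0<α) (proj₁ κ-largest) j 1≤j (ℕ.≤-trans j≤k (k≤1+κ cases))
  runtime₁ : τ + 2 ≤ k → k ≤ κ + 1 →
    RunsInO (suc t) k (cutoffs (suc t) c) (λ n → fromℕ n ** (fromℕ (τ + 2) -ᴿ α *ᴿ fromℕ ((τ + 1) C suc t)))
  runtime₁ _ _ = subst₂ (λ e m → RunsInO (suc t) k (cutoffs (suc t) c) (λ n → fromℕ n ** (fromℕ e -ᴿ α *ᴿ fromℕ (m C suc t))))
    (ℕ.+-comm 2 τ) (ℕ.+-comm 1 τ) (runs-in-peak 0<α c 0≤c≤1 c=Θ t k (suc τ) s≤k λ i _ _ → dominated i)
    where
    dominated : ∀ i → fromℕ (suc i) +ᴿ α *ᴿ fromℕ (suc τ C suc t) ≤ᴿ fromℕ (suc (suc τ)) +ᴿ α *ᴿ fromℕ (i C suc t)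
    dominated i with ℕ.≤-total i (suc τ)
    ... | inj₁ i≤ = dominated-before (proj₁ 0<α) t τ τ-largest i≤ ℕ.≤-refl
    ... | inj₂ i≥ = dominated-after (proj₁ 0<α) t τ τ-largest i≥
  runtime₂ : k < τ + 2 →
    RunsInO (suc t) k (cutoffs (suc t) c) (λ n → fromℕ n ** (fromℕ k -ᴿ α *ᴿ fromℕ (k′ C suc t)))
  -- Only sets of size at most `k - 1 ≤ τ` are extended, so all exponents lie in the rising range
  -- and the last one dominates.
  runtime₂ k< = runs-in-peak 0<α c 0≤c≤1 c=Θ t k k′ s≤k λ i _ i<k →
    dominated-before (proj₁ 0<α) t τ τ-largest (ℕ.s≤s⁻¹ i<k) (ℕ.<⇒≤ (ℕ.s≤s⁻¹ (subst (k <_) (ℕ.+-comm τ 2) k<)))
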